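{- Let $n\ge 4$ and $k\ge 1$ with $n-k\ge 2$. Then the arrangement graph $A_{n,k}$ is super spanning connected: for every integer $l$ with $1\le l\le k(n-k)$ and every pair of distinct vertices $u,v$ of $A_{n,k}$, there is an $l^*$-container of $A_{n,k}$ between $u$ and $v$.
   Context: For integers $n>k\ge 1$, let $\langle n\rangle=\{1,\dots,n\}$. The arrangement graph $A_{n,k}$ has vertex set the set of all sequences $u=u_1u_2\cdots u_k$ with $u_i\in\langle n\rangle$ and $u_i\ne u_j$ for $i\ne j$, and two vertices are adjacent iff they differ in exactly one position; it is $k(n-k)$-regular with connectivity $k(n-k)$. A $k$-container $C(u,v)$ of a graph $G$ is a set of $k$ internally vertex-disjoint paths between $u$ and $v$. A $k$-container is a $k^*$-container if the union of its paths contains every vertex of $G$. $G$ is $k^*$-connected if there is a $k^*$-container between any two distinct vertices of $G$. A graph $G$ is super spanning connected if it is $l^*$-connected for all $1\le l\le\kappa(G)$, where $\kappa(G)$ is its connectivity. -}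

module Defs where

open import Data.Fin using (Fin)
open import Data.List using (List; _∷_; _∷ʳ_; length)
open import Data.List.Membership.Propositional using (_∈_; _∉_)
open import Data.List.Relation.Binary.Disjoint.Propositional using (Disjoint)
open import Data.List.Relation.Unary.Linked using (Linked)
import Data.List.Relation.Unary.Unique.Propositional as List
open import Data.Nat using (ℕ; _≤_)
open import Data.Product using (∃; ∃!; ∃-syntax; _×_; _,_)
open import Data.Refinement using (Refinement-syntax; value)
open import Data.Sum using (_⊎_)
open import Data.Vec using (Vec; lookup)
import Data.Vec.Relation.Unary.Unique.Propositional as Vec
open import Function using (_∘_)
open import Relation.Binary.PropositionalEquality using (_≡_; _≢_; refl; sym)
open import Relation.Nullary using (¬_)

record Graph : Set₁ where
  field
    Vertex   : Set
    _~_      : Vertex → Vertex → Set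
    ~-sym    : ∀ {u v} → u ~ v → v ~ u
    ~-irrefl : ∀ {u} → ¬ (u ~ u)

open Graph using (Vertex)

record Path (G : Graph) (u v : Vertex G) : Set where
  open Graph G using (_~_)
  field
    internal : List (Vertex G)

  vertices : List (Vertex G)
  vertices = u ∷ internal ∷ʳ v

  field
    linked : Linked _~_ vertices
    unique : List.Unique vertices

open Path using (internal; vertices)

-- The paths form a set of size l, hence `distinct`.  It does not follow from
-- `disjoint`: a single edge has no internal vertices, so repeating it would
-- satisfy `disjoint`.
record Container (G : Graph) (l : ℕ) (u v : Vertex G) : Set where
  field
    path     : Fin l → Path G u v
    distinct : ∀ {i j} → i ≢ j → vertices (path i) ≢ vertices (path j)
    disjoint : ∀ {i j} → i ≢ j → Disjoint (internal (path i)) (internal (path j))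

open Container using (path)

Spanning : ∀ {G l u v} → Container G l u v → Set
Spanning {G} C = ∀ (w : Vertex G) → ∃[ i ] w ∈ vertices (path C i)

_*-Container : ℕ → (G : Graph) → Vertex G → Vertex G → Set
(l *-Container) G u v = ∃ λ (C : Container G l u v) → Spanning C

_*-Connected : ℕ → Graph → Set
(l *-Connected) G = ∀ (u v : Vertex G) → u ≢ v → (l *-Container) G u v

Connected : Graph → Set
Connected G = ∀ (u v : Vertex G) → u ≢ v → Path G u v

Trivial : Graph → Set
Trivial G = ∀ (u v : Vertex G) → u ≡ v

_─_ : (G : Graph) → List (Vertex G) → Graph
G ─ S = record
  { Vertex   = [ v ∈ Vertex G ∣ v ∉ S ]
  ; _~_      = λ u v → value u ~ value v
  ; ~-sym    = ~-sym
  ; ~-irrefl = ~-irrefl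
  }
  where open Graph G using (_~_; ~-sym; ~-irrefl)

-- Allowing G ─ S to be trivial is the usual convention that makes the
-- connectivity of the complete graph on n vertices equal to n - 1.
Separates : (G : Graph) → List (Vertex G) → Set
Separates G S = List.Unique S × (¬ Connected (G ─ S) ⊎ Trivial (G ─ S))

-- κ = κ(G), the minimum size of a separating set.
IsConnectivity : Graph → ℕ → Set
IsConnectivity G κ =
  (∃[ S ] Separates G S × length S ≡ κ) × (∀ S → Separates G S → κ ≤ length S)

SuperSpanningConnected : Graph → Set
SuperSpanningConnected G =
  ∀ κ → IsConnectivity G κ → ∀ l → 1 ≤ l → l ≤ κ → (l *-Connected) G

ArrangementVertex : ℕ → ℕ → Set
ArrangementVertex n k = [ u ∈ Vec (Fin n) k ∣ Vec.Unique u ]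

DifferAt : ∀ {n k} → ArrangementVertex n k → ArrangementVertex n k → Fin k → Set
DifferAt u v i = lookup (value u) i ≢ lookup (value v) i

A : ℕ → ℕ → Graph
A n k = record
  { Vertex   = ArrangementVertex n k
  ; _~_      = λ u v → ∃! _≡_ (DifferAt u v)
  ; ~-sym    = λ { (i , d , only) → i , d ∘ sym , λ d′ → only (d′ ∘ sym) }
  ; ~-irrefl = λ { (_ , d , _) → d refl }
  }

-- Fixing the entry at one position p splits the arrangement graph into copies of a smaller one with the
-- same n − k.  By induction on k one proves together that spanning containers exist between adjacent
-- vertices with arbitrarily prescribed first vertices, and between non-adjacent vertices with any number
-- of paths.  Adjacent vertices lie in a common copy for some p, and the other copies are absorbed by
-- leaving and re-entering it.  For non-adjacent u and v take p with a = u_p ≠ v_p = b, a neighbour s of u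
-- in the copy of u, and its image s* in the copy of v.  A container between s* and v reaches a set Z of
-- neighbours of s*, and the prescribed version joins u to the corresponding neighbours of s.  These are
-- adjacent to Z, except that s with b at j has to be joined to s* with a at j by a path through another
-- copy; such paths, and those leaving u directly, sweep up all the remaining copies.  Only A 4 2 is too
-- small for this, and is settled by explicit certificates.
module Submission where

open import Defs
import Algebra.Solver.CommutativeMonoid as CommutativeMonoidSolver
open import Data.Empty using (⊥; ⊥-elim-irr)
open import Data.Fin using (Fin; zero; suc; _≟_; inject≤)
import Data.Fin.Properties as Fin
open import Data.Irrelevant using () renaming ([_] to irrelevant)
open import Data.List
  using (List; []; _∷_; [_]; _++_; _∷ʳ_; map; concat; length; take; drop; filter; zip; allFin; cartesianProduct)
import Data.List as L
open import Data.List.Membership.Propositional using (_∈_; _∉_; find)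
open import Data.List.Membership.Propositional.Properties
  using ( ∈-++⁺ˡ; ∈-++⁺ʳ; ∈-++⁻; ∈-∃++; ∈-map⁺; ∈-map⁻; ∈-filter⁺; ∈-filter⁻; ∈-allFin; ∈-lookup
        ; ∈-cartesianProduct⁺; ∈-cartesianProduct⁻)
open import Data.List.Properties
  using ( length-++; length-map; length-take; length-drop; length-tabulate; take++drop≡id
        ; map-++; map-∘; ++-identityʳ; ++-assoc; ∷-injective; ∷ʳ-injective)
open import Data.List.Relation.Binary.Disjoint.Propositional using (Disjoint)
open import Data.List.Relation.Binary.Permutation.Propositional
  using (_↭_; refl; prep; swap; trans; ↭-refl; ↭-sym; ↭-trans; ↭-reflexive)
open import Data.List.Relation.Binary.Permutation.Propositional.Properties
  using ( All-resp-↭; ∈-resp-↭; ↭-length; ++⁺; ++⁺ˡ; ++⁺ʳ; shift; drop-∷; ↭-singleton-inv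
        ; ++-comm; ++-commutativeMonoid)
  renaming (map⁺ to ↭-map)
open import Data.List.Relation.Binary.Pointwise using (Pointwise; []; _∷_)
open import Data.List.Relation.Binary.Subset.Propositional using (_⊆_)
open import Data.List.Relation.Unary.All as All using (All; []; _∷_)
import Data.List.Relation.Unary.All.Properties as All
open import Data.List.Relation.Unary.AllPairs as AllPairs using ([]; _∷_)
open import Data.List.Relation.Unary.Any using (here; there)
open import Data.List.Relation.Unary.Linked as Linked using (Linked; []; [-]; _∷_)
import Data.List.Relation.Unary.Unique.Propositional as List
import Data.List.Relation.Unary.Unique.Propositional.Properties as Unique
open import Data.Nat using (ℕ; zero; suc; _+_; _*_; _∸_; _≤_; _<_; z≤n; s≤s)
import Data.Nat.Properties as ℕ
open import Data.Product using (∃; _×_; _,_; proj₁; proj₂)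
import Data.Product.Properties as Product
open import Data.Refinement using (value; value-injective; _,_)
open import Data.Sum using (_⊎_; inj₁; inj₂; [_,_]′)
open import Data.Vec using (Vec; lookup; tabulate; _[_]≔_)
open import Data.Vec.Properties using (lookup∘update; lookup∘update′; ≡-dec; tabulate∘lookup; lookup∘tabulate)
import Data.Vec.Relation.Binary.Pointwise.Extensional as Extensional
import Data.Vec.Relation.Unary.AllPairs as VecPairs
import Data.Vec.Relation.Unary.Unique.Propositional as Vec
import Data.Vec.Relation.Unary.Unique.Propositional.Properties as VecUnique
open import Function using (_∘_; id)
open import Relation.Binary.PropositionalEquality using (_≡_; _≢_; refl; sym; cong; cong₂; subst; module ≡-Reasoning)
  renaming (trans to ≡-trans)
open import Relation.Nullary using (¬_; Dec; yes; no; contradiction; ¬?; recompute)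
open import Relation.Nullary.Decidable using (True; toWitness; _×-dec_; _⊎-dec_; _→-dec_)

-- Which start is joined to which end is left open: every path begins next to `u` and finishes next
-- to `v`, so any pairing will do. Leading the paths through other copies thus becomes a matter of
-- counting: each copy gets at most one start and at most one end, and pigeonhole pairs them off.
-- Idle copies can be absorbed only by a path that changes copies, hence the recurring demand for a
-- copy with an end but no start, unless every copy has a start. The tight case is the full degree.
-- The middle copies, those of neither `u` nor `v`, number `length P′ + m - 1`; the `length P′ - 1`
-- exchanges and `m` direct entries into `v` need an end in each of them. This works if `u ! p`
-- recurs in `v`; otherwise a position where `u` and `v` agree, or, when they share no symbol in the
-- face, an entry into `v` from the copy of `u`, has to help. The neighbours of a vertex form a
-- separating set, so the connectivity is at most `k * (n - k)`, and super spanning connectivity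
-- follows from the second half of the theorem.

module ↭-Solver {A : Set} = CommutativeMonoidSolver (++-commutativeMonoid {A = A})

-- Repetition-free lists up to permutation

module _ {A : Set} where

  ∷⁻-∈ : ∀ {x y : A} {ys} → x ∈ y ∷ ys → x ≢ y → x ∈ ys
  ∷⁻-∈ (here x≡y) x≢y = contradiction x≡y x≢y
  ∷⁻-∈ (there x∈) _ = x∈

  Unique-resp-↭ : ∀ {xs ys : List A} → xs ↭ ys → List.Unique xs → List.Unique ys
  Unique-resp-↭ refl u = u
  Unique-resp-↭ (prep x p) (x∉ ∷ u) = All-resp-↭ p x∉ ∷ Unique-resp-↭ p u
  Unique-resp-↭ (swap x y p) ((x≢y ∷ x∉) ∷ y∉ ∷ u) =
    (x≢y ∘ sym ∷ All-resp-↭ p y∉) ∷ All-resp-↭ p x∉ ∷ Unique-resp-↭ p u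
  Unique-resp-↭ (trans p q) u = Unique-resp-↭ q (Unique-resp-↭ p u)

  unique-++⁻ˡ : ∀ (xs : List A) {ys} → List.Unique (xs ++ ys) → List.Unique xs
  unique-++⁻ˡ [] _ = []
  unique-++⁻ˡ (x ∷ xs) (x∉ ∷ u) = All.++⁻ˡ xs x∉ ∷ unique-++⁻ˡ xs u

  unique-++⁻ʳ : ∀ (xs : List A) {ys} → List.Unique (xs ++ ys) → List.Unique ys
  unique-++⁻ʳ [] u = u
  unique-++⁻ʳ (x ∷ xs) (_ ∷ u) = unique-++⁻ʳ xs u

  unique-++⁻-disjoint : ∀ (xs : List A) {ys} → List.Unique (xs ++ ys) → Disjoint xs ys
  unique-++⁻-disjoint (x ∷ xs) (x∉ ∷ u) (here refl , y∈) = All.lookup (All.++⁻ʳ xs x∉) y∈ refl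
  unique-++⁻-disjoint (x ∷ xs) (x∉ ∷ u) (there x∈ , y∈) = unique-++⁻-disjoint xs u (x∈ , y∈)

  unique-∉ : ∀ {x : A} {xs} → List.Unique (x ∷ xs) → x ∉ xs
  unique-∉ (x∉ ∷ _) x∈ = All.lookup x∉ x∈ refl

  ∉⇒All≢ : ∀ {x : A} {xs} → x ∉ xs → All (x ≢_) xs
  ∉⇒All≢ x∉ = All.tabulate λ { y∈ refl → x∉ y∈ }

  unique-∷ : ∀ {x : A} {xs} → x ∉ xs → List.Unique xs → List.Unique (x ∷ xs)
  unique-∷ x∉ u = ∉⇒All≢ x∉ ∷ u

  ∈-↭ : ∀ {x : A} {ys} → x ∈ ys → ∃ λ zs → ys ↭ x ∷ zs
  ∈-↭ x∈ with as , bs , refl ← ∈-∃++ x∈ = as ++ bs , shift _ as bs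

  -- Completes a repetition-free sublist to the whole list; comparing lengths through `rest` yields
  -- the counting lemmas that follow.
  extract : ∀ {xs ys : List A} → List.Unique xs → xs ⊆ ys → ∃ λ rest → ys ↭ xs ++ rest
  extract [] _ = _ , ↭-refl
  extract {x ∷ xs} (x∉ ∷ u) xs⊆ with ∈-↭ (xs⊆ (here refl))
  ... | ys′ , ys↭ with extract u (λ w∈ → ∷⁻-∈ (∈-resp-↭ ys↭ (xs⊆ (there w∈))) (All.lookup x∉ w∈ ∘ sym))
  ... | rest , ys′↭ = rest , ↭-trans ys↭ (prep x ys′↭)

  ⊆-length : ∀ {xs ys : List A} → List.Unique xs → xs ⊆ ys → length xs ≤ length ys
  ⊆-length {xs} u xs⊆ with rest , p ← extract u xs⊆
    rewrite ↭-length p | length-++ xs {rest} = ℕ.m≤m+n _ _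

  ⊆-length⇒↭ : ∀ {xs ys : List A} → List.Unique xs → xs ⊆ ys → length ys ≤ length xs → ys ↭ xs
  ⊆-length⇒↭ {xs} u xs⊆ le with extract u xs⊆
  ... | [] , p = ↭-trans p (↭-reflexive (++-identityʳ xs))
  ... | r ∷ rest , p rewrite ↭-length p | length-++ xs {r ∷ rest} =
    contradiction le (ℕ.<⇒≱ (ℕ.m<m+n (length xs) (s≤s z≤n)))

  ⊆-⊇⇒↭ : ∀ {xs ys : List A} → List.Unique xs → List.Unique ys → xs ⊆ ys → ys ⊆ xs → xs ↭ ys
  ⊆-⊇⇒↭ ux uy xs⊆ ys⊆ = ⊆-length⇒↭ uy ys⊆ (⊆-length ux xs⊆)

  take-⊆ : ∀ i (xs : List A) → take i xs ⊆ xs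
  take-⊆ i xs x∈ = subst (_ ∈_) (take++drop≡id i xs) (∈-++⁺ˡ x∈)

  length-take-≤ : ∀ i (xs : List A) → i ≤ length xs → length (take i xs) ≡ i
  length-take-≤ i xs le = ≡-trans (length-take i xs) (ℕ.m≤n⇒m⊓n≡m le)

module _ {A B : Set} where

  unique-map : ∀ {f : A → B} {xs} →
    (∀ {x y} → x ∈ xs → y ∈ xs → f x ≡ f y → x ≡ y) → List.Unique xs → List.Unique (map f xs)
  unique-map inj [] = []
  unique-map {f = f} inj (x∉ ∷ u) =
    unique-∷ (λ fx∈ → let y , y∈ , eq = ∈-map⁻ f fx∈ in
                      All.lookup x∉ y∈ (inj (here refl) (there y∈) eq))
             (unique-map (λ x∈ y∈ → inj (there x∈) (there y∈)) u)

module _ {A : Set} (_≟_ : ∀ (x y : A) → Dec (x ≡ y)) where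
  open import Data.List.Membership.DecPropositional _≟_ using (_∈?_)

  -- The pigeonhole principle, by which symbols, copies and neighbours are chosen below.
  pickFresh : ∀ {xs : List A} → List.Unique xs → ∀ as → suc (length as) ≤ length xs →
    ∃ λ w → w ∈ xs × w ∉ as
  pickFresh {xs} u as le with All.all? (_∈? as) xs
  ... | yes all = contradiction (⊆-length u (All.lookup all)) (ℕ.<⇒≱ le)
  ... | no ¬all = find (All.¬All⇒Any¬ (_∈? as) xs ¬all)

-- Walks and linkages

module Linking {V : Set} (_~_ : V → V → Set) (~-sym : ∀ {u v} → u ~ v → v ~ u) where

  data Walk : V → V → List V → Set where
    stop : ∀ {x} → Walk x x [ x ]
    step : ∀ {x w y zs} → x ~ w → Walk w y zs → Walk x y (x ∷ zs)

  infixr 5 _∷_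

  data Links : List V → List V → List V → Set where
    []  : Links [] [] []
    _∷_ : ∀ {x y zs X Y B} → Walk x y zs → Links X Y B → Links (x ∷ X) (y ∷ Y) (zs ++ B)

  -- The starts X are joined to the ends Y in an unspecified order.  Vertex-disjointness is not part of
  -- the definition: it follows once the bag B of all vertices is known to be repetition-free.
  record Linkage (X Y B : List V) : Set where
    constructor linkage
    field
      {starts ends bag} : List V
      X↭ : X ↭ starts
      Y↭ : Y ↭ ends
      B↭ : B ↭ bag
      links : Links starts ends bag

  open Linkage

  join : ∀ {x p q y zs zs′} → Walk x p zs → p ~ q → Walk q y zs′ → Walk x y (zs ++ zs′)
  join stop p~q P = step p~q P
  join (step x~w P) p~q P′ = step x~w (join P p~q P′)

  snoc : ∀ {x y z zs} → Walk x y zs → y ~ z → Walk x z (zs ++ [ z ])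
  snoc P y~z = join P y~z stop

  reverseWalk : ∀ {x y zs} → Walk x y zs → ∃ λ zs′ → zs ↭ zs′ × Walk y x zs′
  reverseWalk stop = _ , ↭-refl , stop
  reverseWalk (step {x} x~w P) with zs′ , p , P′ ← reverseWalk P =
    zs′ ++ [ x ] , ↭-trans (prep x p) (++-comm [ x ] zs′) , snoc P′ (~-sym x~w)

  start∈ : ∀ {x y zs} → Walk x y zs → x ∈ zs
  start∈ stop = here refl
  start∈ (step _ _) = here refl

  end∈ : ∀ {x y zs} → Walk x y zs → y ∈ zs
  end∈ stop = here refl
  end∈ (step _ P) = there (end∈ P)

  splitWalk : ∀ {x y zs v} → Walk x y zs → v ∈ zs →
    v ≡ y ⊎ (∃ λ h → ∃ λ as → ∃ λ bs → v ~ h × zs ≡ as ++ bs × Walk x v as × Walk h y bs)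
  splitWalk stop (here refl) = inj₁ refl
  splitWalk (step x~w P) (here refl) = inj₂ (_ , _ , _ , x~w , refl , stop , P)
  splitWalk (step x~w P) (there v∈) with splitWalk P v∈
  ... | inj₁ eq = inj₁ eq
  ... | inj₂ (h , as , bs , v~h , refl , P₁ , P₂) = inj₂ (h , _ ∷ as , bs , v~h , refl , step x~w P₁ , P₂)

  permuteStarts : ∀ {X X′ Y B} → X ↭ X′ → Links X Y B →
    ∃ λ Y′ → ∃ λ B′ → Y ↭ Y′ × B ↭ B′ × Links X′ Y′ B′
  permuteStarts refl L = _ , _ , ↭-refl , ↭-refl , L
  permuteStarts (prep x p) (_∷_ {zs = zs} P L) with _ , _ , q , r , L′ ← permuteStarts p L =
    _ , _ , prep _ q , ++⁺ˡ zs r , P ∷ L′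
  permuteStarts (swap x y p) (_∷_ {zs = zs} P (_∷_ {zs = zs′} {B = B} P′ L))
    with _ , B′ , q , r , L′ ← permuteStarts p L =
    _ , _ , swap _ _ q ,
    ↭-trans (++⁺ˡ zs (++⁺ˡ zs′ r)) (S.solve 3 (λ a b c → a S.⊕ (b S.⊕ c) S.⊜ b S.⊕ (a S.⊕ c)) refl zs zs′ B′) ,
    P′ ∷ P ∷ L′
    where module S = ↭-Solver {V}
  permuteStarts (trans p p′) L
    with _ , _ , q , r , L′ ← permuteStarts p L
    with _ , _ , q′ , r′ , L″ ← permuteStarts p′ L′ =
    _ , _ , ↭-trans q q′ , ↭-trans r r′ , L″

  reverseLinks : ∀ {X Y B} → Links X Y B → ∃ λ B′ → B ↭ B′ × Links Y X B′
  reverseLinks [] = _ , ↭-refl , []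
  reverseLinks (P ∷ L) with _ , p , P′ ← reverseWalk P | _ , q , L′ ← reverseLinks L =
    _ , ++⁺ p q , P′ ∷ L′

  permuteEnds : ∀ {X Y Y′ B} → Y ↭ Y′ → Links X Y B →
    ∃ λ X′ → ∃ λ B′ → X ↭ X′ × B ↭ B′ × Links X′ Y′ B′
  permuteEnds p L
    with _ , q₁ , L₁ ← reverseLinks L
    with _ , _ , r , q₂ , L₂ ← permuteStarts p L₁
    with _ , q₃ , L₃ ← reverseLinks L₂ =
    _ , _ , r , ↭-trans q₁ (↭-trans q₂ q₃) , L₃

  fromStarts : ∀ {X Y B} → Linkage X Y B → ∃ λ Y′ → ∃ λ B′ → Y ↭ Y′ × B ↭ B′ × Links X Y′ B′
  fromStarts (linkage p q r L) with _ , _ , q′ , r′ , L′ ← permuteStarts (↭-sym p) L =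
    _ , _ , ↭-trans q q′ , ↭-trans r r′ , L′

  fromEnds : ∀ {X Y B} → Linkage X Y B → ∃ λ X′ → ∃ λ B′ → X ↭ X′ × B ↭ B′ × Links X′ Y B′
  fromEnds (linkage p q r L) with _ , _ , p′ , r′ , L′ ← permuteEnds (↭-sym q) L =
    _ , _ , ↭-trans p p′ , ↭-trans r r′ , L′

  toLinkage : ∀ {X Y B} → Links X Y B → Linkage X Y B
  toLinkage = linkage ↭-refl ↭-refl ↭-refl

  relink : ∀ {X X′ Y Y′ B B′} → X ↭ X′ → Y ↭ Y′ → B ↭ B′ → Linkage X Y B → Linkage X′ Y′ B′
  relink p q r (linkage p′ q′ r′ L) =
    linkage (↭-trans (↭-sym p) p′) (↭-trans (↭-sym q) q′) (↭-trans (↭-sym r) r′) L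

  reverse : ∀ {X Y B} → Linkage X Y B → Linkage Y X B
  reverse (linkage p q r L) with _ , r′ , L′ ← reverseLinks L = linkage q p (↭-trans r r′) L′

  single : ∀ {x y zs} → Walk x y zs → Linkage [ x ] [ y ] zs
  single {zs = zs} P = linkage ↭-refl ↭-refl (↭-reflexive (sym (++-identityʳ zs))) (P ∷ [])

  appendLinks : ∀ {X Y B X′ Y′ B′} → Links X Y B → Links X′ Y′ B′ →
    ∃ λ C → B ++ B′ ↭ C × Links (X ++ X′) (Y ++ Y′) C
  appendLinks [] L = _ , ↭-refl , L
  appendLinks {B′ = B′} (_∷_ {zs = zs} {B = B} P L) L′ with C , p , L″ ← appendLinks L L′ =
    _ , ↭-trans (S.solve 3 (λ a b c → (a S.⊕ b) S.⊕ c S.⊜ a S.⊕ (b S.⊕ c)) refl zs B B′) (++⁺ˡ zs p) , P ∷ L″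
    where module S = ↭-Solver {V}

  glueLinks : ∀ {X Y B B′ P Q R W} → Pointwise _~_ P Q → Links X (P ++ R) B → Links (Q ++ W) Y B′ →
    ∃ λ C → ∃ λ Y′ → B ++ B′ ↭ C × R ++ Y ↭ Y′ × Links (X ++ W) Y′ C
  glueLinks {R = R} [] L L′ with C , p , L″ ← appendLinks L L′ = C , _ , p , ↭-refl , L″
  glueLinks {R = R} (p~q ∷ ps) (_∷_ {zs = zs} {B = B} P L) (_∷_ {y = y} {zs = zs′} {Y = Y} {B = B′} P′ L′)
    with C , Y′ , r , s , L″ ← glueLinks ps L L′ =
    (zs ++ zs′) ++ C , y ∷ Y′ ,
    ↭-trans (S.solve 4 (λ a b c d → (a S.⊕ b) S.⊕ (c S.⊕ d) S.⊜ (a S.⊕ c) S.⊕ (b S.⊕ d)) refl zs B zs′ B′)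
            (++⁺ˡ (zs ++ zs′) r) ,
    ↭-trans (shift y R Y) (prep y s) ,
    join P p~q P′ ∷ L″
    where module S = ↭-Solver {V}

  -- Only the ends `P` and the starts `Q` are matched, and only up to adjacency. `R` and `W` stay
  -- free, so paths that finish early or join late need no separate treatment.
  glue : ∀ {X Y B B′ P Q R W} → Pointwise _~_ P Q → Linkage X (P ++ R) B → Linkage (Q ++ W) Y B′ →
    Linkage (X ++ W) (R ++ Y) (B ++ B′)
  glue {R = R} {W = W} ps L L′
    with _ , _ , p , r , M ← fromEnds L | _ , _ , q , r′ , M′ ← fromStarts L′
    with _ , _ , r″ , q′ , M″ ← glueLinks ps M M′ =
    linkage (++⁺ʳ W p) (↭-trans (++⁺ˡ R q) q′) (↭-trans (++⁺ r r′) r″) M″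

  beside : ∀ {X Y B X′ Y′ B′} → Linkage X Y B → Linkage X′ Y′ B′ →
    Linkage (X ++ X′) (Y ++ Y′) (B ++ B′)
  beside = glue []

  splitLinks : ∀ {X Y B v} → Links X Y B → v ∈ B →
    (∃ λ Y′ → Y ↭ v ∷ Y′) ⊎
    (∃ λ h → h ∈ B × v ~ h × Linkage (h ∷ X) (v ∷ Y) B)
  splitLinks {B = B} {v} (_∷_ {x} {y} {zs} {X} {Y} {B₀} P L) v∈ with ∈-++⁻ zs v∈
  ... | inj₁ v∈zs with splitWalk P v∈zs
  ...   | inj₁ refl = inj₁ (_ , ↭-refl)
  ...   | inj₂ (h , as , bs , v~h , refl , P₁ , P₂) =
    inj₂ (h , ∈-++⁺ˡ (∈-++⁺ʳ as (start∈ P₂)) , v~h ,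
          linkage ↭-refl (swap v y ↭-refl)
            (S.solve 3 (λ a b c → (a S.⊕ b) S.⊕ c S.⊜ b S.⊕ (a S.⊕ c)) refl as bs B₀)
            (P₂ ∷ P₁ ∷ L) )
    where module S = ↭-Solver {V}
  splitLinks {B = B} {v} (_∷_ {x} {y} {zs} {X} {Y} {B₀} P L) v∈ | inj₂ v∈B with splitLinks L v∈B
  ... | inj₁ (Y′ , p) = inj₁ (y ∷ Y′ , ↭-trans (prep y p) (swap y v ↭-refl))
  ... | inj₂ (h , h∈ , v~h , L′) =
    inj₂ (h , ∈-++⁺ʳ zs h∈ , v~h ,
          relink (swap x h ↭-refl) (swap y v ↭-refl) ↭-refl
            (beside (single P) L′))

  -- Unless `v` is an end already, the walk through it is cut behind it: its successor `h` becomes a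
  -- start. This lets a path stop at a neighbour of its target while the remainder is entered from
  -- elsewhere.
  split : ∀ {X Y B v} → Linkage X Y B → v ∈ B →
    (∃ λ Y′ → Y ↭ v ∷ Y′) ⊎
    (∃ λ h → h ∈ B × v ~ h × Linkage (h ∷ X) (v ∷ Y) B)
  split (linkage p q r L) v∈ with splitLinks L (∈-resp-↭ r v∈)
  ... | inj₁ (Y′ , s) = inj₁ (Y′ , ↭-trans q s)
  ... | inj₂ (h , h∈ , v~h , L′) =
    inj₂ (h , ∈-resp-↭ (↭-sym r) h∈ , v~h , relink (prep _ (↭-sym p)) (prep _ (↭-sym q)) (↭-sym r) L′)

  links-ends⊆ : ∀ {X Y B} → Links X Y B → Y ⊆ B
  links-ends⊆ (P ∷ L) (here refl) = ∈-++⁺ˡ (end∈ P)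
  links-ends⊆ (_∷_ {zs = zs} P L) (there y∈) = ∈-++⁺ʳ zs (links-ends⊆ L y∈)

  ends⊆ : ∀ {X Y B} → Linkage X Y B → Y ⊆ B
  ends⊆ (linkage p q r L) y∈ = ∈-resp-↭ (↭-sym r) (links-ends⊆ L (∈-resp-↭ q y∈))

  starts⊆ : ∀ {X Y B} → Linkage X Y B → X ⊆ B
  starts⊆ = ends⊆ ∘ reverse

  links-length : ∀ {X Y B} → Links X Y B → length X ≡ length Y
  links-length [] = refl
  links-length (P ∷ L) = cong suc (links-length L)

  linkage-length : ∀ {X Y B} → Linkage X Y B → length X ≡ length Y
  linkage-length (linkage p q r L) =
    ≡-trans (↭-length p) (≡-trans (links-length L) (sym (↭-length q)))

  linkage-path : ∀ {x y B} → Linkage [ x ] [ y ] B → ∃ λ zs → B ↭ zs × Walk x y zs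
  linkage-path L with fromStarts L
  ... | _ , _ , q , r , (_∷_ {zs = zs} P []) with refl ← ↭-singleton-inv (↭-sym q) =
    zs , ↭-trans r (↭-reflexive (++-identityʳ zs)) , P

-- Enumerations of sets of vertices

record Cover {V : Set} (P : V → Set) (xs : List V) : Set where
  field
    unique   : List.Unique xs
    sound    : ∀ {w} → w ∈ xs → P w
    complete : ∀ {w} → P w → w ∈ xs

module _ {V : Set} where

  cover-↭ : ∀ {P : V → Set} {xs ys} → xs ↭ ys → Cover P xs → Cover P ys
  cover-↭ p C = record
    { unique = Unique-resp-↭ p C.unique
    ; sound = C.sound ∘ ∈-resp-↭ (↭-sym p)
    ; complete = ∈-resp-↭ p ∘ C.complete
    } where module C = Cover C

  cover-⇔ : ∀ {P Q : V → Set} {xs} → (∀ {w} → P w → Q w) → (∀ {w} → Q w → P w) → Cover P xs → Cover Q xs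
  cover-⇔ f g C = record
    { unique = C.unique ; sound = f ∘ C.sound ; complete = C.complete ∘ g }
    where module C = Cover C

  cover-++ : ∀ {P Q R : V → Set} {xs ys} → (∀ {w} → R w → P w ⊎ Q w) →
    (∀ {w} → P w → R w) → (∀ {w} → Q w → R w) → (∀ {w} → P w → Q w → ⊥) →
    Cover P xs → Cover Q ys → Cover R (xs ++ ys)
  cover-++ {xs = xs} split f g dis C D = record
    { unique = Unique.++⁺ C.unique D.unique λ (p , q) → dis (C.sound p) (D.sound q)
    ; sound = [ f ∘ C.sound , g ∘ D.sound ]′ ∘ ∈-++⁻ xs
    ; complete = [ ∈-++⁺ˡ ∘ C.complete , ∈-++⁺ʳ xs ∘ D.complete ]′ ∘ split
    } where
      module C = Cover C
      module D = Cover D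
 

module _ {A : Set} where

  module _ {Q : A → Set} (Q? : ∀ x → Dec (Q x)) where

    filter-split : ∀ xs → xs ↭ filter Q? xs ++ filter (λ x → ¬? (Q? x)) xs
    filter-split [] = ↭-refl
    filter-split (x ∷ xs) with Q? x
    ... | yes _ = prep x (filter-split xs)
    ... | no _ = ↭-trans (prep x (filter-split xs)) (↭-sym (shift x (filter Q? xs) _))

-- Paired lists and lists of lists

pointwise-∈ : ∀ {A : Set} {R : A → A → Set} {xs ys y} → Pointwise R xs ys → y ∈ ys →
  ∃ λ x → ∃ λ xs′ → ∃ λ ys′ → xs ↭ x ∷ xs′ × ys ↭ y ∷ ys′ × R x y × Pointwise R xs′ ys′
pointwise-∈ (r ∷ rs) (here refl) = _ , _ , _ , ↭-refl , ↭-refl , r , rs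
pointwise-∈ (r ∷ rs) (there y∈) with x , xs′ , ys′ , p , q , r′ , rs′ ← pointwise-∈ rs y∈ =
  x , _ , _ , ↭-trans (prep _ p) (swap _ x ↭-refl) , ↭-trans (prep _ q) (swap _ _ ↭-refl) , r′ , r ∷ rs′

pointwise-length : ∀ {A : Set} {R : A → A → Set} {xs ys} → Pointwise R xs ys → length xs ≡ length ys
pointwise-length [] = refl
pointwise-length (_ ∷ rs) = cong suc (pointwise-length rs)

pointwise-map : ∀ {A B : Set} {R : B → B → Set} {f g : A → B} xs → (∀ {x} → x ∈ xs → R (f x) (g x)) →
  Pointwise R (map f xs) (map g xs)
pointwise-map [] _ = []
pointwise-map (x ∷ xs) r = r (here refl) ∷ pointwise-map xs (r ∘ there)

pointwise-++ : ∀ {A : Set} {R : A → A → Set} {xs ys xs′ ys′} → Pointwise R xs ys → Pointwise R xs′ ys′ →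
  Pointwise R (xs ++ xs′) (ys ++ ys′)
pointwise-++ [] rs = rs
pointwise-++ (r ∷ rs) rs′ = r ∷ pointwise-++ rs rs′

zip-map₁ : ∀ {A B : Set} (xs : List A) (ys : List B) → length xs ≡ length ys → map proj₁ (zip xs ys) ≡ xs
zip-map₁ [] [] _ = refl
zip-map₁ (x ∷ xs) (y ∷ ys) e = cong (x ∷_) (zip-map₁ xs ys (ℕ.suc-injective e))

zip-map₂ : ∀ {A B : Set} (xs : List A) (ys : List B) → length xs ≡ length ys → map proj₂ (zip xs ys) ≡ ys
zip-map₂ [] [] _ = refl
zip-map₂ (x ∷ xs) (y ∷ ys) e = cong (y ∷_) (zip-map₂ xs ys (ℕ.suc-injective e))

module _ {A : Set} where

  concat-index : ∀ {x : A} xss → x ∈ concat xss → ∃ λ i → x ∈ L.lookup xss i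
  concat-index (xs ∷ xss) x∈ with ∈-++⁻ xs x∈
  ... | inj₁ x∈xs = zero , x∈xs
  ... | inj₂ x∈xss = let i , x∈i = concat-index xss x∈xss in suc i , x∈i

  lookup⊆concat : ∀ xss i {x : A} → x ∈ L.lookup xss i → x ∈ concat xss
  lookup⊆concat (xs ∷ xss) zero x∈ = ∈-++⁺ˡ x∈
  lookup⊆concat (xs ∷ xss) (suc i) x∈ = ∈-++⁺ʳ xs (lookup⊆concat xss i x∈)

  lookup-unique : ∀ xss i → List.Unique (concat {A = A} xss) → List.Unique (L.lookup xss i)
  lookup-unique (xs ∷ xss) zero u = unique-++⁻ˡ xs u
  lookup-unique (xs ∷ xss) (suc i) u = lookup-unique xss i (unique-++⁻ʳ xs u)

  lookup-disjoint : ∀ xss {i j} → List.Unique (concat {A = A} xss) → i ≢ j → Disjoint (L.lookup xss i) (L.lookup xss j)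
  lookup-disjoint (xs ∷ xss) {zero} {zero} u i≢j _ = i≢j refl
  lookup-disjoint (xs ∷ xss) {zero} {suc j} u i≢j (x∈ , y∈) = unique-++⁻-disjoint xs u (x∈ , lookup⊆concat xss j y∈)
  lookup-disjoint (xs ∷ xss) {suc i} {zero} u i≢j (x∈ , y∈) = unique-++⁻-disjoint xs u (y∈ , lookup⊆concat xss i x∈)
  lookup-disjoint (xs ∷ xss) {suc i} {suc j} u i≢j = lookup-disjoint xss (unique-++⁻ʳ xs u) (i≢j ∘ cong suc)

  lookup-injective : ∀ {xs : List A} {i j} → List.Unique xs → L.lookup xs i ≡ L.lookup xs j → i ≡ j
  lookup-injective {x ∷ xs} {zero} {zero} u e = refl
  lookup-injective {x ∷ xs} {zero} {suc j} (x∉ ∷ u) e = contradiction e (All.lookup x∉ (∈-lookup j))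
  lookup-injective {x ∷ xs} {suc i} {zero} (x∉ ∷ u) e = contradiction (sym e) (All.lookup x∉ (∈-lookup i))
  lookup-injective {x ∷ xs} {suc i} {suc j} (_ ∷ u) e = cong suc (lookup-injective u e)

  -- Equal blocks would share their first element. Empty blocks could repeat, which is why a path
  -- consisting of a single edge is treated separately later.
  unique-concat⁻ : ∀ {xss : List (List A)} → All (_≢ []) xss → List.Unique (concat xss) → List.Unique xss
  unique-concat⁻ [] _ = []
  unique-concat⁻ {[] ∷ xss} (ne ∷ nes) u = contradiction refl ne
  unique-concat⁻ {(x ∷ xs) ∷ xss} (ne ∷ nes) u =
    unique-∷ (λ xs∈ → unique-++⁻-disjoint (x ∷ xs) u (here refl , inside xss xs∈)) (unique-concat⁻ nes (unique-++⁻ʳ (x ∷ xs) u))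
    where
    inside : ∀ xss → x ∷ xs ∈ xss → x ∈ concat xss
    inside (_ ∷ xss) (here refl) = here refl
    inside (ys ∷ xss) (there p) = ∈-++⁺ʳ ys (inside xss p)

twoPositions : ∀ {k} → 1 ≤ k → k ≢ 1 → ∃ λ (i : Fin k) → ∃ λ (j : Fin k) → i ≢ j
twoPositions {1} _ k≢1 = contradiction refl k≢1
twoPositions {suc (suc _)} _ _ = zero , suc zero , λ ()

-- Certificates in A 4 2; the vertex (i , j) stands for the sequence i j.
module Certificates where

  Pair : Set
  Pair = Fin 4 × Fin 4

  _≟²_ : (x y : Pair) → Dec (x ≡ y)
  _≟²_ = Product.≡-dec _≟_ _≟_

  open import Data.List.Membership.DecPropositional _≟²_ using (_∈?_)
  open import Data.List.Relation.Unary.Unique.DecPropositional _≟²_ using (unique?)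

  _~₄_ : Pair → Pair → Set
  (i , j) ~₄ (i′ , j′) = (i ≢ i′ × j ≡ j′) ⊎ (i ≡ i′ × j ≢ j′)

  _~₄?_ : ∀ x y → Dec (x ~₄ y)
  (i , j) ~₄? (i′ , j′) = (¬? (i ≟ i′) ×-dec j ≟ j′) ⊎-dec (i ≟ i′ ×-dec ¬? (j ≟ j′))

  final : Pair → List Pair → Pair
  final x [] = x
  final _ (y ∷ ys) = final y ys

  -- Each entry is the nonempty interior of a path; its first vertex is kept apart because it
  -- becomes a start.
  Certificate : Set
  Certificate = List (Pair × List Pair)

  flat : Certificate → List Pair
  flat [] = []
  flat ((x , xs) ∷ L) = (x ∷ xs) ++ flat L

  u₀ : Pair
  u₀ = zero , suc zero

  record Valid (v : Pair) (L : Certificate) : Set where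
    constructor valid
    field
      paths    : All (λ (x , xs) → Linked _~₄_ (u₀ ∷ x ∷ xs) × final x xs ~₄ v) L
      disjoint : List.Unique (u₀ ∷ v ∷ flat L)
      proper   : All (λ (i , j) → i ≢ j) (u₀ ∷ v ∷ flat L)
      spanning : ∀ i j → i ≢ j → (i , j) ∈ u₀ ∷ v ∷ flat L

  valid? : ∀ v L → Dec (All (λ (x , xs) → Linked _~₄_ (u₀ ∷ x ∷ xs) × final x xs ~₄ v) L ×
    List.Unique (u₀ ∷ v ∷ flat L) × All (λ (i , j) → i ≢ j) (u₀ ∷ v ∷ flat L) ×
    (∀ i j → i ≢ j → (i , j) ∈ u₀ ∷ v ∷ flat L))
  valid? v L = All.all? (λ (x , xs) → Linked.linked? _~₄?_ (u₀ ∷ x ∷ xs) ×-dec final x xs ~₄? v) L ×-dec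
    unique? (u₀ ∷ v ∷ flat L) ×-dec All.all? (λ (i , j) → ¬? (i ≟ j)) (u₀ ∷ v ∷ flat L) ×-dec
    Fin.all? (λ i → Fin.all? λ j → ¬? (i ≟ j) →-dec ((i , j) ∈? (u₀ ∷ v ∷ flat L)))

  certify : ∀ v L → {True (valid? v L)} → Valid v L
  certify v L {t} = let a , b , c , d = toWitness t in valid a b c d

-- Vertices, adjacency and faces

record Parameters : Set where
  constructor parameters
  field
    n k m : ℕ
    n≡k+m : n ≡ k + m
    2≤m   : 2 ≤ m

module Arrangement (Ω : Parameters) where
  open Parameters Ω

  V : Set
  V = Vec (Fin n) k

  _≟ᵛ_ : (u w : V) → Dec (u ≡ w)
  _≟ᵛ_ = ≡-dec _≟_

  infixl 9 _!_
  _!_ : V → Fin k → Fin n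
  _!_ = lookup

  record Inj (w : V) : Set where
    constructor inj
    field app : ∀ {i j} → w ! i ≡ w ! j → i ≡ j

  record Absent (t : Fin n) (w : V) : Set where
    constructor absent
    field app : ∀ i → w ! i ≢ t

  record Adj (u w : V) : Set where
    constructor adj
    field
      at     : Fin k
      differ : u ! at ≢ w ! at
      agree  : ∀ {i} → i ≢ at → u ! i ≡ w ! i

  -- The vertices obtained from `u` by changing entries at positions in `P`: a smaller arrangement
  -- graph with `length P` positions (for `P` without repetition) and the same `m`. The induction
  -- runs over sets of free positions inside one fixed graph, so that no symbols have to be renamed.
  record Face (u : V) (P : List (Fin k)) (w : V) : Set where
    constructor face
    field
      injective : Inj w
      fixed     : ∀ {i} → i ∉ P → w ! i ≡ u ! i

  open Inj using () renaming (app to inj-app) public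
  open Absent using () renaming (app to absent-app) public
  open Adj using (at; differ; agree) public
  open Face using () renaming (injective to faceInj; fixed to faceFixed) public

  present? : ∀ t w → (∃ λ i → w ! i ≡ t) ⊎ Absent t w
  present? t w with Fin.any? (λ i → w ! i ≟ t)
  ... | yes p = inj₁ p
  ... | no ¬p = inj₂ (absent λ i eq → ¬p (i , eq))

  Adj-sym : ∀ {u w} → Adj u w → Adj w u
  Adj-sym (adj j d s) = adj j (d ∘ sym) (sym ∘ s)

  adj? : ∀ u w → Dec (Adj u w)
  adj? u w with Fin.any? (λ j → ¬? (u ! j ≟ w ! j) ×-dec Fin.all? (λ i → (i ≟ j) ⊎-dec (u ! i ≟ w ! i)))
  ... | yes (j , d , s) = yes (adj j d λ {i} i≢j → [ (λ eq → contradiction eq i≢j) , id ]′ (s i))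
  ... | no ¬a = no λ (adj j d s) → ¬a (j , d , λ i → help (s {i}))
    where
    help : ∀ {i j} → (i ≢ j → u ! i ≡ w ! i) → i ≡ j ⊎ u ! i ≡ w ! i
    help {i} {j} f with i ≟ j
    ... | yes eq = inj₁ eq
    ... | no ne = inj₂ (f ne)

  open Linking Adj Adj-sym public

  ext : ∀ {u w : V} → (∀ i → u ! i ≡ w ! i) → u ≡ w
  ext eq = Extensional.Pointwise-≡⇒≡ (Extensional.ext eq)

  infixl 10 _[_≔_]

  abstract
    _[_≔_] : V → Fin k → Fin n → V
    w [ j ≔ t ] = w [ j ]≔ t

    ≔-same : ∀ w j t → w [ j ≔ t ] ! j ≡ t
    ≔-same w j t = lookup∘update j w t

    ≔-other : ∀ w {i j} t → i ≢ j → w [ j ≔ t ] ! i ≡ w ! i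
    ≔-other w t i≢j = lookup∘update′ i≢j w t

  ≔-elim : ∀ w j t (Q : Fin k → Fin n → Set) → Q j t → (∀ {i} → i ≢ j → Q i (w ! i)) →
    ∀ i → Q i (w [ j ≔ t ] ! i)
  ≔-elim w j t Q q r i with i ≟ j
  ... | yes refl = subst (Q i) (sym (≔-same w i t)) q
  ... | no i≢j = subst (Q i) (sym (≔-other w t i≢j)) (r i≢j)

  ≔-inj : ∀ {w t} j → Inj w → Absent t w → Inj (w [ j ≔ t ])
  ≔-inj {w} {t} j (inj ι) (absent t∉) = inj help
    where
    help : ∀ {x y} → w [ j ≔ t ] ! x ≡ w [ j ≔ t ] ! y → x ≡ y
    help {x} {y} eq with x ≟ j | y ≟ j
    ... | yes refl | yes refl = refl
    ... | yes refl | no y≢ =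
      contradiction (≡-trans (sym (≔-other w t y≢)) (≡-trans (sym eq) (≔-same w x t))) (t∉ y)
    ... | no x≢ | yes refl =
      contradiction (≡-trans (sym (≔-other w t x≢)) (≡-trans eq (≔-same w y t))) (t∉ x)
    ... | no x≢ | no y≢ = ι (≡-trans (sym (≔-other w t x≢)) (≡-trans eq (≔-other w t y≢)))

  ≔-adj : ∀ {w t} j → w ! j ≢ t → Adj w (w [ j ≔ t ])
  ≔-adj {w} {t} j ne = adj j (λ eq → ne (≡-trans eq (≔-same w j t))) (λ i≢j → sym (≔-other w t i≢j))

  ≔-absent : ∀ {w t c} j → Absent c w → t ≢ c → Absent c (w [ j ≔ t ])
  ≔-absent {w} {t} {c} j (absent c∉) t≢c = absent (≔-elim w j t (λ _ x → x ≢ c) t≢c (λ {i} _ → c∉ i))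

  ≔-absent-old : ∀ {w t} j → Inj w → Absent t w → Absent (w ! j) (w [ j ≔ t ])
  ≔-absent-old {w} {t} j (inj ι) (absent t∉) =
    absent (≔-elim w j t (λ _ x → x ≢ w ! j) (t∉ j ∘ sym) (λ i≢j eq → i≢j (ι eq)))

  adj⇒≔ : ∀ {u w} (a : Adj u w) → w ≡ u [ at a ≔ w ! at a ]
  adj⇒≔ {u} {w} (adj j _ s) =
    ext λ i → sym (≔-elim u j (w ! j) (λ i x → x ≡ w ! i) refl s i)

  adj-absent : ∀ {u w} → Inj w → (a : Adj u w) → Absent (w ! at a) u
  adj-absent {u} {w} (inj ι) (adj j d s) = absent λ i eq → help i eq
    where
    help : ∀ i → u ! i ≢ w ! j
    help i eq with i ≟ j
    ... | yes refl = d eq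
    ... | no i≢j = i≢j (ι (≡-trans (sym (s i≢j)) eq))

  ≔-injective : ∀ {u j t j′ t′} → Absent t u → Absent t′ u → u [ j ≔ t ] ≡ u [ j′ ≔ t′ ] → j ≡ j′ × t ≡ t′
  ≔-injective {u} {j} {t} {j′} {t′} (absent t∉) _ eq with j ≟ j′
  ... | yes refl = refl , ≡-trans (sym (≔-same u j t)) (≡-trans (cong (_! j) eq) (≔-same u j t′))
  ... | no j≢ = contradiction
    (≡-trans (sym (≔-other u t′ j≢)) (≡-trans (cong (_! j) (sym eq)) (≔-same u j t))) (t∉ j)

  abstract
    missing : V → List (Fin n)
    missing w = filter (λ t → Fin.all? (λ i → ¬? (w ! i ≟ t))) (allFin n)

    ∈-missing⁺ : ∀ {w t} → Absent t w → t ∈ missing w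
    ∈-missing⁺ {w} (absent t∉) = ∈-filter⁺ (λ t → Fin.all? (λ i → ¬? (w ! i ≟ t))) (∈-allFin _) t∉

    ∈-missing⁻ : ∀ {w t} → t ∈ missing w → Absent t w
    ∈-missing⁻ {w} t∈ = absent (proj₂ (∈-filter⁻ (λ t → Fin.all? (λ i → ¬? (w ! i ≟ t))) {xs = allFin n} t∈))

    missing-unique : ∀ w → List.Unique (missing w)
    missing-unique w = Unique.filter⁺ _ (Unique.allFin⁺ n)

  missing-length : ∀ {w} → Inj w → length (missing w) ≡ m
  missing-length {w} (inj ι) = ℕ.+-cancelˡ-≡ k _ _ (≡-trans (sym count) (≡-trans (length-tabulate {n = n} id) n≡k+m))
    where
    all↭ : allFin n ↭ map (w !_) (allFin k) ++ missing w
    all↭ = ⊆-⊇⇒↭ (Unique.allFin⁺ n)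
      (Unique.++⁺ (Unique.map⁺ ι (Unique.allFin⁺ k)) (missing-unique w)
        λ (t∈ , t∈′) → let i , _ , eq = ∈-map⁻ (w !_) t∈ in absent-app (∈-missing⁻ t∈′) i (sym eq))
      (λ {t} _ → [ (λ (i , eq) → ∈-++⁺ˡ (subst (_∈ _) eq (∈-map⁺ (w !_) (∈-allFin i))))
                 , (λ t∉ → ∈-++⁺ʳ (map (w !_) (allFin k)) (∈-missing⁺ t∉)) ]′ (present? t w))
      (λ _ → ∈-allFin _)
    count : length (allFin n) ≡ k + length (missing w)
    count = ≡-trans (↭-length all↭) (≡-trans (length-++ (map (w !_) (allFin k)))
      (cong (_+ length (missing w)) (≡-trans (length-map (w !_) (allFin k)) (length-tabulate {n = k} id))))

  fresh : ∀ {w} → Inj w → ∀ as → suc (length as) ≤ m → ∃ λ t → Absent t w × t ∉ as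
  fresh {w} ι as le
    with t , t∈ , t∉ ← pickFresh _≟_ (missing-unique w) as (ℕ.≤-trans le (ℕ.≤-reflexive (sym (missing-length ι)))) =
    t , ∈-missing⁻ t∈ , t∉

  open import Data.List.Membership.DecPropositional {A = Fin k} _≟_ public using () renaming (_∈?_ to _∈ᵖ?_)
  open import Data.List.Membership.DecPropositional {A = Fin n} _≟_ public using () renaming (_∈?_ to _∈ˢ?_)
  open import Data.List.Membership.DecPropositional {A = V} _≟ᵛ_ public using () renaming (_∈?_ to _∈ᵛ?_)

  face-refl : ∀ {u P} → Inj u → Face u P u
  face-refl ι = face ι λ _ → refl

  face-trans : ∀ {u v w P} → Face u P v → Face v P w → Face u P w
  face-trans (face _ s) (face ι s′) = face ι λ i∉ → ≡-trans (s′ i∉) (s i∉)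

  face-sym : ∀ {u v P} → Inj u → Face u P v → Face v P u
  face-sym ι (face _ s) = face ι (sym ∘ s)

  face-≔ : ∀ {u w P t} j → j ∈ P → Face u P w → Absent t w → Face u P (w [ j ≔ t ])
  face-≔ {u} {w} {P} {t} j j∈ (face ι s) t∉ =
    face (≔-inj j ι t∉) λ i∉ → ≡-trans (≔-other w t λ { refl → i∉ j∈ }) (s i∉)

  face-mono : ∀ {u w P P′} → P ⊆ P′ → Face u P w → Face u P′ w
  face-mono P⊆ (face ι s) = face ι λ i∉ → s (i∉ ∘ P⊆)

  face-adj-∈ : ∀ {u w P} → Face u P w → (a : Adj u w) → at a ∈ P
  face-adj-∈ {P = P} (face _ s) (adj j d _) with j ∈ᵖ? P
  ... | yes j∈ = j∈
  ... | no j∉ = contradiction (sym (s j∉)) d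

  length-product : ∀ {A B : Set} (xs : List A) (ys : List B) →
    length (cartesianProduct xs ys) ≡ length xs * length ys
  length-product [] ys = refl
  length-product (x ∷ xs) ys = ≡-trans (length-++ (map (x ,_) ys))
    (cong₂ _+_ (length-map (x ,_) ys) (length-product xs ys))

  abstract
    nbrs : List (Fin k) → V → List V
    nbrs P u = map (λ (j , t) → u [ j ≔ t ]) (cartesianProduct P (missing u))

    ∈-nbrs⁺ : ∀ {P u j t} → j ∈ P → Absent t u → u [ j ≔ t ] ∈ nbrs P u
    ∈-nbrs⁺ {u = u} j∈ t∉ = ∈-map⁺ (λ (j , t) → u [ j ≔ t ]) (∈-cartesianProduct⁺ j∈ (∈-missing⁺ t∉))

    ∈-nbrs⁻ : ∀ {P u w} → w ∈ nbrs P u → ∃ λ j → ∃ λ t → j ∈ P × Absent t u × w ≡ u [ j ≔ t ]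
    ∈-nbrs⁻ {P} {u} w∈ with (j , t) , jt∈ , eq ← ∈-map⁻ (λ (j , t) → u [ j ≔ t ]) w∈ =
      let j∈ , t∈ = ∈-cartesianProduct⁻ P (missing u) jt∈ in j , t , j∈ , ∈-missing⁻ t∈ , eq

    nbrs-unique : ∀ {P u} → List.Unique P → List.Unique (nbrs P u)
    nbrs-unique {P} {u} uP = unique-map
      (λ x∈ y∈ eq → let a = ∈-cartesianProduct⁻ P (missing u) x∈ ; b = ∈-cartesianProduct⁻ P (missing u) y∈
                        e₁ , e₂ = ≔-injective (∈-missing⁻ (proj₂ a)) (∈-missing⁻ (proj₂ b)) eq
                    in cong₂ _,_ e₁ e₂)
      (Unique.cartesianProduct⁺ uP (missing-unique u))

    nbrs-length : ∀ {P u} → Inj u → length (nbrs P u) ≡ length P * m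
    nbrs-length {P} {u} ι = ≡-trans (length-map _ (cartesianProduct P (missing u)))
      (≡-trans (length-product P (missing u)) (cong (length P *_) (missing-length ι)))

  face-adj⇒nbr : ∀ {P u w} → Face u P w → Adj u w → w ∈ nbrs P u
  face-adj⇒nbr f a =
    subst (_∈ _) (sym (adj⇒≔ a)) (∈-nbrs⁺ (face-adj-∈ f a) (adj-absent (faceInj f) a))

  nbr-adj : ∀ {P u w} → w ∈ nbrs P u → Adj u w
  nbr-adj w∈ with j , t , _ , t∉ , refl ← ∈-nbrs⁻ w∈ = ≔-adj j (absent-app t∉ j)

  nbr-face : ∀ {P u w} → Inj u → w ∈ nbrs P u → Face u P w
  nbr-face ι w∈ with j , t , j∈ , t∉ , refl ← ∈-nbrs⁻ w∈ = face-≔ j j∈ (face-refl ι) t∉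

  -- Containers inside a face

  record Theta (P : List (Fin k)) (u v : V) (X : List V) : Set where
    constructor theta
    field
      {ends bag} : List V
      -- That `u` is adjacent to `X` is recorded outside the theta, since `X` is sometimes
      -- prescribed and sometimes found.
      link  : Linkage X ends bag
      ends~ : All (λ y → Adj y v) ends
      cover : Cover (Face u P) (u ∷ v ∷ bag)

  -- X prescribes the first vertices of the paths; the edge u v can always be added as one more path.
  AdjacentThetas : List (Fin k) → Set
  AdjacentThetas P = ∀ {u v X} → Inj u → Face u P v → Adj u v →
    All (λ x → Adj u x × Face u P x) X → List.Unique X → v ∉ X → X ≢ [] → Theta P u v X

  -- Here the first vertices are found rather than prescribed; `length P * m` is the degree within
  -- the face.
  DistantThetas : List (Fin k) → Set
  DistantThetas P = ∀ {u v} l → Inj u → Face u P v → u ≢ v → ¬ Adj u v →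
    1 ≤ l → l ≤ length P * m → ∃ λ X → length X ≡ l × All (Adj u) X × Theta P u v X

  Hamiltonian : List (Fin k) → Set
  Hamiltonian P = ∀ {u v} → Inj u → Face u P v → u ≢ v →
    ∃ λ zs → Walk u v zs × Cover (Face u P) zs

  links-unique : ∀ {X Y B} → Links X Y B → List.Unique B → List.Unique X
  links-unique [] _ = []
  links-unique (_∷_ {zs = zs} π L) u =
    unique-∷ (λ x∈ → unique-++⁻-disjoint zs u (start∈ π , starts⊆ (toLinkage L) x∈))
             (links-unique L (unique-++⁻ʳ zs u))

  starts-unique : ∀ {X Y B} → Linkage X Y B → List.Unique B → List.Unique X
  starts-unique (linkage p _ r L) u = Unique-resp-↭ (↭-sym p) (links-unique L (Unique-resp-↭ r u))

  face-↭ : ∀ {P P₁ u w} → P ↭ P₁ → Face u P w → Face u P₁ w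
  face-↭ p = face-mono (∈-resp-↭ p)

  theta-↭ : ∀ {P P₁ u v X X₁} → P ↭ P₁ → X ↭ X₁ → Theta P u v X → Theta P₁ u v X₁
  theta-↭ p q (theta L ends C) =
    theta (relink q ↭-refl ↭-refl L) ends (cover-⇔ (face-↭ p) (face-↭ (↭-sym p)) C)

  module _ {P : List (Fin k)} {u v : V} {X : List V} (T : Theta P u v X) where
    open Theta T

    private
      module C = Cover cover

    bag-unique : List.Unique bag
    bag-unique = AllPairs.tail (AllPairs.tail C.unique)

    theta-starts-unique : List.Unique X
    theta-starts-unique = starts-unique link bag-unique

    bag-face : ∀ {w} → w ∈ bag → Face u P w
    bag-face = C.sound ∘ there ∘ there

    theta-starts-face : ∀ {x} → x ∈ X → Face u P x
    theta-starts-face = bag-face ∘ starts⊆ link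

    ends-face : ∀ {y} → y ∈ ends → Face u P y
    ends-face = bag-face ∘ ends⊆ link

    theta-path : length X ≡ 1 → All (Adj u) X → ∃ λ zs → Walk u v zs × Cover (Face u P) zs
    theta-path len X~ = go len X~ link (linkage-length link) ends~
      where
      open ↭-Solver {V} using (solve; _⊕_; _⊜_)
      go : ∀ {X Y} → length X ≡ 1 → All (Adj u) X → Linkage X Y bag → length X ≡ length Y → All (λ y → Adj y v) Y →
        ∃ λ zs → Walk u v zs × Cover (Face u P) zs
      go {x ∷ []} {y ∷ []} _ (u~x ∷ []) L _ (y~v ∷ []) with zs , p , π ← linkage-path L =
        u ∷ zs ++ [ v ] , step u~x (snoc π y~v) ,
        cover-↭ (prep u (↭-trans (prep v p) (++-comm [ v ] zs))) cover
      go {x ∷ []} {[]} _ _ _ () _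
      go {x ∷ []} {_ ∷ _ ∷ _} _ _ _ () _

  -- In the second alternative the edge from `u` to `v` serves as one of the paths, and `v` itself
  -- is listed as its start.
  EdgeTheta : List (Fin k) → V → V → List V → Set
  EdgeTheta P u v X = Theta P u v X ⊎ (∃ λ X′ → X ↭ v ∷ X′ × Adj u v × Theta P u v X′)

  module _ {P : List (Fin k)} (uniqueP : List.Unique P) (nonempty : 1 ≤ length P)
           (adjacent : AdjacentThetas P) (distant : DistantThetas P) where

    degree≥2 : 2 ≤ length P * m
    degree≥2 = ℕ.≤-trans 2≤m (ℕ.≤-trans (ℕ.≤-reflexive (sym (ℕ.*-identityˡ m))) (ℕ.*-monoˡ-≤ m nonempty))

    joinEnds : Hamiltonian P
    joinEnds {u} {v} ι f u≢v with adj? u v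
    ... | no ¬a with X , len , X~ , T ← distant 1 ι f u≢v ¬a ℕ.≤-refl (ℕ.≤-trans (s≤s z≤n) degree≥2) =
      theta-path T len X~
    -- The degree is at least 2, so some neighbour other than `v` can be prescribed; the single path
    -- through it is Hamiltonian.
    ... | yes a with x , x∈ , x∉ ← pickFresh _≟ᵛ_ (nbrs-unique {P} {u} uniqueP) [ v ]
                     (ℕ.≤-trans degree≥2 (ℕ.≤-reflexive (sym (nbrs-length ι)))) =
      theta-path (adjacent ι f a ((nbr-adj x∈ , nbr-face ι x∈) ∷ []) ([] ∷ [])
                   (λ { (here refl) → x∉ (here refl) }) λ ())
                 refl (nbr-adj x∈ ∷ [])

    allowEdge : ∀ {u v} l → Inj u → Face u P v → u ≢ v → 1 ≤ l → l ≤ length P * m →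
      ∃ λ X → length X ≡ l × List.Unique X × All (λ x → Adj u x × Face u P x) X × EdgeTheta P u v X
    allowEdge {u} {v} l ι f u≢v 1≤l l≤ with adj? u v
    ... | no ¬a with X , len , X~ , T ← distant l ι f u≢v ¬a 1≤l l≤ =
      X , len , theta-starts-unique T ,
      All.tabulate (λ x∈ → All.lookup X~ x∈ , theta-starts-face T x∈) , inj₁ T
    ... | yes a with N , p ← ∈-↭ (face-adj⇒nbr f a) =
      go (l ℕ.≤? length N)
      where
      lenN : suc (length N) ≡ length P * m
      lenN = ≡-trans (sym (↭-length p)) (nbrs-length ι)
      uN : List.Unique (v ∷ N)
      uN = Unique-resp-↭ p (nbrs-unique uniqueP)
      N✓ : ∀ {x} → x ∈ N → Adj u x × Face u P x
      N✓ x∈ = let x∈′ = ∈-resp-↭ (↭-sym p) (there x∈) in nbr-adj x∈′ , nbr-face ι x∈′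
      nonnil : ∀ {X : List V} → 1 ≤ length X → X ≢ []
      nonnil () refl
      go : Dec (l ≤ length N) → ∃ λ X → length X ≡ l × List.Unique X × All (λ x → Adj u x × Face u P x) X × EdgeTheta P u v X
      go (yes l≤N) = take l N , len , Unique.take⁺ l (AllPairs.tail uN) , All.tabulate (N✓ ∘ take-⊆ l N) ,
        inj₁ (adjacent ι f a (All.tabulate (N✓ ∘ take-⊆ l N)) (Unique.take⁺ l (AllPairs.tail uN))
                (unique-∉ uN ∘ take-⊆ l N) (nonnil (ℕ.≤-trans 1≤l (ℕ.≤-reflexive (sym len)))))
        where len = length-take-≤ l N l≤N
      -- `N` falls short of the degree by one, so `l` is the full degree and the edge has to be one
      -- of the paths.
      go (no l≰N) = v ∷ N , ℕ.≤-antisym (ℕ.≰⇒> l≰N) (ℕ.≤-trans l≤ (ℕ.≤-reflexive (sym lenN))) , uN ,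
        (a , f) ∷ All.tabulate N✓ ,
        inj₂ (N , ↭-refl , a , adjacent ι f a (All.tabulate N✓) (AllPairs.tail uN) (unique-∉ uN)
                (nonnil (ℕ.≤-pred (ℕ.≤-trans degree≥2 (ℕ.≤-reflexive (sym lenN))))))

    abstract
      hamiltonian : Hamiltonian P
      hamiltonian = joinEnds

      edgeThetas : ∀ {u v} l → Inj u → Face u P v → u ≢ v → 1 ≤ l → l ≤ length P * m →
        ∃ λ X → length X ≡ l × List.Unique X × All (λ x → Adj u x × Face u P x) X × EdgeTheta P u v X
      edgeThetas = allowEdge

  interior : ∀ {u v zs} → Walk u v zs → u ≢ v → ¬ Adj u v →
    ∃ λ x → ∃ λ y → ∃ λ B → Adj u x × Adj y v × zs ↭ u ∷ v ∷ B × Linkage [ x ] [ y ] B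
  interior stop u≢v _ = contradiction refl u≢v
  interior {u} {v} (step u~x π) u≢v ¬a with reverseWalk π
  ... | _ , q , stop = contradiction u~x ¬a
  ... | _ , q , step {zs = B} v~y π′ = _ , _ , B , u~x , Adj-sym v~y , prep u q , reverse (single π′)

  -- Copies inside a face

  record Split : Set where
    constructor splitting
    field
      p       : Fin k
      P′      : List (Fin k)
      uniqueP : List.Unique (p ∷ P′)

  module Copies (Σ : Split) where
    open Split Σ

    P : List (Fin k)
    P = p ∷ P′

    p∉P′ : p ∉ P′
    p∉P′ = unique-∉ uniqueP

    ≢p⇒∈P′ : ∀ {i} → i ∈ P → i ≢ p → i ∈ P′
    ≢p⇒∈P′ = ∷⁻-∈

    ∈P′⇒≢p : ∀ {i} → i ∈ P′ → i ≢ p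
    ∈P′⇒≢p i∈ refl = p∉P′ i∈

    copy⇒face : ∀ {u x w} → Face u P x → Face x P′ w → Face u P w
    copy⇒face f (face ι s) = face-trans f (face ι λ i∉ → s (i∉ ∘ there))

    copy-at : ∀ {x w} → Face x P′ w → w ! p ≡ x ! p
    copy-at f = faceFixed f p∉P′

    face⇒copy : ∀ {u x w} → Face u P x → Face u P w → w ! p ≡ x ! p → Face x P′ w
    face⇒copy {x = x} {w} (face _ s) (face ι s′) eq = face ι help
      where
      help : ∀ {i} → i ∉ P′ → w ! i ≡ x ! i
      help {i} i∉ with i ≟ p
      ... | yes refl = eq
      ... | no i≢p = ≡-trans (s′ i∉P) (sym (s i∉P))
        where
        i∉P : i ∉ P
        i∉P i∈ = i∉ (≢p⇒∈P′ i∈ i≢p)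

    -- The symbols that can occur at positions of `P` within the face: those missing from `u` and
    -- those that `u` has inside `P`.
    record Free (u : V) (t : Fin n) : Set where
      constructor free
      field app : ∀ {i} → u ! i ≡ t → i ∈ P

    free-face : ∀ {u w t} → Face u P w → Free u t → Free w t
    free-face {u} {w} {t} (face _ s) (free φ) = free help
      where
      help : ∀ {i} → w ! i ≡ t → i ∈ P
      help {i} eq with i ∈ᵖ? P
      ... | yes i∈ = i∈
      ... | no i∉ = φ (≡-trans (sym (s i∉)) eq)

    free-at : ∀ {u w j} → Face u P w → j ∈ P → Free u (w ! j)
    free-at {u} {w} {j} (face (inj ι) s) j∈ = free help
      where
      help : ∀ {i} → u ! i ≡ w ! j → i ∈ P
      help {i} eq with i ∈ᵖ? P
      ... | yes i∈ = i∈
      ... | no i∉ = subst (_∈ P) (sym (ι (≡-trans (s i∉) eq))) j∈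

    free-absent : ∀ {u t} → Absent t u → Free u t
    free-absent (absent t∉) = free λ {i} eq → contradiction eq (t∉ i)

    InCopies : V → List (Fin n) → V → Set
    InCopies u M w = Face u P w × w ! p ∈ M

    ≔p-face : ∀ {u w t} → Face u P w → Absent t w → Face u P (w [ p ≔ t ])
    ≔p-face = face-≔ p (here refl)

    cover-copy : ∀ {u x zs} → Face u P x → Cover (Face x P′) zs → Cover (InCopies u [ x ! p ]) zs
    cover-copy f = cover-⇔ (λ g → copy⇒face f g , here (copy-at g))
      λ { (g , here eq) → face⇒copy f g eq }

    cover-same : ∀ {u M M′ zs} → M ⊆ M′ → M′ ⊆ M → Cover (InCopies u M) zs → Cover (InCopies u M′) zs
    cover-same ⊆₁ ⊆₂ = cover-⇔ (λ (f , c) → f , ⊆₁ c) (λ (f , c) → f , ⊆₂ c)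

    cover-base : ∀ {u x M zs} → Inj u → Face u P x → Cover (InCopies x M) zs → Cover (InCopies u M) zs
    cover-base ι f = cover-⇔ (λ (g , c) → face-trans f g , c) (λ (g , c) → face-trans (face-sym ι f) g , c)

    cover-join : ∀ {u M M′ xs ys} → Disjoint M M′ → Cover (InCopies u M) xs → Cover (InCopies u M′) ys →
      Cover (InCopies u (M ++ M′)) (xs ++ ys)
    cover-join {M = M} dis = cover-++
      (λ (f , c) → [ (λ c → inj₁ (f , c)) , (λ c → inj₂ (f , c)) ]′ (∈-++⁻ M c))
      (λ (f , c) → f , ∈-++⁺ˡ c) (λ (f , c) → f , ∈-++⁺ʳ M c) (λ (_ , c) (_ , c′) → dis (c , c′))

    -- For nonempty `P′` this fails only if `P′` has one position and `m = 2`, the shape of A 4 2.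
    -- It secures a third exit from a copy and enough choice for a pivot.
    Rich : Set
    Rich = (3 ≤ m × ∃ (_∈ P′)) ⊎ (∃ λ q → ∃ λ q′ → q ∈ P′ × q′ ∈ P′ × q ≢ q′)

    record Setting : Set where
      constructor setting
      field
        nonempty : 1 ≤ length P′
        rich     : Rich
        adjacent : AdjacentThetas P′
        distant  : DistantThetas P′

    module Inductive (Γ : Setting) where
      open Setting Γ

      uniqueP′ : List.Unique P′
      uniqueP′ = AllPairs.tail uniqueP

      ham : Hamiltonian P′
      ham = hamiltonian uniqueP′ nonempty adjacent distant

      -- Routing through copies

      record Exit (x : V) (e : Fin n) (w : V) : Set where
        constructor exit
        field
          face-exit   : Face x P′ w
          absent-exit : Absent e w

      open Exit

      exit-≔ : ∀ {x e w q t} → Exit x e w → q ∈ P′ → Absent t w → t ≢ e → Exit x e (w [ q ≔ t ])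
      exit-≔ (exit f a) q∈ t∉ t≢e = exit (face-≔ _ q∈ f t∉) (≔-absent _ a t≢e)

      -- If `e` occurs in `x`, overwriting that entry by a missing symbol frees it without leaving
      -- the copy.
      someExit : ∀ {x e} → Inj x → Free x e → e ≢ x ! p → ∃ (Exit x e)
      someExit {x} {e} ι (free φ) e≢ with present? e x
      ... | inj₂ e∉ = x , exit (face-refl ι) e∉
      ... | inj₁ (i , refl) with t , t∉ , _ ← fresh ι [] (ℕ.≤-trans (s≤s z≤n) 2≤m) =
        x [ i ≔ t ] , exit (face-≔ i (≢p⇒∈P′ (φ refl) λ { refl → e≢ refl }) (face-refl ι) t∉) (≔-absent-old i ι t∉)

      -- Two vertices may have to be avoided at once: the one where the copy is entered, and the one
      -- whose image in the next copy is the final target. Hence three.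
      threeExits : ∀ {x e w} → Exit x e w → ∃ λ ws → List.Unique ws × length ws ≡ 3 × All (Exit x e) ws
      threeExits {x} {e} {w} E@(exit (face ι _) _) with fresh ι [ e ] 2≤m
      ... | t , t∉ , t≢ = go rich
        where
        changed : ∀ {q t} → Absent t w → w ≢ w [ q ≔ t ]
        changed {q} {t} t∉ eq = absent-app t∉ q (≡-trans (cong (_! q) eq) (≔-same w q t))
        go : Rich → ∃ λ ws → List.Unique ws × length ws ≡ 3 × All (Exit x e) ws
        go (inj₁ (3≤m , q , q∈)) with t′ , t′∉ , t′≢ ← fresh ι (e ∷ t ∷ []) 3≤m =
          w ∷ w [ q ≔ t ] ∷ w [ q ≔ t′ ] ∷ [] ,
          (changed t∉ ∷ changed t′∉ ∷ []) ∷
          ((λ eq → t′≢ (there (here (sym (proj₂ (≔-injective t∉ t′∉ eq)))))) ∷ []) ∷ [] ∷ [] ,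
          refl ,
          E ∷ exit-≔ E q∈ t∉ (t≢ ∘ here) ∷ exit-≔ E q∈ t′∉ (t′≢ ∘ here) ∷ []
        go (inj₂ (q , q′ , q∈ , q′∈ , q≢)) =
          w ∷ w [ q ≔ t ] ∷ w [ q′ ≔ t ] ∷ [] ,
          (changed t∉ ∷ changed t∉ ∷ []) ∷
          ((λ eq → q≢ (proj₁ (≔-injective t∉ t∉ eq))) ∷ []) ∷ [] ∷ [] ,
          refl ,
          E ∷ exit-≔ E q∈ t∉ (t≢ ∘ here) ∷ exit-≔ E q′∈ t∉ (t≢ ∘ here) ∷ []

      abstract
        goodExit : ∀ {x e} → Inj x → Free x e → e ≢ x ! p → ∀ y →
          ∃ λ w → Exit x e w × w ≢ x × w [ p ≔ e ] ≢ y
        goodExit {x} {e} ι φ e≢ y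
          with ws , u , l , E ← threeExits (proj₂ (someExit ι φ e≢))
          with w , w∈ , w∉ ← pickFresh _≟ᵛ_ u (x ∷ y [ p ≔ x ! p ] ∷ []) (ℕ.≤-reflexive (sym l)) =
          w , All.lookup E w∈ , w∉ ∘ here , λ eq → w∉ (there (here (back eq)))
          where
          back : w [ p ≔ e ] ≡ y → w ≡ y [ p ≔ x ! p ]
          back refl = ext λ i → sym (≔-elim (w [ p ≔ e ]) p (x ! p) (λ i t → t ≡ w ! i)
            (sym (copy-at (face-exit (All.lookup E w∈)))) (λ i≢ → ≔-other w e i≢) i)

      -- Each copy is crossed by a Hamiltonian path from its entry to an exit towards the next copy.
      -- The exit differs from the entry and does not lead to `y`, so every crossing has two
      -- distinct ends.
      chain : ∀ es {x y} → Inj x → Face x P y → x ! p ≢ y ! p → List.Unique es →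
        x ! p ∉ es → y ! p ∉ es → All (Free x) es →
        ∃ λ zs → Walk x y zs × Cover (InCopies x (x ! p ∷ y ! p ∷ es)) zs
      chain-via : ∀ e {M x y} → Inj x → Free x e → e ≢ x ! p → x ! p ∉ M → 
        (∀ {x₁} → Face x P x₁ → x₁ ! p ≡ e → x₁ ≢ y →
          ∃ λ zs → Walk x₁ y zs × Cover (InCopies x₁ M) zs) →
        ∃ λ zs → Walk x y zs × Cover (InCopies x (x ! p ∷ M)) zs

      chain-via e {M} {x} {y} ι φ e≢ x∉ rest
        with w , exit f e∉ , w≢x , w≢y ← goodExit ι φ e≢ y
        with zs₁ , π₁ , C₁ ← ham ι f (w≢x ∘ sym)
        with f₁ ← ≔p-face (copy⇒face (face-refl ι) f) e∉
        with zs₂ , π₂ , C₂ ← rest f₁ (≔-same w p e) w≢y =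
        zs₁ ++ zs₂ ,
        join π₁ (≔-adj p (absent-app e∉ p)) π₂ ,
        cover-join (λ { (here refl , c∈) → x∉ c∈ }) (cover-copy (face-refl ι) C₁) (cover-base ι f₁ C₂)

      chain [] {x} {y} ι f x≢y _ _ _ _ =
        chain-via (y ! p) ι (free-at f (here refl)) (x≢y ∘ sym) (λ { (here eq) → x≢y eq })
          λ f₁ eq x₁≢y → let zs , π , C = ham (faceInj f₁) (face⇒copy f₁ f (sym eq)) x₁≢y in
            zs , π , subst (λ c → Cover (InCopies _ [ c ]) zs) eq (cover-copy (face-refl (faceInj f₁)) C)
      chain (e ∷ es) {x} {y} ι f x≢y (e∉ ∷ u) x∉ y∉ (φ ∷ φs) =
        let zs , π , C = chain-via e {y ! p ∷ e ∷ es} ι φ (λ eq → x∉ (here (sym eq)))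
              (λ { (here eq) → x≢y eq ; (there c) → x∉ c })
              λ {x₁} f₁ eq x₁≢y →
                let f₂ = face-trans (face-sym ι f₁) f
                    zs , π , C = chain es (faceInj f₁) f₂
                      (λ eq′ → y∉ (here (≡-trans (sym eq′) eq))) u
                      (λ e∈ → All.lookup e∉ (subst (_∈ es) eq e∈) refl) (y∉ ∘ there) (All.map (free-face f₁) φs)
                in zs , π , cover-same
                     (λ { (here c) → there (here (≡-trans c eq)) ; (there (here c)) → here c ; (there (there c)) → there (there c) })
                     (λ { (here c) → there (here c) ; (there (here c)) → here (≡-trans c (sym eq)) ; (there (there c)) → there (there c) }) C
        in zs , π , C

      copiesOf : List V → List (Fin n)
      copiesOf = map (_! p)

      ∈-copiesOf : ∀ {c X} → c ∈ copiesOf X → ∃ λ x → x ∈ X × x ! p ≡ c × (∃ λ X′ → X ↭ x ∷ X′)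
      ∈-copiesOf c∈ with x , x∈ , eq ← ∈-map⁻ (_! p) c∈ = x , x∈ , sym eq , ∈-↭ x∈

      -- A copy holds at most one start and at most one end, possibly one of each; then one
      -- Hamiltonian path of the copy can join them, which is why they must be distinct vertices.
      record Terminals (u : V) (X Y : List V) : Set where
        constructor terminals
        field
          startsIn     : All (Face u P) X
          endsIn       : All (Face u P) Y
          uniqueStarts : List.Unique (copiesOf X)
          uniqueEnds   : List.Unique (copiesOf Y)
          sameLength   : length X ≡ length Y
          distinct     : Disjoint X Y

      dropTerminals : ∀ {u x y X Y X₀ Y₀} → X₀ ↭ x ∷ X → Y₀ ↭ y ∷ Y → Terminals u X₀ Y₀ → Terminals u (x ∷ X) (y ∷ Y) × Terminals u X Y
      dropTerminals q r (terminals a b c d e f)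
        with _ ∷ a′ ← All-resp-↭ q a | _ ∷ b′ ← All-resp-↭ r b
           | _ ∷ c′ ← Unique-resp-↭ (↭-map (_! p) q) c | _ ∷ d′ ← Unique-resp-↭ (↭-map (_! p) r) d =
        terminals (All-resp-↭ q a) (All-resp-↭ r b) (Unique-resp-↭ (↭-map (_! p) q) c) (Unique-resp-↭ (↭-map (_! p) r) d)
          len (λ (x∈ , y∈) → f (∈-resp-↭ (↭-sym q) x∈ , ∈-resp-↭ (↭-sym r) y∈)) ,
        terminals a′ b′ c′ d′ (ℕ.suc-injective len)
          (λ (x∈ , y∈) → f (∈-resp-↭ (↭-sym q) (there x∈) , ∈-resp-↭ (↭-sym r) (there y∈)))
        where len = ≡-trans (sym (↭-length q)) (≡-trans e (↭-length r))

      Routed : V → List (Fin n) → List V → List V → Set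
      Routed u M X Y = ∃ λ B → Linkage X Y B × Cover (InCopies u M) B

      addRoute : ∀ {u x y X Y X₀ Y₀ zs N M M₀} → X₀ ↭ x ∷ X → Y₀ ↭ y ∷ Y → Walk x y zs →
        Cover (InCopies u N) zs → Disjoint N M → N ++ M ⊆ M₀ → M₀ ⊆ N ++ M → Routed u M X Y → Routed u M₀ X₀ Y₀
      addRoute q r π C dis ⊆₁ ⊆₂ (B , L , D) =
        _ , relink (↭-sym q) (↭-sym r) ↭-refl (beside (single π) L) , cover-same ⊆₁ ⊆₂ (cover-join dis C D)

      -- A start that shares its copy with an end is joined to it there. A start alone in its copy
      -- is joined, across the two copies, to an end alone in its own.
      routeExact : ∀ {u} X {Y} → Inj u → Terminals u X Y → Routed u (copiesOf X ++ copiesOf Y) X Y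
      routeExact [] {[]} ι T = [] , toLinkage [] , record { unique = [] ; sound = λ () ; complete = λ () }
      routeExact {u} (x ∷ X) {Y} ι T with x ! p ∈ˢ? copiesOf Y
      ... | yes x∈ with y , y∈ , eq , Y′ , r ← ∈-copiesOf x∈
        with terminals (f ∷ _) (g ∷ _) (c ∷ _) (d ∷ _) _ dis , T′ ← dropTerminals ↭-refl r T =
        let zs , π , C = ham (faceInj f) (face⇒copy f g eq) λ { refl → dis (here refl , here refl) } in
        addRoute ↭-refl r π (cover-copy f C)
          (λ { (here refl , c∈) → [ (λ c′ → All.lookup c c′ refl) , (λ d′ → All.lookup d d′ eq) ]′ (∈-++⁻ (copiesOf X) c∈) })
          (λ { (here refl) → here refl
             ; (there c∈) → there ([ ∈-++⁺ˡ , ∈-++⁺ʳ (copiesOf X) ∘ ∈-resp-↭ (↭-map (_! p) (↭-sym r)) ∘ there ]′ (∈-++⁻ (copiesOf X) c∈)) })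
          (λ { (here refl) → here refl
             ; (there c∈) → [ there ∘ ∈-++⁺ˡ , (λ d′ → last (∈-resp-↭ (↭-map (_! p) r) d′)) ]′ (∈-++⁻ (copiesOf X) c∈) })
          (routeExact X ι T′)
        where
        last : ∀ {c} → c ∈ y ! p ∷ copiesOf Y′ → c ∈ x ! p ∷ copiesOf X ++ copiesOf Y′
        last (here refl) = here eq
        last (there c∈) = there (∈-++⁺ʳ (copiesOf X) c∈)
      routeExact {u} (x ∷ X) {Y} ι T | no x∉
        -- There is one more end than there are remaining starts, so some end has a copy free of
        -- them; the copy of `x` holds no end anyway.
        with c₀ , c₀∈ , c₀∉ ← pickFresh _≟_ (Terminals.uniqueEnds T) (copiesOf X)
          (ℕ.≤-reflexive (≡-trans (cong suc (length-map (_! p) X)) (≡-trans (Terminals.sameLength T) (sym (length-map (_! p) Y)))))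
        with y , y∈ , refl , Y′ , r ← ∈-copiesOf c₀∈
        with terminals (f ∷ _) (g ∷ _) (c ∷ _) (d ∷ _) _ dis , T′ ← dropTerminals ↭-refl r T =
        let x≢y = λ eq → x∉ (subst (_∈ copiesOf Y) (sym eq) c₀∈)
            zs , π , C = chain [] (faceInj f) (face-trans (face-sym ι f) g) x≢y [] (λ ()) (λ ()) [] in
        addRoute ↭-refl r π (cover-base ι f C)
          (λ { (here refl , c∈) → [ (λ c′ → All.lookup c c′ refl)
                                  , (λ d′ → x∉ (∈-resp-↭ (↭-map (_! p) (↭-sym r)) (there d′))) ]′ (∈-++⁻ (copiesOf X) c∈)
             ; (there (here refl) , c∈) → [ c₀∉ , (λ d′ → All.lookup d d′ refl) ]′ (∈-++⁻ (copiesOf X) c∈) })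
          (λ { (here refl) → here refl
             ; (there (here refl)) → there (∈-++⁺ʳ (copiesOf X) c₀∈)
             ; (there (there c∈)) → there ([ ∈-++⁺ˡ , ∈-++⁺ʳ (copiesOf X) ∘ ∈-resp-↭ (↭-map (_! p) (↭-sym r)) ∘ there ]′ (∈-++⁻ (copiesOf X) c∈)) })
          (λ { (here refl) → here refl
             ; (there c∈) → [ there ∘ there ∘ ∈-++⁺ˡ , (λ d′ → last (∈-resp-↭ (↭-map (_! p) r) d′)) ]′ (∈-++⁻ (copiesOf X) c∈) })
          (routeExact X ι T′)
        where
        last : ∀ {c} → c ∈ y ! p ∷ copiesOf Y′ → c ∈ x ! p ∷ y ! p ∷ copiesOf X ++ copiesOf Y′
        last (here refl) = there (here refl)
        last (there c∈) = there (there (∈-++⁺ʳ (copiesOf X) c∈))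

      -- Copies without terminals are absorbed by one chain between different copies. An end in a
      -- copy without a start provides such a chain; in the other alternative every copy of `M` has
      -- a start and none is idle.
      routeAll : ∀ {u M X Y} → Inj u → List.Unique M → All (Free u) M → Terminals u X Y →
        copiesOf X ⊆ M → copiesOf Y ⊆ M →
        (∃ λ c → c ∈ copiesOf Y × c ∉ copiesOf X) ⊎ M ⊆ copiesOf X → Routed u M X Y
      routeAll {X = X} ι uM φ T X⊆ Y⊆ (inj₂ M⊆) with B , L , C ← routeExact X ι T =
        B , L , cover-same ([ X⊆ , Y⊆ ]′ ∘ ∈-++⁻ (copiesOf X)) (∈-++⁺ˡ ∘ M⊆) C
      routeAll {u} {M} {X} {Y} ι uM φ T X⊆ Y⊆ (inj₁ (_ , y∈ , y∉))
        with y , _ , refl , Y′ , r ← ∈-copiesOf y∈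
        -- There is one more start than there are ends besides `y`, so some start shares its copy
        -- with none of these. The chain from it to `y` takes in all idle copies `E`.
        with c₀ , c₀∈ , c₀∉ ← pickFresh _≟_ (Terminals.uniqueStarts T) (copiesOf Y′)
          (ℕ.≤-reflexive (≡-trans (cong suc (length-map (_! p) Y′)) (≡-trans (sym (↭-length r)) (≡-trans (sym (Terminals.sameLength T)) (sym (length-map (_! p) X))))))
        with x , _ , refl , X′ , q ← ∈-copiesOf c₀∈
        with terminals (f ∷ _) (g ∷ _) (c ∷ _) (d ∷ _) _ dis , T′ ← dropTerminals q r T =
        let zs , π , C = chain E (faceInj f) (face-trans (face-sym ι f) g) x≢y (Unique.filter⁺ used? uM)
              (λ x∈ → proj₂ (∈-filter⁻ used? {xs = M} x∈) (∈-++⁺ˡ c₀∈))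
              (λ y∈′ → proj₂ (∈-filter⁻ used? {xs = M} y∈′) (∈-++⁺ʳ (copiesOf X) y∈))
              (All.map (free-face f) (All.tabulate λ e∈ → All.lookup φ (proj₁ (∈-filter⁻ used? {xs = M} e∈)))) in
        addRoute q r π (cover-base ι f C)
          (λ { (here refl , c∈) → [ (λ c′ → All.lookup c c′ refl) , c₀∉ ]′ (∈-++⁻ (copiesOf X′) c∈)
             ; (there (here refl) , c∈) → [ (λ c′ → y∉ (∈-resp-↭ (↭-map (_! p) (↭-sym q)) (there c′))) , (λ d′ → All.lookup d d′ refl) ]′ (∈-++⁻ (copiesOf X′) c∈)
             ; (there (there e∈) , c∈) → proj₂ (∈-filter⁻ used? {xs = M} e∈) (up c∈) })
          (λ { (here refl) → X⊆ c₀∈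
             ; (there (here refl)) → Y⊆ y∈
             ; (there (there c∈)) → [ (λ e∈ → proj₁ (∈-filter⁻ used? {xs = M} e∈)) , ([ X⊆ , Y⊆ ]′ ∘ ∈-++⁻ (copiesOf X)) ∘ up ]′ (∈-++⁻ E c∈) })
          (λ {c} c∈ → down c∈)
          (routeExact X′ ι T′)
        where
        used? = λ c → ¬? (c ∈ˢ? (copiesOf X ++ copiesOf Y))
        E = filter used? M
        x≢y : x ! p ≢ y ! p
        x≢y eq = y∉ (subst (_∈ copiesOf X) eq c₀∈)
        up : ∀ {c} → c ∈ copiesOf X′ ++ copiesOf Y′ → c ∈ copiesOf X ++ copiesOf Y
        up c∈ = [ ∈-++⁺ˡ ∘ ∈-resp-↭ (↭-map (_! p) (↭-sym q)) ∘ there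
                , ∈-++⁺ʳ (copiesOf X) ∘ ∈-resp-↭ (↭-map (_! p) (↭-sym r)) ∘ there ]′ (∈-++⁻ (copiesOf X′) c∈)
        down : M ⊆ (x ! p ∷ y ! p ∷ E) ++ copiesOf X′ ++ copiesOf Y′
        down {c} c∈ with c ∈ˢ? (copiesOf X ++ copiesOf Y)
        ... | no c∉ = there (there (∈-++⁺ˡ (∈-filter⁺ used? c∈ c∉)))
        ... | yes c∈′ with ∈-++⁻ (copiesOf X) c∈′
        ...   | inj₁ c∈X with ∈-resp-↭ (↭-map (_! p) q) c∈X
        ...     | here refl = here refl
        ...     | there c∈X′ = there (there (∈-++⁺ʳ E (∈-++⁺ˡ c∈X′)))
        down {c} c∈ | yes c∈′ | inj₂ c∈Y with ∈-resp-↭ (↭-map (_! p) r) c∈Y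
        ...     | here refl = there (here refl)
        ...     | there c∈Y′ = there (there (∈-++⁺ʳ E (∈-++⁺ʳ (copiesOf X′) c∈Y′)))

      abstract
        route : ∀ {u M X Y} → Inj u → List.Unique M → All (Free u) M → Terminals u X Y →
          copiesOf X ⊆ M → copiesOf Y ⊆ M →
          (∃ λ c → c ∈ copiesOf Y × c ∉ copiesOf X) ⊎ M ⊆ copiesOf X → Routed u M X Y
        route = routeAll

      -- indices of the copies other than that of u
      symbols : V → List (Fin n)
      symbols u = map (u !_) P′ ++ missing u

      ∈-symbols⁺ : ∀ {u c} → Free u c → c ≢ u ! p → c ∈ symbols u
      ∈-symbols⁺ {u} {c} (free φ) c≢ with present? c u
      ... | inj₂ c∉ = ∈-++⁺ʳ (map (u !_) P′) (∈-missing⁺ c∉)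
      ... | inj₁ (i , refl) = ∈-++⁺ˡ (∈-map⁺ (u !_) (≢p⇒∈P′ (φ refl) λ { refl → c≢ refl }))

      ∈-symbols⁻ : ∀ {u c} → Inj u → c ∈ symbols u → Free u c × c ≢ u ! p
      ∈-symbols⁻ {u} (inj ι) c∈ with ∈-++⁻ (map (u !_) P′) c∈
      ... | inj₂ c∈′ = free-absent (∈-missing⁻ c∈′) , absent-app (∈-missing⁻ c∈′) p ∘ sym
      ... | inj₁ c∈′ with i , i∈ , refl ← ∈-map⁻ (u !_) c∈′ =
        free (λ eq → subst (_∈ P) (sym (ι eq)) (there i∈)) , λ eq → ∈P′⇒≢p i∈ (ι eq)

      symbols-unique : ∀ {u} → Inj u → List.Unique (symbols u)
      symbols-unique {u} (inj ι) = Unique.++⁺ (Unique.map⁺ ι uniqueP′) (missing-unique u)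
        λ (c∈ , c∈′) → let i , _ , eq = ∈-map⁻ (u !_) c∈ in absent-app (∈-missing⁻ c∈′) i (sym eq)

      symbols-free : ∀ {u} → Inj u → All (Free u) (symbols u)
      symbols-free ι = All.tabulate (proj₁ ∘ ∈-symbols⁻ ι)

      face-symbols : ∀ {u w} → Face u P w → w ! p ≢ u ! p → w ! p ∈ symbols u
      face-symbols f ne = ∈-symbols⁺ (free-at f (here refl)) ne

      shifts : V → List (Fin n) → List V
      shifts w = map (λ c → w [ p ≔ c ])

      copiesOf-shifts : ∀ w C → copiesOf (shifts w C) ≡ C
      copiesOf-shifts w [] = refl
      copiesOf-shifts w (c ∷ C) = cong₂ _∷_ (≔-same w p c) (copiesOf-shifts w C)

      All-shifts : ∀ {Q : V → Set} {w C} → (∀ {c} → c ∈ C → Q (w [ p ≔ c ])) → All Q (shifts w C)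
      All-shifts {Q} {w} q = All.tabulate λ x∈ → let c , c∈ , eq = ∈-map⁻ (λ c → w [ p ≔ c ]) x∈ in subst Q (sym eq) (q c∈)

      shifts-face : ∀ {u w C} → Face u P w → All (λ c → Absent c w) C → All (Face u P) (shifts w C)
      shifts-face f a = All-shifts λ c∈ → ≔p-face f (All.lookup a c∈)

      shifts-adj : ∀ {w C} → All (λ c → Absent c w) C → All (Adj w) (shifts w C)
      shifts-adj a = All-shifts λ c∈ → ≔-adj p (absent-app (All.lookup a c∈) p)

      -- A difference away from `p` survives every change at `p`, which keeps all shifts of `x` and
      -- `y` distinct.
      Apart : V → V → Set
      Apart x y = ∃ λ j → j ≢ p × x ! j ≢ y ! j

      apart⇒≢ : ∀ {x y} → Apart x y → x ≢ y
      apart⇒≢ (j , _ , d) refl = d refl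

      apart-≔ : ∀ {x y} c d → Apart x y → Apart (x [ p ≔ c ]) (y [ p ≔ d ])
      apart-≔ {x} {y} c d (j , j≢ , ne) =
        j , j≢ , λ eq → ne (≡-trans (sym (≔-other x c j≢)) (≡-trans eq (≔-other y d j≢)))

      shifts-disjoint : ∀ {x y C D} → Apart x y → Disjoint (shifts x C) (shifts y D)
      shifts-disjoint {x} {y} a (w∈ , w∈′)
        with c , _ , refl ← ∈-map⁻ (λ c → x [ p ≔ c ]) w∈
        with d , _ , eq ← ∈-map⁻ (λ c → y [ p ≔ c ]) w∈′ = apart⇒≢ (apart-≔ c d a) eq

      -- Two vertices in a common copy

      routeAway : ∀ {u X Y} → Inj u → Terminals u X Y → u ! p ∉ copiesOf X → u ! p ∉ copiesOf Y →
        (∃ λ c → c ∈ copiesOf Y × c ∉ copiesOf X) → Routed u (symbols u) X Y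
      routeAway {u} {X} {Y} ι T uX uY w = route ι (symbols-unique ι) (symbols-free ι) T
        (within uX (Terminals.startsIn T)) (within uY (Terminals.endsIn T)) (inj₁ w)
        where
        within : ∀ {Z} → u ! p ∉ copiesOf Z → All (Face u P) Z → copiesOf Z ⊆ symbols u
        within u∉ fs c∈ with z , z∈ , refl , _ ← ∈-copiesOf c∈ =
          face-symbols (All.lookup fs z∈) λ eq → u∉ (subst (_∈ _) eq c∈)

      joinHome : ∀ {u v A B} → Cover (Face u P′) (u ∷ v ∷ A) → Cover (InCopies u (symbols u)) B → Inj u →
        Cover (Face u P) (u ∷ v ∷ A ++ B)
      joinHome {u} C D ι = cover-++ splitFace (copy⇒face (face-refl ι)) proj₁
        (λ f (_ , c∈) → proj₂ (∈-symbols⁻ ι c∈) (copy-at f)) C D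
        where
        splitFace : ∀ {w} → Face u P w → Face u P′ w ⊎ InCopies u (symbols u) w
        splitFace {w} f with w ! p ≟ u ! p
        ... | yes eq = inj₁ (face⇒copy (face-refl ι) f eq)
        ... | no ne = inj₂ (f , face-symbols f ne)

      -- If all prescribed vertices lie in the copy, one path is prolonged: instead of stepping from
      -- its last vertex `y` to `v`, it visits all other copies and reaches `v` from one of them.
      detour : ∀ {u v X} → Inj u → Face u P v → u ! p ≡ v ! p → X ≢ [] → Theta P′ u v X → Theta P u v X
      detour {u} {v} {X} ι f eq X≢ T@(theta L ends~ C) = go ends~ L (ends-face T) (linkage-length L)
        where
        go : ∀ {Y} → All (λ y → Adj y v) Y → Linkage X Y _ → (∀ {y} → y ∈ Y → Face u P′ y) →
          length X ≡ length Y → Theta P u v X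
        go [] L _ len = contradiction (nil X len) X≢
          where
          nil : ∀ (X : List V) → length X ≡ 0 → X ≡ []
          nil [] _ = refl
        go {y ∷ Y} (y~v ∷ Y~v) L inFace _ with c , c∉ , _ ← fresh (faceInj f) [] (ℕ.≤-trans (s≤s z≤n) 2≤m) =
          theta (relink (↭-reflexive (++-identityʳ X)) ↭-refl ↭-refl (glue (≔-adj p (absent-app e∉ p) ∷ []) L L′))
                (All.++⁺ Y~v (Adj-sym (≔-adj p (absent-app c∉ p)) ∷ []))
                (joinHome C C′ ι)
          where
          -- This is the symbol of `v` that its neighbour `y` lacks. As `v` has it, it differs from
          -- `c`, so the other copies are entered and left in different copies.
          e = v ! at y~v
          e∉ : Absent e y
          e∉ = adj-absent (faceInj f) y~v
          g : Face u P y
          g = copy⇒face (face-refl ι) (inFace (here refl))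
          y≡u : y ! p ≡ u ! p
          y≡u = copy-at (inFace (here refl))
          R = routeAway {u} {[ y [ p ≔ e ] ]} {[ v [ p ≔ c ] ]} ι
            (terminals (≔p-face g e∉ ∷ []) (≔p-face f c∉ ∷ []) ([] ∷ []) ([] ∷ []) refl
              λ { (here refl , here e) → absent-app c∉ (at y~v) (≡-trans (sym (≔-same y p _)) (≡-trans (cong (_! p) e) (≔-same v p c))) })
            (λ { (here e′) → absent-app e∉ p (≡-trans y≡u (≡-trans e′ (≔-same y p e))) })
            (λ { (here e′) → absent-app c∉ p (≡-trans (sym eq) (≡-trans e′ (≔-same v p c))) })
            (_ , here refl , λ { (here e′) → absent-app c∉ (at y~v) (≡-trans (sym (≔-same y p e)) (≡-trans (sym e′) (≔-same v p c))) })
          L′ = proj₁ (proj₂ R)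
          C′ = proj₂ (proj₂ R)

      -- The paths inside the copy are kept; new ones run outside it between shifts of `u` and
      -- shifts of `v`. The symbol in `D` but not in `C` lets them absorb the idle copies.
      outward : ∀ {u v X C D} → Inj u → Face u P v → u ! p ≡ v ! p → Apart u v →
        All (λ c → Absent c u) C → All (λ c → Absent c v) D → List.Unique C → List.Unique D → length C ≡ length D →
        (∃ λ c → c ∈ D × c ∉ C) → Theta P′ u v X → Theta P u v (X ++ shifts u C)
      outward {u} {v} {X} {C} {D} ι f eq apart C∉ D∉ uC uD len (c , c∈ , c∉) T@(theta L ends~ K) =
        theta (beside L L′) (All.++⁺ ends~ (All.map Adj-sym (shifts-adj D∉))) (joinHome K K′ ι)
        where
        C≡ = copiesOf-shifts u C
        D≡ = copiesOf-shifts v D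
        R = routeAway {u} {shifts u C} {shifts v D} ι
          (terminals (shifts-face (face-refl ι) C∉) (shifts-face f D∉)
            (subst List.Unique (sym C≡) uC) (subst List.Unique (sym D≡) uD)
            (≡-trans (length-map _ C) (≡-trans len (sym (length-map _ D)))) (shifts-disjoint apart))
          (λ u∈ → absent-app (All.lookup C∉ (subst (u ! p ∈_) C≡ u∈)) p refl)
          (λ u∈ → absent-app (All.lookup D∉ (subst (u ! p ∈_) D≡ u∈)) p (sym eq))
          (c , subst (c ∈_) (sym D≡) c∈ , c∉ ∘ subst (c ∈_) C≡)
        L′ = proj₁ (proj₂ R)
        K′ = proj₂ (proj₂ R)

      adjacentStep : ∀ {u v X} → Inj u → Face u P v → Adj u v → u ! p ≡ v ! p →
        All (λ x → Adj u x × Face u P x) X → List.Unique X → v ∉ X → X ≢ [] → Theta P u v X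
      adjacentStep {u} {v} {X} ι f a eq X✓ uX v∉ X≢ = go Xa C refl refl
        where
        home? = λ x → x ! p ≟ u ! p
        Xa = filter home? X
        Xo = filter (λ x → ¬? (home? x)) X
        C = copiesOf Xo
        f′ : Face u P′ v
        f′ = face⇒copy (face-refl ι) f (sym eq)
        Xo✓ : ∀ {x} → x ∈ Xo → Adj u x × Face u P x × x ! p ≢ u ! p
        Xo✓ x∈ = let x∈X , ne = ∈-filter⁻ (λ x → ¬? (home? x)) {xs = X} x∈ ; b , g = All.lookup X✓ x∈X in b , g , ne
        shape : ∀ {x} → Adj u x × Face u P x × x ! p ≢ u ! p → Absent (x ! p) u × x ≡ u [ p ≔ x ! p ]
        shape (b , g , ne) with at b ≟ p
        ... | yes refl = adj-absent (faceInj g) b , adj⇒≔ b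
        ... | no at≢ = contradiction (sym (agree b (at≢ ∘ sym))) ne
        Xo≡ : shifts u C ≡ Xo
        Xo≡ = help Xo Xo✓
          where
          help : ∀ Z → (∀ {x} → x ∈ Z → Adj u x × Face u P x × x ! p ≢ u ! p) → shifts u (copiesOf Z) ≡ Z
          help [] _ = refl
          help (z ∷ Z) h = cong₂ _∷_ (sym (proj₂ (shape (h (here refl))))) (help Z (h ∘ there))
        C∉ : All (λ c → Absent c u) C
        C∉ = All.tabulate λ c∈ → let x , x∈ , e , _ = ∈-copiesOf c∈ in subst (λ c → Absent c u) e (proj₁ (shape (Xo✓ x∈)))
        uC : List.Unique C
        uC = unique-map
          (λ x∈ y∈ e → ≡-trans (proj₂ (shape (Xo✓ x∈))) (≡-trans (cong (λ c → u [ p ≔ c ]) e) (sym (proj₂ (shape (Xo✓ y∈))))))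
          (Unique.filter⁺ (λ x → ¬? (home? x)) uX)
        X↭ : Xa ++ shifts u C ↭ X
        X↭ = ↭-trans (↭-reflexive (cong (Xa ++_) Xo≡)) (↭-sym (filter-split home? X))
        Xa✓ : ∀ {x} → x ∈ Xa → Adj u x × Face u P′ x
        Xa✓ x∈ = let x∈X , e = ∈-filter⁻ home? {xs = X} x∈ ; b , g = All.lookup X✓ x∈X in b , face⇒copy (face-refl ι) g e
        q = at a
        q∈ : q ∈ P′
        q∈ = face-adj-∈ f′ a
        apart : Apart u v
        apart = q , ∈P′⇒≢p q∈ , differ a
        -- The symbol given up between `u` and `v` is missing from `v` but not from `u`: it is the
        -- copy with an end and no start that the routing demands.
        old : Absent (u ! q) v
        old = adj-absent ι (Adj-sym a)
        old∉C : u ! q ∉ C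
        old∉C q∈C = absent-app (All.lookup C∉ q∈C) q refl
        R↭ = ∈-↭ (∈-missing⁺ old)
        R = proj₁ R↭
        uR : List.Unique (u ! q ∷ R)
        uR = Unique-resp-↭ (proj₂ R↭) (missing-unique v)
        R∉ : ∀ {c} → c ∈ u ! q ∷ R → Absent c v
        R∉ c∈ = ∈-missing⁻ (∈-resp-↭ (↭-sym (proj₂ R↭)) c∈)
        lenC : ∀ {c C′} → C ≡ c ∷ C′ → length C′ ≤ length R
        lenC e = ℕ.≤-pred (ℕ.≤-trans (ℕ.≤-reflexive (cong length (sym e))) (ℕ.≤-trans (⊆-length uC (λ c∈ → ∈-missing⁺ (All.lookup C∉ c∈)))
          (ℕ.≤-reflexive (≡-trans (missing-length ι) (≡-trans (sym (missing-length (faceInj f))) (↭-length (proj₂ R↭)))))))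
        go : ∀ Xa′ C′ → Xa′ ≡ Xa → C′ ≡ C → Theta P u v X
        go [] [] eq₁ eq₂ = contradiction (help X (subst (_↭ X) (cong₂ (λ Z Z′ → Z ++ shifts u Z′) (sym eq₁) (sym eq₂)) X↭)) X≢
          where
          help : ∀ X → [] ↭ X → X ≡ []
          help X r = nil X (↭-length r)
            where
            nil : ∀ (X : List V) → 0 ≡ length X → X ≡ []
            nil [] _ = refl
        go (x ∷ Xa′) [] eq₁ eq₂ = theta-↭ ↭-refl X↭′
          (detour ι f eq (λ e → case≢ e)
            (adjacent ι f′ a (All.tabulate Xa✓) (Unique.filter⁺ home? uX)
              (λ v∈ → v∉ (proj₁ (∈-filter⁻ home? {xs = X} v∈))) (λ e → case≢ e)))
          where
          case≢ : Xa ≢ []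
          case≢ e with ≡-trans eq₁ e
          ... | ()
          X↭′ : Xa ↭ X
          X↭′ = ↭-trans (↭-reflexive (≡-trans (sym (++-identityʳ Xa)) (cong (λ Z → Xa ++ shifts u Z) eq₂))) X↭
        go (x ∷ Xa′) (c ∷ C′) eq₁ eq₂ = theta-↭ ↭-refl X↭
          (outward ι f eq apart C∉ (All.tabulate D∉) uC (take-unique _) 
            lenD (u ! q , here refl , old∉C)
            (adjacent ι f′ a (All.tabulate Xa✓) (Unique.filter⁺ home? uX)
              (λ v∈ → v∉ (proj₁ (∈-filter⁻ home? {xs = X} v∈))) (λ e → case≢ e)))
          where
          case≢ : Xa ≢ []
          case≢ e with ≡-trans eq₁ e
          ... | ()
          D = u ! q ∷ take (length C′) R
          D∉ : ∀ {d} → d ∈ D → Absent d v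
          D∉ (here refl) = R∉ (here refl)
          D∉ (there d∈) = R∉ (there (take-⊆ (length C′) R d∈))
          take-unique : ∀ i → List.Unique (u ! q ∷ take i R)
          take-unique i = Unique.take⁺ (suc i) uR
          lenD : length C ≡ length D
          lenD = ≡-trans (cong length (sym eq₂)) (cong suc (sym (length-take-≤ (length C′) R (lenC (sym eq₂)))))
        -- All prescribed vertices lie outside, so the copy itself has to be entered from there: at
        -- `w`, a neighbour of `u` other than `v`, coming from the copy `u ! q`. One outside path
        -- continues through `w` while the others go to shifts of `v`.
        go [] (c ∷ C′) eq₁ eq₂ with r , r∉ , r≢ ← fresh ι [ v ! q ] 2≤m
          with theta {bag = A} L ends~ K ← adjacent ι f′ a ((≔-adj q (absent-app r∉ q) , face-≔ q q∈ (face-refl ι) r∉) ∷ [])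
             ([] ∷ []) (λ { (here e) → r≢ (here (≡-trans (sym (≔-same u q r)) (cong (_! q) (sym e)))) }) (λ ()) =
          theta-↭ ↭-refl X↭′ (theta
            (relink (↭-reflexive (++-identityʳ _)) ↭-refl (++-comm (proj₁ R′) A) (glue (Adj-sym (≔-adj p (absent-app x∉ p)) ∷ []) L′ L))
            (All.++⁺ (All.map Adj-sym (shifts-adj D∉)) ends~)
            (joinHome K K′ ι))
          where
          w = u [ q ≔ r ]
          x∉ : Absent (u ! q) w
          x∉ = ≔-absent-old q ι r∉
          X↭′ : shifts u C ↭ X
          X↭′ = subst (λ Z → Z ++ shifts u C ↭ X) (sym eq₁) X↭
          D = take (length C′) R
          D∉ : All (λ d → Absent d v) D
          D∉ = All.tabulate λ d∈ → R∉ (there (take-⊆ (length C′) R d∈))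
          g : Face u P w
          g = face-≔ q (there q∈) (face-refl ι) r∉
          D≡ = copiesOf-shifts v D
          C≡ = copiesOf-shifts u C
          ends≡ : copiesOf (w [ p ≔ u ! q ] ∷ shifts v D) ≡ u ! q ∷ D
          ends≡ = cong₂ _∷_ (≔-same w p (u ! q)) D≡
          R′ = routeAway {u} {shifts u C} {w [ p ≔ u ! q ] ∷ shifts v D} ι
            (terminals (shifts-face (face-refl ι) C∉) (≔p-face g x∉ ∷ shifts-face f D∉)
              (subst List.Unique (sym C≡) uC) (subst List.Unique (sym ends≡) (Unique.take⁺ (suc (length C′)) uR))
              (≡-trans (length-map _ C) (≡-trans (cong length (sym eq₂)) (cong suc (sym (≡-trans (length-map _ D) (length-take-≤ (length C′) R (lenC (sym eq₂))))))))
              λ { (z∈ , here refl) → shifts-disjoint {u} {w} {C} {[ u ! q ]} (q , ∈P′⇒≢p q∈ , λ e → absent-app r∉ q (≡-trans e (≔-same u q r))) (z∈ , here refl)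
                ; (z∈ , there z∈′) → shifts-disjoint apart (z∈ , z∈′) })
            (λ u∈ → absent-app (All.lookup C∉ (subst (u ! p ∈_) C≡ u∈)) p refl)
            (λ u∈ → help (subst (u ! p ∈_) ends≡ u∈))
            (u ! q , subst (u ! q ∈_) (sym ends≡) (here refl) , old∉C ∘ subst (u ! q ∈_) C≡)
            where
            help : u ! p ∉ u ! q ∷ D
            help u∈ = absent-app (R∉ (sub u∈)) p (sym eq)
              where
              sub : u ! p ∈ u ! q ∷ D → u ! p ∈ u ! q ∷ R
              sub (here e) = here e
              sub (there d∈) = there (take-⊆ (length C′) R d∈)
          L′ = proj₁ (proj₂ R′)
          K′ = proj₂ (proj₂ R′)

      -- Pivots for non-adjacent vertices

      -- The path from u to v leaves the copy of u through neighbours of s and enters the copy of v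
      -- through neighbours of s [ p ≔ v ! p ]; s itself is a neighbour of u.
      record Pivot (u v : V) : Set where
        constructor pivot
        field
          at-j    : Fin k
          symbol  : Fin n
          j∈      : at-j ∈ P′
          symbol∉ : Absent symbol u
          b∉      : Absent (v ! p) (u [ at-j ≔ symbol ])
          symbol≢ : symbol ≢ v ! at-j

      abstract
        -- `s` must lack `b`. If `u` has `b`, the change has to take place at that position; if not,
        -- the new symbol must avoid both `b` and the entry of `v`, and `Rich` leaves room for this.
        findPivot : ∀ {u v} → Inj u → Face u P v → u ! p ≢ v ! p → Pivot u v
        findPivot {u} {v} ι f a≢b with present? (v ! p) u
        ... | inj₁ (i , eq) with d , d∉ , d≢ ← fresh ι [ v ! i ] 2≤m =
          pivot i d i∈ d∉ (subst (λ b → Absent b (u [ i ≔ d ])) eq (≔-absent-old i ι d∉)) (d≢ ∘ here)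
          where
          i∈ : i ∈ P′
          i∈ with i ∈ᵖ? P
          ... | yes i∈ = ≢p⇒∈P′ i∈ λ { refl → a≢b eq }
          ... | no i∉ = contradiction (subst (_∈ P) (sym (inj-app (faceInj f) (≡-trans (faceFixed f i∉) eq))) (here refl)) i∉
        ... | inj₂ b∉ = go rich
          where
          go : Rich → Pivot u v
          go (inj₁ (3≤m , q , q∈)) with d , d∉ , d≢ ← fresh ι (v ! p ∷ v ! q ∷ []) 3≤m =
            pivot q d q∈ d∉ (≔-absent q b∉ (d≢ ∘ here)) (d≢ ∘ there ∘ here)
          go (inj₂ (q , q′ , q∈ , q′∈ , q≢)) with d , d∉ , d≢ ← fresh ι [ v ! p ] 2≤m | d ≟ v ! q
          ... | no d≢q = pivot q d q∈ d∉ (≔-absent q b∉ (d≢ ∘ here)) d≢q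
          -- `v` repeats no symbol, so `d`, being its entry at `q`, is not its entry at `q′`.
          ... | yes refl = pivot q′ d q′∈ d∉ (≔-absent q′ b∉ (d≢ ∘ here)) λ eq → q≢ (inj-app (faceInj f) eq)

      record Separated : Set where
        constructor separated
        field
          {u v} : V
          ι     : Inj u
          f     : Face u P v
          a≢b   : u ! p ≢ v ! p
          apart : Apart u v
          π     : Pivot u v

      module Pivoted (Π : Separated) where
        open Separated Π
        open Pivot π renaming (at-j to jᵤ; symbol to d; j∈ to jᵤ∈)

        a b : Fin n
        a = u ! p
        b = v ! p

        s s* : V
        s  = u [ jᵤ ≔ d ]
        s* = s [ p ≔ b ]

        jᵤ≢p : jᵤ ≢ p
        jᵤ≢p = ∈P′⇒≢p jᵤ∈

        ιs : Inj s
        ιs = ≔-inj jᵤ ι symbol∉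

        ιs* : Inj s*
        ιs* = ≔-inj p ιs b∉

        s-p : s ! p ≡ a
        s-p = ≔-other u d (jᵤ≢p ∘ sym)

        s-j : s ! jᵤ ≡ d
        s-j = ≔-same u jᵤ d

        s*-p : s* ! p ≡ b
        s*-p = ≔-same s p b

        face-us : Face u P s
        face-us = face-≔ jᵤ (there jᵤ∈) (face-refl ι) symbol∉

        face-su : Face s P u
        face-su = face-sym ι face-us

        face-sv : Face s P v
        face-sv = face-trans face-su f

        face-ss* : Face s P s*
        face-ss* = ≔p-face (face-refl ιs) b∉

        home-su : Face s P′ u
        home-su = face⇒copy (face-refl ιs) face-su (sym s-p)

        away-v : Face s* P′ v
        away-v = face⇒copy face-ss* face-sv (sym s*-p)

        s~u : Adj s u
        s~u = Adj-sym (≔-adj jᵤ (absent-app symbol∉ jᵤ))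

        s*≢v : s* ≢ v
        s*≢v eq = symbol≢ (≡-trans (sym (≡-trans (≔-other s b jᵤ≢p) s-j)) (cong (_! jᵤ) eq))

        -- For fixed `j` and `t` these vectors have pairwise different entries at `p` and agree
        -- elsewhere: a line of neighbours, one for each index of a copy.
        S : Fin k → Fin n → Fin n → V
        S j t c = s [ j ≔ t ] [ p ≔ c ]

        S-p : ∀ j t c → S j t c ! p ≡ c
        S-p j t c = ≔-same (s [ j ≔ t ]) p c

        S-j : ∀ {j} t c → j ≢ p → S j t c ! j ≡ t
        S-j t c j≢p = ≡-trans (≔-other (s [ _ ≔ t ]) c j≢p) (≔-same s _ t)

        S-other : ∀ {i j} t c → i ≢ p → i ≢ j → S j t c ! i ≡ s ! i
        S-other t c i≢p i≢j = ≡-trans (≔-other (s [ _ ≔ t ]) c i≢p) (≔-other s t i≢j)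

        S-elim : ∀ j t c (Q : Fin k → Fin n → Set) → Q p c → (j ≢ p → Q j t) → (∀ {i} → i ≢ p → i ≢ j → Q i (s ! i)) →
          ∀ i → Q i (S j t c ! i)
        S-elim j t c Q qp qj qs i with i ≟ p
        ... | yes refl = subst (Q i) (sym (S-p j t c)) qp
        ... | no i≢p with i ≟ j
        ...   | yes refl = subst (Q i) (sym (S-j t c i≢p)) (qj i≢p)
        ...   | no i≢j = subst (Q i) (sym (S-other t c i≢p i≢j)) (qs i≢p i≢j)

        S-≔ : ∀ j t c c′ → S j t c [ p ≔ c′ ] ≡ S j t c′
        S-≔ j t c c′ = ext (≔-elim (S j t c) p c′ (λ i x → x ≡ S j t c′ ! i) (sym (S-p j t c′))
          λ {i} i≢p → ≡-trans (≔-other (s [ j ≔ t ]) c i≢p) (sym (≔-other (s [ j ≔ t ]) c′ i≢p)))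

        S-adj : ∀ j t {c c′} → c ≢ c′ → Adj (S j t c) (S j t c′)
        S-adj j t {c} {c′} ne = subst (Adj (S j t c)) (S-≔ j t c c′) (≔-adj p λ eq → ne (≡-trans (sym (S-p j t c)) eq))

        S-a : ∀ {j} t → j ≢ p → s [ j ≔ t ] ≡ S j t a
        S-a {j} t j≢p = ext λ i → sym (S-elim j t a (λ i x → x ≡ s [ j ≔ t ] ! i)
          (sym (≡-trans (≔-other s t (j≢p ∘ sym)) s-p)) (λ _ → sym (≔-same s j t)) (λ _ i≢j → sym (≔-other s t i≢j)) i)

        S-b : ∀ {j} t → j ≢ p → s* [ j ≔ t ] ≡ S j t b
        S-b {j} t j≢p = ext λ i → sym (S-elim j t b (λ i x → x ≡ s* [ j ≔ t ] ! i)
          (sym (≡-trans (≔-other s* t (j≢p ∘ sym)) s*-p)) (λ _ → sym (≔-same s* j t))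
          (λ i≢p i≢j → sym (≡-trans (≔-other s* t i≢j) (≔-other s b i≢p))) i)

        S-face : ∀ {j t c} → j ∈ P′ → Absent t s → Absent c (s [ j ≔ t ]) → Face s P (S j t c)
        S-face j∈ t∉ c∉ = ≔p-face (face-≔ _ (there j∈) (face-refl ιs) t∉) c∉

        s≢a : ∀ {i} → i ≢ p → s ! i ≢ a
        s≢a i≢p eq = i≢p (inj-app ιs (≡-trans eq (sym s-p)))

        missing-a : Absent a s*
        missing-a = absent (≔-elim s p b (λ _ x → x ≢ a) (a≢b ∘ sym) s≢a)

        R : List (Fin n)
        R = proj₁ (∈-↭ (∈-missing⁺ b∉))

        missing-s : missing s ↭ b ∷ R
        missing-s = proj₂ (∈-↭ (∈-missing⁺ b∉))

        R-unique : List.Unique (b ∷ R)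
        R-unique = Unique-resp-↭ missing-s (missing-unique s)

        R∉ : ∀ {c} → c ∈ R → Absent c s
        R∉ c∈ = ∈-missing⁻ (∈-resp-↭ (↭-sym missing-s) (there c∈))

        R≢b : ∀ {c} → c ∈ R → c ≢ b
        R≢b c∈ refl = unique-∉ R-unique c∈

        R-length : suc (length R) ≡ m
        R-length = ≡-trans (sym (↭-length missing-s)) (missing-length ιs)

        -- The indices of all copies of the face other than those of `u` and `v`.
        middle : List (Fin n)
        middle = map (s !_) P′ ++ R

        symbols↭ : symbols s ↭ b ∷ middle
        symbols↭ = ↭-trans (++⁺ˡ (map (s !_) P′) missing-s) (shift b (map (s !_) P′) R)

        middle-unique : List.Unique (b ∷ middle)
        middle-unique = Unique-resp-↭ symbols↭ (symbols-unique ιs)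

        middle-free : All (Free s) middle
        middle-free = All.tabulate λ c∈ → All.lookup (symbols-free ιs) (∈-resp-↭ (↭-sym symbols↭) (there c∈))

        ∈-middle : ∀ {c} → Free s c → c ≢ a → c ≢ b → c ∈ middle
        ∈-middle φ c≢a c≢b = ∷⁻-∈ (∈-resp-↭ symbols↭ (∈-symbols⁺ φ λ eq → c≢a (≡-trans eq s-p))) c≢b

        middle≢a : ∀ {c} → c ∈ middle → c ≢ a
        middle≢a c∈ eq = proj₂ (∈-symbols⁻ ιs (∈-resp-↭ (↭-sym symbols↭) (there c∈))) (≡-trans eq (sym s-p))

        middle≢b : ∀ {c} → c ∈ middle → c ≢ b
        middle≢b c∈ refl = unique-∉ middle-unique c∈

        ∈-middle-face : ∀ {w} → Face s P w → w ! p ≢ a → w ! p ≢ b → w ! p ∈ middle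
        ∈-middle-face g = ∈-middle (free-at g (here refl))

        coverAll : ∀ {A B M} → Cover (Face s P′) (s ∷ u ∷ A) → Cover (InCopies s middle) M → Cover (Face s* P′) (s* ∷ v ∷ B) →
          Cover (Face u P) (u ∷ v ∷ ((A ++ M) ++ s ∷ s* ∷ []) ++ B)
        coverAll {A} {B} {M} C₁ C₂ C₃ = cover-↭
          (solve 7 (λ s s* u v A M B → (s ⊕ (u ⊕ A)) ⊕ ((s* ⊕ (v ⊕ B)) ⊕ M) ⊜ u ⊕ (v ⊕ (((A ⊕ M) ⊕ (s ⊕ s*)) ⊕ B)))
            refl [ s ] [ s* ] [ u ] [ v ] A M B)
          (cover-⇔ (λ (g , c∈) → face-trans face-us g)
                   (λ g → face-trans face-su g , help g)
            (cover-join {u = s} {M = [ a ]} {M′ = b ∷ middle}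
              (λ { (here refl , here eq) → a≢b eq ; (here refl , there c∈) → middle≢a c∈ refl })
              (subst (λ c → Cover (InCopies s [ c ]) (s ∷ u ∷ A)) s-p (cover-copy (face-refl ιs) C₁))
              (cover-join {M = [ b ]} {M′ = middle} (λ { (here refl , c∈) → middle≢b c∈ refl })
                (subst (λ c → Cover (InCopies s [ c ]) (s* ∷ v ∷ B)) s*-p (cover-copy face-ss* C₃)) C₂)))
          where
          open ↭-Solver {V} using (solve; _⊕_; _⊜_)
          help : ∀ {w} → Face u P w → w ! p ∈ a ∷ b ∷ middle
          help {w} g with w ! p ≟ a | w ! p ≟ b
          ... | yes eq | _ = here eq
          ... | no _ | yes eq = there (here eq)
          ... | no ne | no ne′ = there (there (∈-middle-face (face-trans face-su g) ne ne′))

        -- `Pd` meets the starts `Zp` of the container between `s*` and `v`, the starts `Zu` are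
        -- reached from `u` in one step, and `Fn` are neighbours of `v` reached without that
        -- container, each adding one path to `length Z`.
        finish : ∀ {A M X Pd Fn Z Zp Zu} → All (Adj u) X → All (Adj u) Zu → All (λ y → Adj y v) Fn → v ∉ Zu →
          Pointwise Adj Pd Zp → Z ↭ Zp ++ Zu → EdgeTheta P′ s* v Z →
          Linkage X (Pd ++ Fn) ((A ++ M) ++ s ∷ s* ∷ []) →
          Cover (Face s P′) (s ∷ u ∷ A) → Cover (InCopies s middle) M →
          ∃ λ X′ → length X′ ≡ length Z + length Fn × All (Adj u) X′ × Theta P u v X′
        finish {A} {M} {X} {Pd} {Fn} {Z} {Zp} {Zu} X~ Zu~ Fn~ v∉ pw Z↭ E L C₁ C₂ =
          X ++ Zu , len , All.++⁺ X~ Zu~ , go E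
          where
          len : length (X ++ Zu) ≡ length Z + length Fn
          len = ≡-trans (length-++ X) (≡-trans (cong (_+ length Zu)
            (≡-trans (linkage-length L) (≡-trans (length-++ Pd) (cong (_+ length Fn) (pointwise-length pw)))))
            (≡-trans (ℕ.+-assoc (length Zp) (length Fn) (length Zu))
            (≡-trans (cong (length Zp +_) (ℕ.+-comm (length Fn) (length Zu)))
            (≡-trans (sym (ℕ.+-assoc (length Zp) (length Zu) (length Fn)))
              (cong (_+ length Fn) (sym (≡-trans (↭-length Z↭) (length-++ Zp))))))))
          go : EdgeTheta P′ s* v Z → Theta P u v (X ++ Zu)
          go (inj₁ (theta L′ ends~ C₃)) =
            theta (glue pw L (relink Z↭ ↭-refl ↭-refl L′)) (All.++⁺ Fn~ ends~) (coverAll C₁ C₂ C₃)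
          -- If the container uses the edge from `s*` to `v`, then `v` is among its starts, and the
          -- vertex `w` paired with `v` simply ends its path there.
          go (inj₂ (Z′ , Z↭′ , _ , theta L′ ends~ C₃)) with pointwise-∈ pw v∈
            where
            v∈ : v ∈ Zp
            v∈ = [ id , (λ v∈ → contradiction v∈ v∉) ]′ (∈-++⁻ Zp (∈-resp-↭ (↭-trans (↭-sym Z↭′) Z↭) (here refl)))
          ... | w , Pd′ , Zp′ , q , r , w~v , pw′ =
            theta (glue pw′ (relink ↭-refl (↭-trans (++⁺ʳ Fn q) (↭-sym (shift w Pd′ Fn))) ↭-refl L)
                    (relink (drop-∷ (↭-trans (↭-sym Z↭′) (↭-trans Z↭ (++⁺ʳ Zu r)))) ↭-refl ↭-refl L′))
              (All.++⁺ (w~v ∷ Fn~) ends~) (coverAll C₁ C₂ C₃)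

        u*≢v : u [ p ≔ b ] ≢ v
        u*≢v eq = let j , j≢p , ne = apart in ne (≡-trans (sym (≔-other u b j≢p)) (cong (_! j) eq))

        direct enter : Fin k × Fin n → V
        direct (j , t) = S j t a
        enter (j , t) = S j t b

        -- The vector opposite `swapIn j` in the copy of `u` would carry `a` at both `p` and `j`,
        -- and so is no vertex; `swapOut j` stands in for it.
        swapOut swapIn : Fin k → V
        swapOut j = S j b a
        swapIn j = S j a b

        -- A neighbour of s* is entered straight from the copy of s (D), after exchanging a and b (J), or from u (Zᵤ).
        record Classified (Z : List V) : Set where
          constructor classified
          field
            D : List (Fin k × Fin n)
            J : List (Fin k)
            Zᵤ : List V
            split↭ : Z ↭ (map enter D ++ map swapIn J) ++ Zᵤ
            D✓ : All (λ (j , t) → j ∈ P′ × Absent t s × t ≢ b × S j t a ≢ u) D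
            J✓ : All (_∈ P′) J
            Zᵤ✓ : All (_≡ u [ p ≔ b ]) Zᵤ

        classify : ∀ {Z} → All (λ z → Adj s* z × Face s* P′ z) Z → Classified Z
        classify [] = classified [] [] [] ↭-refl [] [] []
        classify {z ∷ Z} ((z~ , g) ∷ zs) with classify zs | z ! at z~ ≟ a
        ... | classified D J Zᵤ q D✓ J✓ Zᵤ✓ | yes t≡a = classified D (j ∷ J) Zᵤ q′ D✓ (j∈ ∷ J✓) Zᵤ✓
          where
          j = at z~
          j∈ : j ∈ P′
          j∈ = face-adj-∈ g z~
          z≡ : z ≡ swapIn j
          z≡ = ≡-trans (adj⇒≔ z~) (≡-trans (cong (λ t → s* [ j ≔ t ]) t≡a) (S-b a (∈P′⇒≢p j∈)))
          open ↭-Solver {V} using (solve; _⊕_; _⊜_)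
          q′ : z ∷ Z ↭ (map enter D ++ swapIn j ∷ map swapIn J) ++ Zᵤ
          q′ = ↭-trans (prep z q) (↭-trans (↭-reflexive (cong (_∷ _) z≡))
            (solve 4 (λ z d j u → z ⊕ ((d ⊕ j) ⊕ u) ⊜ (d ⊕ (z ⊕ j)) ⊕ u) refl [ swapIn j ] (map enter D) (map swapIn J) Zᵤ))
        ... | classified D J Zᵤ q D✓ J✓ Zᵤ✓ | no t≢a = go (S j t a ≟ᵛ u)
          where
          j = at z~
          t = z ! j
          j∈ : j ∈ P′
          j∈ = face-adj-∈ g z~
          z≡ : z ≡ S j t b
          z≡ = ≡-trans (adj⇒≔ z~) (S-b t (∈P′⇒≢p j∈))
          t∉* : Absent t s*
          t∉* = adj-absent (faceInj g) z~
          t≢b : t ≢ b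
          t≢b eq = absent-app t∉* p (≡-trans s*-p (sym eq))
          t∉ : Absent t s
          t∉ = absent λ i → help i
            where
            help : ∀ i → s ! i ≢ t
            help i eq with i ≟ p
            ... | yes refl = t≢a (≡-trans (sym eq) s-p)
            ... | no i≢p = absent-app t∉* i (≡-trans (≔-other s b i≢p) eq)
          go : Dec (S j t a ≡ u) → Classified (z ∷ Z)
          go (no ne) = classified ((j , t) ∷ D) J Zᵤ (↭-trans (↭-reflexive (cong (_∷ Z) z≡)) (prep _ q))
            ((j∈ , t∉ , t≢b , ne) ∷ D✓) J✓ Zᵤ✓
          go (yes eq) = classified D J (z ∷ Zᵤ) (↭-trans (prep z q) (↭-sym (shift z _ Zᵤ))) D✓ J✓
            (≡-trans z≡ (≡-trans (sym (S-≔ j t a b)) (cong (_[ p ≔ b ]) eq)) ∷ Zᵤ✓)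

        module FromClass {Z : List V} (uZ : List.Unique Z) (K : Classified Z) where
          open Classified K

          private
            u₁ : List.Unique ((map enter D ++ map swapIn J) ++ Zᵤ)
            u₁ = Unique-resp-↭ split↭ uZ
            u₂ = unique-++⁻ˡ (map enter D ++ map swapIn J) u₁

          D-unique : List.Unique D
          D-unique = Unique.map⁻ (unique-++⁻ˡ (map enter D) u₂)

          J-unique : List.Unique J
          J-unique = Unique.map⁻ (unique-++⁻ʳ (map enter D) u₂)

          Zᵤ-unique : List.Unique Zᵤ
          Zᵤ-unique = unique-++⁻ʳ (map enter D ++ map swapIn J) u₁

          Zᵤ~ : All (Adj u) Zᵤ
          Zᵤ~ = All.map (λ eq → subst (Adj u) (sym eq) (≔-adj p a≢b)) Zᵤ✓

          v∉Zᵤ : v ∉ Zᵤ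
          v∉Zᵤ v∈ = u*≢v (sym (All.lookup Zᵤ✓ v∈))

          Zᵤ-short : length Zᵤ ≤ 1
          Zᵤ-short = short Zᵤ✓ Zᵤ-unique
            where
            short : ∀ {x : V} {X} → All (_≡ x) X → List.Unique X → length X ≤ 1
            short [] _ = z≤n
            short (_ ∷ []) _ = s≤s z≤n
            short (refl ∷ refl ∷ _) ((ne ∷ _) ∷ _) = contradiction refl ne

          -- J₀ lists the positions where the exchange starts at a vertex other than u
          leaveHome : ∀ {J₀} → List.Unique J₀ → All (λ j → j ∈ P′ × S j b a ≢ u) J₀ → map direct D ++ map swapOut J₀ ≢ [] →
            ∃ λ X → ∃ λ A → Linkage X (map direct D ++ map swapOut J₀) A × All (Adj u) X × Cover (Face s P′) (s ∷ u ∷ A)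
          leaveHome {J₀} uJ₀ J₀✓ nonnil with adjacent ιs home-su s~u ok unique u∉ nonnil
            where
            ok-D : ∀ {x} → x ∈ map direct D → Adj s x × Face s P′ x
            ok-D x∈ with (j , t) , jt∈ , refl ← ∈-map⁻ direct x∈ with j∈ , t∉ , _ ← All.lookup D✓ jt∈ =
              subst (λ x → Adj s x × Face s P′ x) (S-a t (∈P′⇒≢p j∈)) (≔-adj j (absent-app t∉ j) , face-≔ j j∈ (face-refl ιs) t∉)
            ok-J : ∀ {x} → x ∈ map swapOut J₀ → Adj s x × Face s P′ x
            ok-J x∈ with j , j∈J , refl ← ∈-map⁻ swapOut x∈ with j∈ , _ ← All.lookup J₀✓ j∈J =
              subst (λ x → Adj s x × Face s P′ x) (S-a b (∈P′⇒≢p j∈)) (≔-adj j (absent-app b∉ j) , face-≔ j j∈ (face-refl ιs) b∉)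
            ok : All (λ x → Adj s x × Face s P′ x) (map direct D ++ map swapOut J₀)
            ok = All.++⁺ (All.tabulate ok-D) (All.tabulate ok-J)
            inj-S : ∀ {j j′ t t′} → j ∈ P′ → j′ ∈ P′ → Absent t s → Absent t′ s → S j t a ≡ S j′ t′ a → j ≡ j′ × t ≡ t′
            inj-S {t = t} {t′} j∈ j′∈ t∉ t′∉ eq = ≔-injective t∉ t′∉
              (≡-trans (S-a t (∈P′⇒≢p j∈)) (≡-trans eq (sym (S-a t′ (∈P′⇒≢p j′∈)))))
            unique : List.Unique (map direct D ++ map swapOut J₀)
            unique = Unique.++⁺
              (unique-map (λ x∈ y∈ eq → let j∈ , t∉ , _ = All.lookup D✓ x∈ ; j′∈ , t′∉ , _ = All.lookup D✓ y∈
                                            e , e′ = inj-S j∈ j′∈ t∉ t′∉ eq in cong₂ _,_ e e′) D-unique)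
              (unique-map (λ x∈ y∈ eq → proj₁ (inj-S (proj₁ (All.lookup J₀✓ x∈)) (proj₁ (All.lookup J₀✓ y∈)) b∉ b∉ eq)) uJ₀)
              λ (x∈ , x∈′) → let (j , t) , jt∈ , eq = ∈-map⁻ direct x∈ ; j′ , j′∈ , eq′ = ∈-map⁻ swapOut x∈′
                                 j∈ , t∉ , t≢b , _ = All.lookup D✓ jt∈
                             in t≢b (proj₂ (inj-S j∈ (proj₁ (All.lookup J₀✓ j′∈)) t∉ b∉ (≡-trans (sym eq) eq′)))
            u∉ : u ∉ map direct D ++ map swapOut J₀
            u∉ u∈ with ∈-++⁻ (map direct D) u∈
            ... | inj₁ u∈ with (j , t) , jt∈ , eq ← ∈-map⁻ direct u∈ = proj₂ (proj₂ (proj₂ (All.lookup D✓ jt∈))) (sym eq)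
            ... | inj₂ u∈ with j , j∈ , eq ← ∈-map⁻ swapOut u∈ = proj₂ (All.lookup J₀✓ j∈) (sym eq)
          -- The prescription was made at `s`. Read backwards, the paths start at neighbours of `u`
          -- and end at the prescribed neighbours of `s`.
          ... | theta {ends = X} {bag = A} L ends~ C = X , A , reverse L , All.map Adj-sym ends~ , C

          abstract
            home : ∀ {J₀} → List.Unique J₀ → All (λ j → j ∈ P′ × S j b a ≢ u) J₀ → map direct D ++ map swapOut J₀ ≢ [] →
              ∃ λ X → ∃ λ A → Linkage X (map direct D ++ map swapOut J₀) A × All (Adj u) X × Cover (Face s P′) (s ∷ u ∷ A)
            home = leaveHome

        -- Away from p, sources carry b or avoid a and sinks the other way round, so they never coincide.
        Carries : Fin n → V → Set
        Carries t w = ∃ λ i → i ≢ p × w ! i ≡ t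

        source-b : ∀ {j} c → j ∈ P′ → Carries b (S j b c)
        source-b c j∈ = _ , ∈P′⇒≢p j∈ , S-j b c (∈P′⇒≢p j∈)

        sink-a : ∀ {j} c → j ∈ P′ → Carries a (S j a c)
        sink-a c j∈ = _ , ∈P′⇒≢p j∈ , S-j a c (∈P′⇒≢p j∈)

        source-¬a : ∀ {c} → ¬ Carries a (u [ p ≔ c ])
        source-¬a {c} (i , i≢p , eq) = i≢p (inj-app ι (≡-trans (sym (≔-other u c i≢p)) eq))

        sink-¬b : ∀ {j} c → j ∈ P′ → ¬ Carries b (S j a c)
        sink-¬b {j} c j∈ (i , i≢p , eq) =
          S-elim j a c (λ i x → i ≢ p → x ≢ b) (λ ne → contradiction refl ne) (λ _ _ → a≢b) (λ {i} _ _ _ → absent-app b∉ i) i i≢p eq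

        s-¬b : ∀ {c} → ¬ Carries b (s [ p ≔ c ])
        s-¬b {c} (i , i≢p , eq) = absent-app b∉ i (≡-trans (sym (≔-other s c i≢p)) eq)

        v-¬b : ∀ {c} → ¬ Carries b (v [ p ≔ c ])
        v-¬b {c} (i , i≢p , eq) = i≢p (inj-app (faceInj f) (≡-trans (sym (≔-other v c i≢p)) eq))

        -- `swapOut jᵤ` is `u` itself if `u` has `b` at `jᵤ`, so the exchange at `jᵤ` is avoided.
        -- The start `z₀` set aside will be entered from `s*`.
        choose : ∀ Z → 3 ≤ length Z → List.Unique Z → ∃ λ z₀ → ∃ λ Z₁ → Z ↭ z₀ ∷ Z₁ × swapIn jᵤ ∉ Z₁
        choose (z ∷ Z) _ uZ with swapIn jᵤ ∈ᵛ? (z ∷ Z)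
        ... | no z∉ = z , Z , ↭-refl , z∉ ∘ there
        ... | yes z∈ with Z₁ , q ← ∈-↭ z∈ = _ , Z₁ , q , unique-∉ (Unique-resp-↭ q uZ)

        -- At most (κ − 1) m paths: besides the exchanges only one path uses the middle copies.
        few : ∀ l → 3 ≤ l → l ≤ length P′ * m → ∃ λ X → length X ≡ l × All (Adj u) X × Theta P u v X
        few l 3≤l l≤
          with Z , len , uZ , Z✓ , E ← edgeThetas uniqueP′ nonempty adjacent distant l ιs* away-v s*≢v (ℕ.≤-trans (s≤s z≤n) 3≤l) l≤
          with z₀ , Z₁ , Z↭ , z∉ ← choose Z (subst (3 ≤_) (sym len) 3≤l) uZ = go (classify Z₁✓)
          where
          u₁ : List.Unique (z₀ ∷ Z₁)
          u₁ = Unique-resp-↭ Z↭ uZ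
          Z₁✓ = All.tail (All-resp-↭ Z↭ Z✓)
          z₀~ : Adj s* z₀
          z₀~ = proj₁ (All.head (All-resp-↭ Z↭ Z✓))
          go : Classified Z₁ → _
          go K@(classified D J Zᵤ split↭ D✓ J✓ Zᵤ✓) = subst (λ l → ∃ λ X → length X ≡ l × All (Adj u) X × Theta P u v X)
              (≡-trans (ℕ.+-identityʳ _) len)
              (finish (All.++⁺ X~ (≔-adj p (absent-app symbol∉ p) ∷ [])) Zᵤ~ [] v∉Zᵤ pw Z↭′ E L₃ C₁ C₂)
            where
            open FromClass (AllPairs.tail u₁) K
            J≢ : ∀ {j} → j ∈ J → j ≢ jᵤ
            J≢ j∈ refl = z∉ (∈-resp-↭ (↭-sym split↭) (∈-++⁺ˡ (∈-++⁺ʳ (map enter D) (∈-map⁺ swapIn j∈))))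
            J₀✓ : All (λ j → j ∈ P′ × S j b a ≢ u) J
            J₀✓ = All.tabulate λ {j} j∈ → All.lookup J✓ j∈ , λ eq →
              absent-app b∉ j (≡-trans (≔-other u d (J≢ j∈)) (≡-trans (cong (_! j) (sym eq)) (S-j b a (∈P′⇒≢p (All.lookup J✓ j∈)))))
            -- Of at least three starts, one is entered from `s*` and at most one from `u`, so a
            -- path through the home copy remains.
            nonnil : map direct D ++ map swapOut J ≢ []
            nonnil e = ℕ.<⇒≱ (ℕ.≤-trans 3≤l (ℕ.≤-reflexive (≡-trans (sym len) (≡-trans (↭-length Z↭) (cong suc (↭-length split↭))))))
              (s≤s (ℕ.≤-trans (ℕ.≤-reflexive (≡-trans (length-++ (map enter D ++ map swapIn J)) (cong (_+ length Zᵤ) zero≡))) Zᵤ-short))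
              where
              zero≡ : length (map enter D ++ map swapIn J) ≡ 0
              zero≡ = ≡-trans (length-++ (map enter D)) (≡-trans (cong₂ _+_ (≡-trans (length-map enter D) (sym (length-map direct D)))
                (≡-trans (length-map swapIn J) (sym (length-map swapOut J)))) (≡-trans (sym (length-++ (map direct D))) (cong length e)))
            H = home J-unique J₀✓ nonnil
            X = proj₁ H
            Bₐ = proj₁ (proj₂ H)
            L₁ = proj₁ (proj₂ (proj₂ H))
            X~ = proj₁ (proj₂ (proj₂ (proj₂ H)))
            C₁ = proj₂ (proj₂ (proj₂ (proj₂ H)))
            r∃ : ∃ (_∈ R)
            r∃ with R | R-length
            ... | [] | e = contradiction (subst (2 ≤_) (sym e) 2≤m) λ { (s≤s ()) }
            ... | r ∷ _ | _ = r , here refl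
            r = proj₁ r∃
            r∈ = proj₂ r∃
            src snk : Fin k → V
            -- Source and sink both lie in the copy `s ! j`; moving `s ! j` to `p` vacates position
            -- `j` for `b` or `a`.
            src j = S j b (s ! j)
            snk j = S j a (s ! j)
            -- Besides the exchanges there is one start in the copy `d`, next to `u`, and one end in
            -- the copy `r`, next to `s`. From that end the path goes on through `s` and `s*` to
            -- `z₀`, so that these two vertices are covered.
            SS = map src J ++ [ u [ p ≔ d ] ]
            TT = map snk J ++ [ s [ p ≔ r ] ]
            src-face : ∀ {j} → j ∈ J → Face s P (src j)
            src-face j∈ = S-face (All.lookup J✓ j∈) b∉ (≔-absent-old _ ιs b∉)
            a∉ : ∀ {j} → j ∈ P′ → Face s P (snk j)
            a∉ {j} j∈ = subst (Face s P) eq (≔p-face (face-≔ j (there j∈) face-ss* missing-a)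
                (subst (λ t → Absent t (s* [ j ≔ a ])) (≔-other s b (∈P′⇒≢p j∈)) (≔-absent-old j ιs* missing-a)))
              where
              eq : s* [ j ≔ a ] [ p ≔ s ! j ] ≡ snk j
              eq = ≡-trans (cong (_[ p ≔ s ! j ]) (S-b a (∈P′⇒≢p j∈))) (S-≔ j a b (s ! j))
            copies-src : ∀ J → copiesOf (map src J) ≡ map (s !_) J
            copies-src [] = refl
            copies-src (j ∷ J) = cong₂ _∷_ (S-p j b (s ! j)) (copies-src J)
            copies-snk : ∀ J → copiesOf (map snk J) ≡ map (s !_) J
            copies-snk [] = refl
            copies-snk (j ∷ J) = cong₂ _∷_ (S-p j a (s ! j)) (copies-snk J)
            SS≡ : copiesOf SS ≡ map (s !_) J ++ [ d ]
            SS≡ = ≡-trans (map-++ (_! p) (map src J) _) (cong₂ _++_ (copies-src J) (cong [_] (≔-same u p d)))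
            TT≡ : copiesOf TT ≡ map (s !_) J ++ [ r ]
            TT≡ = ≡-trans (map-++ (_! p) (map snk J) _) (cong₂ _++_ (copies-snk J) (cong [_] (≔-same s p r)))
            sJ-unique : List.Unique (map (s !_) J)
            sJ-unique = Unique.map⁺ (inj-app ιs) J-unique
            d∉J : d ∉ map (s !_) J
            d∉J d∈ = let j , j∈ , eq = ∈-map⁻ (s !_) d∈ in J≢ j∈ (inj-app ιs (≡-trans (sym eq) (sym s-j)))
            r∉J : r ∉ map (s !_) J
            r∉J r∈J = let j , j∈ , eq = ∈-map⁻ (s !_) r∈J in absent-app (R∉ r∈) j (sym eq)
            d∈M : d ∈ middle
            d∈M = ∈-++⁺ˡ (subst (_∈ map (s !_) P′) s-j (∈-map⁺ (s !_) jᵤ∈))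
            sJ⊆ : ∀ {c} → c ∈ map (s !_) J → c ∈ middle
            sJ⊆ c∈ = let j , j∈ , eq = ∈-map⁻ (s !_) c∈ in ∈-++⁺ˡ (subst (_∈ map (s !_) P′) (sym eq) (∈-map⁺ (s !_) (All.lookup J✓ j∈)))
            T : Terminals s SS TT
            T = terminals
              (All.++⁺ (All.tabulate λ x∈ → let j , j∈ , eq = ∈-map⁻ src x∈ in subst (Face s P) (sym eq) (src-face j∈))
                       (≔p-face face-su symbol∉ ∷ []))
              (All.++⁺ (All.tabulate λ x∈ → let j , j∈ , eq = ∈-map⁻ snk x∈ in subst (Face s P) (sym eq) (a∉ (All.lookup J✓ j∈)))
                       (≔p-face (face-refl ιs) (R∉ r∈) ∷ []))
              (subst List.Unique (sym SS≡) (Unique.++⁺ sJ-unique ([] ∷ []) λ { (c∈ , here refl) → d∉J c∈ }))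
              (subst List.Unique (sym TT≡) (Unique.++⁺ sJ-unique ([] ∷ []) λ { (c∈ , here refl) → r∉J c∈ }))
              (≡-trans (length-++ (map src J)) (≡-trans (cong (_+ 1) (≡-trans (length-map src J) (sym (length-map snk J)))) (sym (length-++ (map snk J)))))
              dis
              where
              dis : Disjoint SS TT
              dis (x∈ , x∈′) with ∈-++⁻ (map src J) x∈ | ∈-++⁻ (map snk J) x∈′
              ... | inj₁ x∈ | inj₁ x∈′ with j , j∈ , refl ← ∈-map⁻ src x∈ with j′ , j′∈ , eq ← ∈-map⁻ snk x∈′ =
                sink-¬b _ (All.lookup J✓ j′∈) (subst (Carries b) eq (source-b _ (All.lookup J✓ j∈)))
              ... | inj₁ x∈ | inj₂ (here refl) with j , j∈ , eq ← ∈-map⁻ src x∈ =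
                s-¬b (subst (Carries b) (sym eq) (source-b _ (All.lookup J✓ j∈)))
              ... | inj₂ (here refl) | inj₁ x∈′ with j′ , j′∈ , eq ← ∈-map⁻ snk x∈′ =
                source-¬a (subst (Carries a) (sym eq) (sink-a _ (All.lookup J✓ j′∈)))
              ... | inj₂ (here refl) | inj₂ (here eq) =
                apart⇒≢ (apart-≔ d r (jᵤ , jᵤ≢p , λ e → absent-app symbol∉ jᵤ (≡-trans e s-j))) eq
            Rt : Routed s middle SS TT
            Rt = route ιs (AllPairs.tail middle-unique) middle-free T
              (λ {c} c∈ → [ sJ⊆ , (λ { (here refl) → d∈M }) ]′ (∈-++⁻ (map (s !_) J) (subst (c ∈_) SS≡ c∈)))
              (λ {c} c∈ → [ sJ⊆ , (λ { (here refl) → ∈-++⁺ʳ (map (s !_) P′) r∈ }) ]′ (∈-++⁻ (map (s !_) J) (subst (c ∈_) TT≡ c∈)))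
              -- All copies with a start are indexed by symbols of `s`, whereas `r` is missing from
              -- `s`.
              (inj₁ (r , subst (r ∈_) (sym TT≡) (∈-++⁺ʳ (map (s !_) J) (here refl)) ,
                λ r∈S → [ r∉J , (λ { (here eq) → absent-app (R∉ r∈) jᵤ (≡-trans s-j (sym eq)) }) ]′ (∈-++⁻ (map (s !_) J) (subst (r ∈_) SS≡ r∈S))))
            M = proj₁ Rt
            C₂ = proj₂ (proj₂ Rt)
            s-sj : ∀ {j} → j ∈ J → a ≢ s ! j
            s-sj j∈ = s≢a (∈P′⇒≢p (All.lookup J✓ j∈)) ∘ sym
            L₂ : Linkage (X ++ [ u [ p ≔ d ] ]) (map direct D ++ map snk J ++ [ s [ p ≔ r ] ]) (Bₐ ++ M)
            L₂ = glue (pointwise-map J λ {j} j∈ → S-adj j b (s-sj j∈))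
              (relink ↭-refl (++-comm (map direct D) (map swapOut J)) ↭-refl L₁) (proj₁ (proj₂ Rt))
            L₃ : Linkage (X ++ [ u [ p ≔ d ] ]) ((s* ∷ map direct D ++ map snk J) ++ []) ((Bₐ ++ M) ++ s ∷ s* ∷ [])
            L₃ = relink (↭-reflexive (++-identityʳ _))
              (↭-trans (++-comm (map direct D ++ map snk J) [ s* ]) (↭-reflexive (sym (++-identityʳ _)))) ↭-refl
              (glue {P = [ s [ p ≔ r ] ]} {W = []} (Adj-sym (≔-adj p (absent-app (R∉ r∈) p)) ∷ [])
                (relink ↭-refl (solve 3 (λ x y z → x ⊕ (y ⊕ z) ⊜ z ⊕ (x ⊕ y)) refl (map direct D) (map snk J) [ s [ p ≔ r ] ]) ↭-refl L₂)
                (single (step (≔-adj p (absent-app b∉ p)) stop)))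
              where open ↭-Solver {V} using (solve; _⊕_; _⊜_)
            pw : Pointwise Adj (s* ∷ map direct D ++ map snk J) (z₀ ∷ map enter D ++ map swapIn J)
            pw = z₀~ ∷ pointwise-++ (pointwise-map D λ {jt} _ → S-adj (proj₁ jt) (proj₂ jt) a≢b)
              (pointwise-map J λ {j} _ → S-adj j a (absent-app b∉ j))
            Z↭′ : Z ↭ (z₀ ∷ map enter D ++ map swapIn J) ++ Zᵤ
            Z↭′ = ↭-trans Z↭ (prep z₀ split↭)

        -- Exchanging a and b in the middle copies

        -- The exchange of a and b at position j can take place in the copy s ! j or in any copy of R.
        distribute : ∀ {B} r → List.Unique B → B ⊆ middle → length B ≡ r + length R →
          ∃ λ J₁ → ∃ λ As → length J₁ ≡ r × P′ ↭ J₁ ++ map proj₁ As × middle ↭ B ++ map proj₂ As ×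
            All (λ (j , c) → c ≡ s ! j ⊎ c ∈ R) As
        distribute {B} r uB B⊆ lenB = J₁ , As , len₁ , P′↭ , middle↭ , As✓
          where
          taken? = λ j → (s ! j) ∈ˢ? B
          free? = λ j → ¬? (taken? j)
          inB? = λ c → c ∈ˢ? B
          outB? = λ c → ¬? (inB? c)
          J₂ = filter taken? P′
          J₃ = filter free? P′
          R₂ = filter inB? R
          R₃ = filter outB? R
          uR : List.Unique R
          uR = AllPairs.tail R-unique
          B↭ : B ↭ map (s !_) J₂ ++ R₂
          B↭ = ⊆-⊇⇒↭ uB
            (Unique.++⁺ (Unique.map⁺ (inj-app ιs) (Unique.filter⁺ taken? uniqueP′)) (Unique.filter⁺ inB? uR)
              λ (c∈ , c∈′) → let j , _ , eq = ∈-map⁻ (s !_) c∈ in absent-app (R∉ (proj₁ (∈-filter⁻ inB? {xs = R} c∈′))) j (sym eq))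
            sub sup
            where
            sub : B ⊆ map (s !_) J₂ ++ R₂
            sub {c} c∈ with ∈-++⁻ (map (s !_) P′) (B⊆ c∈)
            ... | inj₂ c∈R = ∈-++⁺ʳ (map (s !_) J₂) (∈-filter⁺ inB? c∈R c∈)
            ... | inj₁ c∈s with j , j∈ , refl ← ∈-map⁻ (s !_) c∈s = ∈-++⁺ˡ (∈-map⁺ (s !_) (∈-filter⁺ taken? j∈ c∈))
            sup : map (s !_) J₂ ++ R₂ ⊆ B
            sup c∈ with ∈-++⁻ (map (s !_) J₂) c∈
            ... | inj₂ c∈R = proj₂ (∈-filter⁻ inB? {xs = R} c∈R)
            ... | inj₁ c∈s with j , j∈ , refl ← ∈-map⁻ (s !_) c∈s = proj₂ (∈-filter⁻ taken? {xs = P′} j∈)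
          -- Counting `B` in two ways: the positions whose own copy is taken exceed the spare copies
          -- `R₃` by `r`. The first `r` of them form `J₁`, and the others receive the copies `R₃`.
          lenJ₂ : length J₂ ≡ r + length R₃
          lenJ₂ = ℕ.+-cancelʳ-≡ (length R₂) _ _ (begin
            length J₂ + length R₂ ≡⟨ cong (_+ length R₂) (sym (length-map (s !_) J₂)) ⟩
            length (map (s !_) J₂) + length R₂ ≡⟨ sym (length-++ (map (s !_) J₂)) ⟩
            length (map (s !_) J₂ ++ R₂) ≡⟨ sym (↭-length B↭) ⟩
            length B ≡⟨ lenB ⟩
            r + length R ≡⟨ cong (r +_) (≡-trans (↭-length (filter-split inB? R)) (length-++ R₂)) ⟩
            r + (length R₂ + length R₃) ≡⟨ cong (r +_) (ℕ.+-comm (length R₂) (length R₃)) ⟩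
            r + (length R₃ + length R₂) ≡⟨ sym (ℕ.+-assoc r (length R₃) (length R₂)) ⟩
            r + length R₃ + length R₂ ∎)
            where open ≡-Reasoning
          J₁ = take r J₂
          J₄ = drop r J₂
          len₁ : length J₁ ≡ r
          len₁ = length-take-≤ r J₂ (ℕ.≤-trans (ℕ.m≤m+n r _) (ℕ.≤-reflexive (sym lenJ₂)))
          len₄ : length J₄ ≡ length R₃
          len₄ = ≡-trans (length-drop r J₂) (≡-trans (cong (_∸ r) lenJ₂) (ℕ.m+n∸m≡n r _))
          keep : Fin k → Fin k × Fin n
          keep j = j , s ! j
          As = map keep J₃ ++ zip J₄ R₃
          As₁ : map proj₁ As ≡ J₃ ++ J₄
          As₁ = ≡-trans (map-++ proj₁ (map keep J₃) _) (cong₂ _++_ (fst J₃) (zip-map₁ J₄ R₃ len₄))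
            where
            fst : ∀ J → map proj₁ (map keep J) ≡ J
            fst [] = refl
            fst (j ∷ J) = cong (j ∷_) (fst J)
          As₂ : map proj₂ As ≡ map (s !_) J₃ ++ R₃
          As₂ = ≡-trans (map-++ proj₂ (map keep J₃) _) (cong₂ _++_ (sym (map-∘ J₃)) (zip-map₂ J₄ R₃ len₄))
          P′↭ : P′ ↭ J₁ ++ map proj₁ As
          P′↭ = ↭-trans (filter-split taken? P′) (↭-trans (↭-reflexive (cong (_++ J₃) (sym (take++drop≡id r J₂))))
            (↭-trans (solve 3 (λ x y z → (x ⊕ y) ⊕ z ⊜ x ⊕ (z ⊕ y)) refl J₁ J₄ J₃) (↭-reflexive (cong (J₁ ++_) (sym As₁)))))
            where open ↭-Solver {Fin k} using (solve; _⊕_; _⊜_)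
          middle↭ : middle ↭ B ++ map proj₂ As
          middle↭ = ↭-trans (++⁺ (↭-trans (↭-map (s !_) (filter-split taken? P′)) (↭-reflexive (map-++ (s !_) J₂ J₃))) (filter-split inB? R))
            (↭-trans (solve 4 (λ x y z w → (x ⊕ y) ⊕ (z ⊕ w) ⊜ (x ⊕ z) ⊕ (y ⊕ w)) refl (map (s !_) J₂) (map (s !_) J₃) R₂ R₃)
              (++⁺ (↭-sym B↭) (↭-reflexive (sym As₂))))
            where open ↭-Solver {Fin n} using (solve; _⊕_; _⊜_)
          As✓ : All (λ (j , c) → c ≡ s ! j ⊎ c ∈ R) As
          As✓ = All.++⁺ (All.tabulate λ x∈ → let j , _ , eq = ∈-map⁻ keep x∈ in inj₁ (≡-trans (cong proj₂ eq) (cong (s !_) (sym (cong proj₁ eq)))))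
            (All.tabulate λ {(j , c)} x∈ → inj₂ (proj₁ (∈-filter⁻ outB? {xs = R} (subst (c ∈_) (zip-map₂ J₄ R₃ len₄) (∈-map⁺ proj₂ x∈)))))

        abstract
          assign : ∀ {B} r → List.Unique B → B ⊆ middle → length B ≡ r + length R →
            ∃ λ J₁ → ∃ λ As → length J₁ ≡ r × P′ ↭ J₁ ++ map proj₁ As × middle ↭ B ++ map proj₂ As ×
              All (λ (j , c) → c ≡ s ! j ⊎ c ∈ R) As
          assign = distribute

        a∉snk : ∀ {j c} → j ∈ P′ → c ≡ s ! j ⊎ c ∈ R → Face s P (S j a c)
        a∉snk {j} {c} j∈ c✓ = subst (Face s P) eq (≔p-face (face-≔ j (there j∈) face-ss* missing-a) (c∉ c✓))
          where
          eq : s* [ j ≔ a ] [ p ≔ c ] ≡ S j a c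
          eq = ≡-trans (cong (_[ p ≔ c ]) (S-b a (∈P′⇒≢p j∈))) (S-≔ j a b c)
          c∉ : c ≡ s ! j ⊎ c ∈ R → Absent c (s* [ j ≔ a ])
          c∉ (inj₁ refl) = subst (λ t → Absent t (s* [ j ≔ a ])) (≔-other s b (∈P′⇒≢p j∈)) (≔-absent-old j ιs* missing-a)
          c∉ (inj₂ c∈R) = ≔-absent j (≔-absent p (R∉ c∈R) (R≢b c∈R ∘ sym)) λ eq → middle≢a (∈-++⁺ʳ (map (s !_) P′) c∈R) (sym eq)

        -- The copy `u ! j` is `s ! j` except at `jᵤ`. Placing the sources here leaves every symbol
        -- missing from `u`, `d` included, to the paths that leave `u` directly.
        sourceAt : Fin k → V
        sourceAt j = S j b (u ! j)

        sinkAt : Fin k × Fin n → V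
        sinkAt (j , c) = S j a c

        sourceAt-face : ∀ {j} → j ∈ P′ → u ! j ≢ b → Face s P (sourceAt j)
        sourceAt-face {j} j∈ ne = S-face j∈ b∉ c∉
          where
          c∉ : Absent (u ! j) (s [ j ≔ b ])
          c∉ with j ≟ jᵤ
          ... | yes refl = ≔-absent jᵤ (≔-absent-old jᵤ ι symbol∉) (ne ∘ sym)
          ... | no j≢ = subst (λ t → Absent t (s [ j ≔ b ])) (≔-other u d j≢) (≔-absent-old j ιs b∉)

        -- The starts in the copies `Ms` are the exchanges begun at `Js` and the neighbours of `u`
        -- in the copies `U`; the ends are the exchanges completed as `As` says and the neighbours
        -- of `v` in the copies `W`. As the pairing is free, only the totals must agree, and `Js`
        -- may differ from the positions in `As`.
        record Exchange : Set where
          constructor exchange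
          field
            Ms : List (Fin n)
            Js : List (Fin k)
            U : List (Fin n)
            As : List (Fin k × Fin n)
            W : List (Fin n)
            Ms-unique : List.Unique Ms
            Ms⊆ : Ms ⊆ middle
            Js-unique : List.Unique Js
            Js✓ : All (λ j → j ∈ P′ × u ! j ≢ b) Js
            U-unique : List.Unique U
            U✓ : All (λ c → Absent c u) U
            As✓ : All (λ (j , c) → j ∈ P′ × (c ≡ s ! j ⊎ c ∈ R)) As
            W✓ : All (λ c → Absent c v) W
            T-unique : List.Unique (map proj₂ As ++ W)
            S⊆ : map (u !_) Js ++ U ⊆ Ms
            T⊆ : map proj₂ As ++ W ⊆ Ms
            lengths : length Js + length U ≡ length As + length W
            open-route : (∃ λ c → c ∈ map proj₂ As ++ W × c ∉ map (u !_) Js ++ U) ⊎ Ms ⊆ map (u !_) Js ++ U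

        module Exchanges (Ξ : Exchange) where
          open Exchange Ξ

          SS TT : List V
          SS = map sourceAt Js ++ shifts u U
          TT = map sinkAt As ++ shifts v W

          private
            copies-src : ∀ J → copiesOf (map sourceAt J) ≡ map (u !_) J
            copies-src [] = refl
            copies-src (j ∷ J) = cong₂ _∷_ (S-p j b (u ! j)) (copies-src J)

            copies-snk : ∀ X → copiesOf (map sinkAt X) ≡ map proj₂ X
            copies-snk [] = refl
            copies-snk ((j , c) ∷ X) = cong₂ _∷_ (S-p j a c) (copies-snk X)

            SS≡ : copiesOf SS ≡ map (u !_) Js ++ U
            SS≡ = ≡-trans (map-++ (_! p) (map sourceAt Js) _) (cong₂ _++_ (copies-src Js) (copiesOf-shifts u U))

            TT≡ : copiesOf TT ≡ map proj₂ As ++ W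
            TT≡ = ≡-trans (map-++ (_! p) (map sinkAt As) _) (cong₂ _++_ (copies-snk As) (copiesOf-shifts v W))

            S-unique : List.Unique (map (u !_) Js ++ U)
            S-unique = Unique.++⁺ (Unique.map⁺ (inj-app ι) Js-unique) U-unique
              λ (c∈ , c∈′) → let j , _ , eq = ∈-map⁻ (u !_) c∈ in absent-app (All.lookup U✓ c∈′) j (sym eq)

            dis : Disjoint SS TT
            dis (x∈ , x∈′) with ∈-++⁻ (map sourceAt Js) x∈ | ∈-++⁻ (map sinkAt As) x∈′
            ... | inj₁ x∈ | inj₁ x∈′ with j , j∈ , refl ← ∈-map⁻ sourceAt x∈ with (j′ , _) , j′∈ , eq ← ∈-map⁻ sinkAt x∈′ =
              sink-¬b _ (proj₁ (All.lookup As✓ j′∈)) (subst (Carries b) eq (source-b _ (proj₁ (All.lookup Js✓ j∈))))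
            ... | inj₁ x∈ | inj₂ x∈′ with j , j∈ , refl ← ∈-map⁻ sourceAt x∈ with c , _ , eq ← ∈-map⁻ (λ c → v [ p ≔ c ]) x∈′ =
              v-¬b (subst (Carries b) eq (source-b _ (proj₁ (All.lookup Js✓ j∈))))
            ... | inj₂ x∈ | inj₁ x∈′ with c , _ , refl ← ∈-map⁻ (λ c → u [ p ≔ c ]) x∈ with (j′ , _) , j′∈ , eq ← ∈-map⁻ sinkAt x∈′ =
              source-¬a (subst (Carries a) (sym eq) (sink-a _ (proj₁ (All.lookup As✓ j′∈))))
            ... | inj₂ x∈ | inj₂ x∈′ = shifts-disjoint apart (x∈ , x∈′)

          abstract
            exchanged : Routed s Ms SS TT
            exchanged = route ιs Ms-unique (All.tabulate λ c∈ → All.lookup middle-free (Ms⊆ c∈))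
              (terminals
                (All.++⁺ (All.tabulate λ x∈ → let j , j∈ , eq = ∈-map⁻ sourceAt x∈ ; j∈P , ne = All.lookup Js✓ j∈ in
                            subst (Face s P) (sym eq) (sourceAt-face j∈P ne))
                         (shifts-face face-su U✓))
                (All.++⁺ (All.tabulate λ x∈ → let jc , jc∈ , eq = ∈-map⁻ sinkAt x∈ ; j∈P , c✓ = All.lookup As✓ jc∈ in
                            subst (Face s P) (sym eq) (a∉snk j∈P c✓))
                         (shifts-face face-sv W✓))
                (subst List.Unique (sym SS≡) S-unique) (subst List.Unique (sym TT≡) T-unique)
                (≡-trans (length-++ (map sourceAt Js)) (≡-trans (cong₂ _+_ (length-map sourceAt Js) (length-map _ U))
                  (≡-trans lengths (sym (≡-trans (length-++ (map sinkAt As)) (cong₂ _+_ (length-map sinkAt As) (length-map _ W)))))))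
                dis)
              (λ {c} c∈ → S⊆ (subst (c ∈_) SS≡ c∈)) (λ {c} c∈ → T⊆ (subst (c ∈_) TT≡ c∈))
              ([ (λ (c , c∈ , c∉) → inj₁ (c , subst (c ∈_) (sym TT≡) c∈ , c∉ ∘ subst (c ∈_) SS≡))
               , (λ Ms⊆ → inj₂ λ {c} c∈ → subst (c ∈_) (sym SS≡) (Ms⊆ c∈)) ]′ open-route)

          -- One path begins with `s` and `s*`, which covers both and turns `s*` into a further end
          -- next to the copy's remaining starts. `F` collects ends of home paths that go straight
          -- to `v`.
          assemble : ∀ {X D F A} → Linkage X ((map direct D ++ map swapOut Js) ++ F) A →
            Linkage (X ++ shifts u U ++ [ s ]) ((s* ∷ map direct D ++ map sinkAt As) ++ F ++ shifts v W) ((A ++ proj₁ exchanged) ++ s ∷ s* ∷ [])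
          assemble {X} {D} {F} {A} L = relink (↭-reflexive (++-assoc X _ _))
            (solve 5 (λ d f z w t → ((d ⊕ f) ⊕ (z ⊕ w)) ⊕ t ⊜ (t ⊕ (d ⊕ z)) ⊕ (f ⊕ w)) refl (map direct D) F (map sinkAt As) (shifts v W) [ s* ])
            ↭-refl
            (beside
              (glue (pointwise-map Js λ {j} j∈ → S-adj j b λ eq → ∈P′⇒≢p (proj₁ (All.lookup Js✓ j∈)) (sym (inj-app ι eq)))
                (relink ↭-refl (solve 3 (λ d j f → (d ⊕ j) ⊕ f ⊜ j ⊕ (d ⊕ f)) refl (map direct D) (map swapOut Js) F) ↭-refl L)
                (proj₁ (proj₂ exchanged)))
              (single (step (≔-adj p (absent-app b∉ p)) stop)))
            where
            open ↭-Solver {V} using (solve; _⊕_; _⊜_)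

          starts~ : ∀ {X} → All (Adj u) X → All (Adj u) (X ++ shifts u U ++ [ s ])
          starts~ X~ = All.++⁺ X~ (All.++⁺ (shifts-adj U✓) (Adj-sym s~u ∷ []))

        -- With as many paths as the degree, the starts are all the neighbours of `s*`, among them
        -- every `swapIn j`; hence every position of `P′` is involved in an exchange.
        record Full : Set where
          constructor full
          field
            {Z}    : List V
            theta* : EdgeTheta P′ s* v Z
            uZ     : List.Unique Z
            lenZ   : length Z ≡ length P′ * m
            class  : Classified Z
            J↭     : P′ ↭ Classified.J class

        abstract
          fullContainer : Full
          fullContainer
            with Z , len , uZ , Z✓ , E ← edgeThetas uniqueP′ nonempty adjacent distant (length P′ * m) ιs* away-v s*≢v
                   (ℕ.≤-trans (s≤s z≤n) (degree≥2 uniqueP′ nonempty adjacent distant)) ℕ.≤-refl =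
            go (⊆-length⇒↭ uZ (λ z∈ → let z~ , g = All.lookup Z✓ z∈ in face-adj⇒nbr g z~)
                 (ℕ.≤-reflexive (≡-trans (nbrs-length {P′} {s*} ιs*) (sym len)))) (classify Z✓)
            where
            go : nbrs P′ s* ↭ Z → Classified Z → Full
            go q K = full E uZ len K (⊆-⊇⇒↭ uniqueP′ J-unique sub (λ j∈ → All.lookup J✓ j∈))
              where
              open Classified K
              open FromClass uZ K
              sub : P′ ⊆ J
              sub {j} j∈ with ∈-++⁻ (map enter D ++ map swapIn J) (∈-resp-↭ (↭-trans q split↭) (∈-nbrs⁺ j∈ missing-a))
              ... | inj₂ z∈ = contradiction
                (≡-trans (sym (≔-other u b (∈P′⇒≢p j∈))) (≡-trans (cong (_! j) (sym (All.lookup Zᵤ✓ z∈))) (≔-same s* j a)))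
                λ eq → ∈P′⇒≢p j∈ (inj-app ι eq)
              ... | inj₁ z∈ with ∈-++⁻ (map enter D) z∈
              ...   | inj₁ z∈D with (j′ , t) , jt∈ , eq ← ∈-map⁻ enter z∈D with j′∈ , t∉ , _ ← All.lookup D✓ jt∈ =
                contradiction (sink-a b j∈) λ (i , i≢p , eq′) →
                  S-elim j′ t b (λ i x → i ≢ p → x ≢ a) (λ ne → contradiction refl ne) (λ _ _ t≡a → absent-app t∉ p (≡-trans s-p (sym t≡a)))
                    (λ i≢p _ _ → s≢a i≢p) i i≢p (≡-trans (cong (_! i) (≡-trans (sym eq) (S-b a (∈P′⇒≢p j∈)))) eq′)
              ...   | inj₂ z∈J with j′ , j′∈ , eq ← ∈-map⁻ swapIn z∈J =
                subst (_∈ J) (sym (proj₁ (≔-injective missing-a missing-a (≡-trans eq (sym (S-b a (∈P′⇒≢p (All.lookup J✓ j′∈)))))))) j′∈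

        open Full fullContainer public
        open Classified class public
        open FromClass uZ class public

        -- The prescribed version demands a nonempty list. Were it empty, `u` would carry `b` at
        -- each position of `P′`, impossible for two positions; and `D` would be empty, leaving at
        -- most `length P′ + 1` starts, fewer than `length P′ * m` if `m ≥ 3`.
        some-home : ∀ {Js} → (∀ {j} → j ∈ P′ → u ! j ≢ b → j ∈ Js) → map direct D ++ map swapOut Js ≢ []
        some-home {Js} all e = go rich
          where
          D≡[] : length D ≡ 0
          D≡[] = ≡-trans (sym (length-map direct D)) (ℕ.m+n≡0⇒m≡0 _ (≡-trans (sym (length-++ (map direct D))) (cong length e)))
          Js≡[] : length (map swapOut Js) ≡ 0
          Js≡[] = ℕ.m+n≡0⇒n≡0 (length (map direct D)) (≡-trans (sym (length-++ (map direct D))) (cong length e))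
          none : ∀ {j} → j ∈ P′ → u ! j ≡ b
          none {j} j∈ with u ! j ≟ b
          ... | yes eq = eq
          ... | no ne = contradiction (subst (1 ≤_) Js≡[] (∈⇒1≤ (∈-map⁺ swapOut (all j∈ ne)))) λ ()
            where
            ∈⇒1≤ : ∀ {x : V} {X} → x ∈ X → 1 ≤ length X
            ∈⇒1≤ (here _) = s≤s z≤n
            ∈⇒1≤ (there _) = s≤s z≤n
          go : Rich → ⊥
          go (inj₂ (q , q′ , q∈ , q′∈ , q≢)) = q≢ (inj-app ι (≡-trans (none q∈) (sym (none q′∈))))
          go (inj₁ (3≤m , _)) = ℕ.<⇒≱ (ℕ.≤-trans (3κ nonempty) (ℕ.*-monoʳ-≤ (length P′) 3≤m)) (ℕ.≤-trans (ℕ.≤-reflexive count) (ℕ.+-monoʳ-≤ (length P′) Zᵤ-short))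
            where
            3κ : ∀ {κ} → 1 ≤ κ → suc (κ + 1) ≤ κ * 3
            3κ {suc κ} _ = s≤s (s≤s (ℕ.≤-trans (ℕ.≤-reflexive (ℕ.+-comm κ 1)) (s≤s (ℕ.m≤m*n κ 3))))
            count : length P′ * m ≡ length P′ + length Zᵤ
            count = ≡-trans (sym lenZ) (≡-trans (↭-length split↭) (≡-trans (length-++ (map enter D ++ map swapIn J)) (cong (_+ length Zᵤ)
              (≡-trans (length-++ (map enter D)) (cong₂ _+_ (≡-trans (length-map enter D) D≡[]) (≡-trans (length-map swapIn J) (sym (↭-length J↭))))))))

        home✓ : ∀ {Js} → All (λ j → j ∈ P′ × u ! j ≢ b) Js → All (λ j → j ∈ P′ × S j b a ≢ u) Js
        home✓ = All.map λ {j} (j∈ , ne) → j∈ , λ eq → ne (≡-trans (cong (_! j) (sym eq)) (S-j b a (∈P′⇒≢p j∈)))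

        sinks-pointwise : ∀ As → All (λ (j , c) → c ≢ b) As →
          Pointwise Adj (map direct D ++ map sinkAt As) (map enter D ++ map swapIn (map proj₁ As))
        sinks-pointwise As c≢b = pointwise-++ (pointwise-map D λ {jt} _ → S-adj (proj₁ jt) (proj₂ jt) a≢b)
          (subst (Pointwise Adj (map sinkAt As)) (map-∘ As) (pointwise-map As λ {jc} jc∈ → S-adj (proj₁ jc) a (All.lookup c≢b jc∈)))

        split-full : ∀ {J₁ As} → P′ ↭ J₁ ++ map (proj₁ {A = Fin k} {B = λ _ → Fin n}) As →
          Z ↭ (map swapIn J₁ ++ map enter D ++ map swapIn (map proj₁ As)) ++ Zᵤ
        split-full {J₁} {As} q = ↭-trans split↭ (++⁺ʳ Zᵤ (↭-trans
          (++⁺ˡ (map enter D) (↭-trans (↭-map swapIn (↭-trans (↭-sym J↭) q)) (↭-reflexive (map-++ swapIn J₁ (map proj₁ As)))))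
          (solve 3 (λ x y z → x ⊕ (y ⊕ z) ⊜ y ⊕ (x ⊕ z)) refl (map enter D) (map swapIn J₁) (map swapIn (map proj₁ As)))))
          where open ↭-Solver {V} using (solve; _⊕_; _⊜_)

        -- The copies u ! j, where exchanges start, and Uᵇ, which u enters directly, make up the middle.
        record Sources : Set where
          constructor sources
          field
            Js : List (Fin k)
            Uᵇ : List (Fin n)
            Js-unique : List.Unique Js
            Js✓ : All (λ j → j ∈ P′ × u ! j ≢ b) Js
            Js-all : ∀ {j} → j ∈ P′ → u ! j ≢ b → j ∈ Js
            Uᵇ-unique : List.Unique Uᵇ
            Uᵇ✓ : All (λ c → Absent c u × c ≢ b) Uᵇ
            Uᵇ-all : ∀ {c} → Absent c u → c ≢ b → c ∈ Uᵇ
            count : suc (length Js + length Uᵇ) ≡ length P′ + m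
            Uᵇ-long : m ≤ suc (length Uᵇ)

        abstract
          allSources : Sources
          allSources with present? b u
          ... | inj₁ (i , eq) = go (∈-↭ i∈)
            where
            i∈ : i ∈ P′
            i∈ with free φ ← free-at f (here refl) = ≢p⇒∈P′ (φ eq) λ { refl → a≢b eq }
            go : (∃ λ J → P′ ↭ i ∷ J) → Sources
            go (J , q) = sources J (missing u) (AllPairs.tail uJ)
              (All.tabulate λ {j} j∈ → ∈-resp-↭ (↭-sym q) (there j∈) , λ eq′ → unique-∉ uJ (subst (_∈ J) (inj-app ι (≡-trans eq′ (sym eq))) j∈))
              (λ j∈ ne → ∷⁻-∈ (∈-resp-↭ q j∈) λ { refl → ne eq })
              (missing-unique u) (All.tabulate λ c∈ → ∈-missing⁻ c∈ , λ { refl → absent-app (∈-missing⁻ {u} c∈) i eq })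
              (λ c∉ _ → ∈-missing⁺ c∉)
              (cong₂ _+_ (sym (↭-length q)) (missing-length ι))
              (ℕ.≤-trans (ℕ.≤-reflexive (sym (missing-length ι))) (ℕ.n≤1+n _))
              where
              uJ : List.Unique (i ∷ J)
              uJ = Unique-resp-↭ q uniqueP′
          ... | inj₂ b∉u with U , q ← ∈-↭ (∈-missing⁺ b∉u) =
            sources P′ U uniqueP′ (All.tabulate λ {j} j∈ → j∈ , absent-app b∉u j) (λ j∈ _ → j∈)
              (AllPairs.tail uU) (All.tabulate λ c∈ → ∈-missing⁻ (∈-resp-↭ (↭-sym q) (there c∈)) , λ { refl → unique-∉ uU c∈ })
              (λ c∉ ne → ∷⁻-∈ (∈-resp-↭ q (∈-missing⁺ c∉)) ne)
              (≡-trans (sym (ℕ.+-suc (length P′) _)) (cong (length P′ +_) len))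
              (ℕ.≤-reflexive (sym len))
            where
            uU : List.Unique (b ∷ U)
            uU = Unique-resp-↭ q (missing-unique u)
            len : suc (length U) ≡ m
            len = ≡-trans (sym (↭-length q)) (missing-length ι)

        open Sources allSources public

        absent-u∈middle : ∀ {c} → Absent c u → c ≢ b → c ∈ middle
        absent-u∈middle c∉ c≢b = ∈-middle (free-face face-us (free-absent c∉)) (absent-app c∉ p ∘ sym) c≢b

        absent-v∈middle : ∀ {c} → Absent c v → c ≢ a → c ∈ middle
        absent-v∈middle c∉ c≢a = ∈-middle (free-face (face-sym ιs face-sv) (free-absent c∉)) c≢a (absent-app c∉ p ∘ sym)

        old∈middle : ∀ {j} → j ∈ P′ → u ! j ≢ b → u ! j ∈ middle
        old∈middle j∈ ne = ∈-middle (free-at face-su (there j∈)) (λ eq → ∈P′⇒≢p j∈ (inj-app ι eq)) ne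

        middle⊆sources : middle ⊆ map (u !_) Js ++ Uᵇ
        middle⊆sources {c} c∈ with present? c u
        ... | inj₂ c∉ = ∈-++⁺ʳ (map (u !_) Js) (Uᵇ-all c∉ (middle≢b c∈))
        ... | inj₁ (i , refl) with free φ ← free-face face-su (All.lookup middle-free c∈) =
          ∈-++⁺ˡ (∈-map⁺ (u !_) (Js-all (≢p⇒∈P′ (φ refl) λ { refl → middle≢a c∈ refl }) (middle≢b c∈)))

        sources⊆middle : ∀ {U} → U ⊆ Uᵇ → map (u !_) Js ++ U ⊆ middle
        sources⊆middle U⊆ c∈ with ∈-++⁻ (map (u !_) Js) c∈
        ... | inj₂ c∈U = let c∉ , ne = All.lookup Uᵇ✓ (U⊆ c∈U) in absent-u∈middle c∉ ne
        ... | inj₁ c∈J with j , j∈ , refl ← ∈-map⁻ (u !_) c∈J = let j∈P , ne = All.lookup Js✓ j∈ in old∈middle j∈P ne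

        old∉U : ∀ {c U} → Absent c u → c ∉ U → c ∉ map (u !_) Js ++ U
        old∉U c∉u c∉ c∈ = [ (λ c∈J → let j , _ , eq = ∈-map⁻ (u !_) c∈J in absent-app c∉u j (sym eq)) , c∉ ]′ (∈-++⁻ (map (u !_) Js) c∈)

        Result : ℕ → Set
        Result e = ∃ λ X → length X ≡ length P′ * m + e × All (Adj u) X × Theta P u v X

        -- More than (κ − 1) m paths: the surplus ones leave u directly, through the symbols U.
        many : ∀ {U W B} → List.Unique U → U ⊆ Uᵇ → List.Unique B → W ⊆ B → B ⊆ middle → length B ≡ m →
          List.Unique W → All (λ c → Absent c v) W → suc (length Js + length U) ≡ length P′ + length W →
          (∃ λ c → c ∈ Uᵇ × c ∉ U × (c ∈ W ⊎ c ∉ B)) ⊎ Uᵇ ⊆ U → Result (length W)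
        many {U} {W} {B} uU U⊆ uB W⊆ B⊆ lenB uW W✓ lens cond
          -- `B` exceeds `R` by one element, so one position `j₁` gets no copy for its exchange;
          -- `swapIn j₁` is entered from `s*` instead.
          with assign 1 uB B⊆ (≡-trans lenB (sym R-length))
        ... | j₁ ∷ [] , As , _ , P′↭ , middle↭ , As✓ =
          subst (λ l → ∃ λ X → length X ≡ l × All (Adj u) X × Theta P u v X) (cong₂ _+_ lenZ (length-map _ W))
            (finish (Exchanges.starts~ Ξ X~) Zᵤ~ (All.map Adj-sym (shifts-adj W✓)) v∉Zᵤ
              (≔-to ∷ sinks-pointwise As c≢b) (split-full {j₁ ∷ []} {As} P′↭) theta* (Exchanges.assemble Ξ {D = D} {F = []} (relink ↭-refl (↭-reflexive (sym (++-identityʳ _))) ↭-refl L₁)) C₁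
              (proj₂ (proj₂ (Exchanges.exchanged Ξ))))
          where
          H = home Js-unique (home✓ Js✓) (some-home Js-all)
          X~ = proj₁ (proj₂ (proj₂ (proj₂ H)))
          L₁ = proj₁ (proj₂ (proj₂ H))
          C₁ = proj₂ (proj₂ (proj₂ (proj₂ H)))
          uM : List.Unique (B ++ map proj₂ As)
          uM = Unique-resp-↭ middle↭ (AllPairs.tail middle-unique)
          As⊆ : map proj₂ As ⊆ middle
          As⊆ c∈ = ∈-resp-↭ (↭-sym middle↭) (∈-++⁺ʳ B c∈)
          c≢b : All (λ (j , c) → c ≢ b) As
          c≢b = All.tabulate λ jc∈ → middle≢b (As⊆ (∈-map⁺ proj₂ jc∈))
          ≔-to : Adj s* (swapIn j₁)
          ≔-to = subst (Adj s*) (S-b a (∈P′⇒≢p (∈-resp-↭ (↭-sym P′↭) (here refl)))) (≔-adj j₁ (absent-app missing-a j₁))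
          inTT : ∀ {c} → c ∈ Uᵇ → c ∈ W ⊎ c ∉ B → c ∈ map proj₂ As ++ W
          inTT c∈ (inj₁ c∈W) = ∈-++⁺ʳ (map proj₂ As) c∈W
          inTT c∈ (inj₂ c∉B) with c∉ , ne ← All.lookup Uᵇ✓ c∈ =
            ∈-++⁺ˡ ([ (λ c∈B → contradiction c∈B c∉B) , id ]′ (∈-++⁻ B (∈-resp-↭ middle↭ (absent-u∈middle c∉ ne))))
          -- Either the copy `c`, where no path starts, receives an end, or every middle copy has a
          -- start and none is idle.
          routeCond : (∃ λ c → c ∈ Uᵇ × c ∉ U × (c ∈ W ⊎ c ∉ B)) ⊎ Uᵇ ⊆ U →
            (∃ λ c → c ∈ map proj₂ As ++ W × c ∉ map (u !_) Js ++ U) ⊎ middle ⊆ map (u !_) Js ++ U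
          routeCond (inj₁ (c , c∈ , c∉ , w)) = inj₁ (c , inTT c∈ w , old∉U (proj₁ (All.lookup Uᵇ✓ c∈)) c∉)
          routeCond (inj₂ Uᵇ⊆) = inj₂ λ c∈ → [ ∈-++⁺ˡ , (λ c∈U → ∈-++⁺ʳ (map (u !_) Js) (Uᵇ⊆ c∈U)) ]′ (∈-++⁻ (map (u !_) Js) (middle⊆sources c∈))
          As-placed : All (λ (j , c) → j ∈ P′ × (c ≡ s ! j ⊎ c ∈ R)) As
          As-placed = All.tabulate λ {(j , c)} jc∈ → ∈-resp-↭ (↭-sym P′↭) (there (∈-map⁺ proj₁ jc∈)) , All.lookup As✓ jc∈
          Ξ : Exchange
          Ξ = exchange middle Js U As W (AllPairs.tail middle-unique) id Js-unique Js✓ uU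
            (All.tabulate λ c∈ → proj₁ (All.lookup Uᵇ✓ (U⊆ c∈)))
            As-placed
            W✓
            (Unique.++⁺ (unique-++⁻ʳ B uM) uW λ (c∈ , c∈W) → unique-++⁻-disjoint B uM (W⊆ c∈W , c∈))
            (sources⊆middle U⊆) (λ c∈ → [ As⊆ , B⊆ ∘ W⊆ ]′ (∈-++⁻ (map proj₂ As) c∈))
            (ℕ.suc-injective (≡-trans lens (cong (_+ length W) (≡-trans (↭-length P′↭) (cong suc (length-map proj₁ As))))))
            (routeCond cond)

        -- As `a` occurs in `v`, all `m` symbols missing from `v` index middle copies, and `v` can
        -- be entered from each of them.
        manyLinked : ¬ Absent a v → Result m
        manyLinked a∈v = subst Result lenV
          (many Uᵇ-unique id (missing-unique v) id (λ c∈ → absent-v∈middle (∈-missing⁻ c∈) λ { refl → a∈v (∈-missing⁻ c∈) }) lenV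
            (missing-unique v) (All.tabulate ∈-missing⁻) (≡-trans count (cong (length P′ +_) (sym lenV))) (inj₂ id))
          where
          lenV : length (missing v) ≡ m
          lenV = missing-length (faceInj f)

        middle-length : suc (length middle) ≡ length P′ + m
        middle-length = ≡-trans (cong suc (≡-trans (length-++ (map (s !_) P′)) (cong (_+ length R) (length-map (s !_) P′))))
          (≡-trans (sym (ℕ.+-suc (length P′) (length R))) (cong (length P′ +_) R-length))

        -- The middle copies from which `v` can be entered. The symbol `a` is excluded because it
        -- indexes the copy of `u`, which costs at most one of the `m` missing symbols.
        record Targets : Set where
          constructor targets
          field
            Vᵃ : List (Fin n)
            Vᵃ-unique : List.Unique Vᵃ
            Vᵃ✓ : All (λ c → Absent c v × c ≢ a) Vᵃ
            Vᵃ-all : ∀ {c} → Absent c v → c ≢ a → c ∈ Vᵃ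
            Vᵃ-long : m ≤ suc (length Vᵃ)

        abstract
          allTargets : Targets
          allTargets with present? a v
          ... | inj₁ (i , eq) = targets (missing v) (missing-unique v)
            (All.tabulate λ c∈ → ∈-missing⁻ c∈ , λ { refl → absent-app (∈-missing⁻ {v} c∈) i eq }) (λ c∉ _ → ∈-missing⁺ c∉)
            (ℕ.≤-trans (ℕ.≤-reflexive (sym (missing-length (faceInj f)))) (ℕ.n≤1+n _))
          ... | inj₂ a∉v with U , q ← ∈-↭ (∈-missing⁺ a∉v) =
            targets U (AllPairs.tail uU)
              (All.tabulate λ c∈ → ∈-missing⁻ (∈-resp-↭ (↭-sym q) (there c∈)) , λ { refl → unique-∉ uU c∈ })
              (λ c∉ ne → ∷⁻-∈ (∈-resp-↭ q (∈-missing⁺ c∉)) ne)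
              (ℕ.≤-reflexive (sym (≡-trans (sym (↭-length q)) (missing-length (faceInj f)))))
            where
            uU : List.Unique (a ∷ U)
            uU = Unique-resp-↭ q (missing-unique v)

        open Targets allTargets public

        -- Since `e < m`, some copy `c` is not entered from `u`. To let the paths absorb idle copies
        -- it must receive an end: `v` is entered from it, or it is kept out of `B` and so falls to
        -- an exchange.
        manyFewer : ∀ e → 1 ≤ e → suc e ≤ m → Result e
        manyFewer (suc e′) _ e<m = go P′ refl
          where
          e = suc e′
          r = m ∸ e
          r≡ : e + r ≡ m
          r≡ = ℕ.m+[n∸m]≡n (ℕ.≤-trans (ℕ.n≤1+n e) e<m)
          1≤r : 1 ≤ r
          1≤r = ℕ.m<n⇒0<n∸m e<m
          module _ {c : Fin n} (c∈ : c ∈ Uᵇ) where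
            Uᶜ = proj₁ (∈-↭ c∈)
            Uᶜ↭ = proj₂ (∈-↭ c∈)
            uUᶜ : List.Unique (c ∷ Uᶜ)
            uUᶜ = Unique-resp-↭ Uᶜ↭ Uᵇ-unique
            r≤ : r ≤ length Uᵇ
            r≤ = ℕ.≤-pred (ℕ.≤-trans (ℕ.≤-trans (ℕ.+-monoˡ-≤ r (s≤s z≤n)) (ℕ.≤-reflexive r≡)) Uᵇ-long)
            -- `r = m ∸ e` of the copies in `Uᵇ` are not entered from `u`, and `c` is one of them.
            U = take (length Uᵇ ∸ r) Uᶜ
            lenU : length U + r ≡ length Uᵇ
            lenU = ≡-trans (cong (_+ r) (length-take-≤ _ Uᶜ (ℕ.≤-pred (ℕ.≤-trans (ℕ.≤-trans (ℕ.≤-reflexive (ℕ.+-comm 1 (length Uᵇ ∸ r)))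
              (ℕ.≤-trans (ℕ.+-monoʳ-≤ (length Uᵇ ∸ r) 1≤r) (ℕ.≤-reflexive (ℕ.m∸n+n≡m r≤)))) (ℕ.≤-reflexive (↭-length Uᶜ↭)))))) (ℕ.m∸n+n≡m r≤)
            U⊆ : U ⊆ Uᵇ
            U⊆ x∈ = ∈-resp-↭ (↭-sym Uᶜ↭) (there (take-⊆ _ Uᶜ x∈))
            c∉U : c ∉ U
            c∉U = unique-∉ uUᶜ ∘ take-⊆ _ Uᶜ
            use : ∀ {W B} → List.Unique B → W ⊆ B → B ⊆ middle → length B ≡ m → List.Unique W → length W ≡ e →
              All (λ c → Absent c v) W → c ∈ W ⊎ c ∉ B → Result e
            use uB W⊆ B⊆ lenB uW lenW W✓ w = subst Result lenW
              (many (Unique.take⁺ _ (AllPairs.tail uUᶜ)) U⊆ uB W⊆ B⊆ lenB uW W✓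
                (ℕ.+-cancelʳ-≡ r _ _ (≡-trans (cong suc (≡-trans (ℕ.+-assoc (length Js) (length U) r) (cong (length Js +_) lenU)))
                  (≡-trans count (≡-trans (cong (length P′ +_) (≡-trans (sym r≡) (cong (_+ r) (sym lenW)))) (sym (ℕ.+-assoc (length P′) _ r))))))
                (inj₁ (c , c∈ , c∉U , w)))
            W-sub : ∀ {W} → W ⊆ Vᵃ → W ⊆ middle
            W-sub W⊆ x∈ = let x∉ , ne = All.lookup Vᵃ✓ (W⊆ x∈) in absent-v∈middle x∉ ne
            both : Absent c v → Result e
            both c∉v = use {W} {B} uB ∈-++⁺ˡ
              (λ x∈ → [ W⊆M , (λ y∈ → ∈-resp-↭ (↭-sym rest↭) (∈-++⁺ʳ W (take-⊆ r rest y∈))) ]′ (∈-++⁻ W x∈))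
              (≡-trans (length-++ W) (≡-trans (cong₂ _+_ lenW (length-take-≤ r rest r≤rest)) r≡))
              uW lenW (All.tabulate λ x∈ → proj₁ (All.lookup Vᵃ✓ (W⊆ x∈))) (inj₁ (here refl))
              where
              c≢a : c ≢ a
              c≢a = absent-app (proj₁ (All.lookup Uᵇ✓ c∈)) p ∘ sym
              V↭ = ∈-↭ (Vᵃ-all c∉v c≢a)
              V₀ = proj₁ V↭
              uV₀ : List.Unique (c ∷ V₀)
              uV₀ = Unique-resp-↭ (proj₂ V↭) Vᵃ-unique
              W = c ∷ take e′ V₀
              uW : List.Unique W
              uW = Unique.take⁺ e uV₀
              lenW : length W ≡ e
              lenW = cong suc (length-take-≤ e′ V₀ (ℕ.≤-pred (ℕ.≤-trans (ℕ.≤-pred (ℕ.≤-trans e<m Vᵃ-long)) (ℕ.≤-reflexive (↭-length (proj₂ V↭))))))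
              W⊆ : W ⊆ Vᵃ
              W⊆ x∈ = ∈-resp-↭ (↭-sym (proj₂ V↭)) (take-⊆ e (c ∷ V₀) x∈)
              W⊆M : W ⊆ middle
              W⊆M = W-sub W⊆
              ex = extract uW W⊆M
              rest = proj₁ ex
              rest↭ : middle ↭ W ++ rest
              rest↭ = proj₂ ex
              B = W ++ take r rest
              uB : List.Unique B
              uB = let uA = Unique-resp-↭ rest↭ (AllPairs.tail middle-unique) in
                Unique.++⁺ uW (Unique.take⁺ r (unique-++⁻ʳ W uA)) λ (x∈ , y∈) → unique-++⁻-disjoint W uA (x∈ , take-⊆ r rest y∈)
              r≤rest : r ≤ length rest
              r≤rest = ℕ.+-cancelˡ-≤ e _ _ (ℕ.≤-trans (ℕ.≤-reflexive r≡) (ℕ.≤-trans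
                (ℕ.≤-pred (ℕ.≤-trans (ℕ.+-monoˡ-≤ m nonempty) (ℕ.≤-reflexive (sym middle-length))))
                (ℕ.≤-reflexive (≡-trans (↭-length rest↭) (≡-trans (length-++ W) (cong (_+ length rest) lenW))))))
            apart-from-v : 2 ≤ length P′ → ∀ i → v ! i ≡ c → Result e
            apart-from-v 2≤κ i eq = use {W} {B} uB ∈-++⁺ˡ
              (λ x∈ → [ W⊆M , (λ y∈ → ∈-resp-↭ (↭-sym rest↭) (there (∈-++⁺ʳ W (take-⊆ r rest y∈)))) ]′ (∈-++⁻ W x∈))
              (≡-trans (length-++ W) (≡-trans (cong₂ _+_ lenW (length-take-≤ r rest r≤rest)) r≡))
              uW lenW (All.tabulate λ x∈ → proj₁ (All.lookup Vᵃ✓ (W⊆ x∈)))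
              (inj₂ λ c∈B → unique-∉ uA ([ ∈-++⁺ˡ , ∈-++⁺ʳ W ∘ take-⊆ r rest ]′ (∈-++⁻ W c∈B)))
              where
              W = take e Vᵃ
              W⊆ : W ⊆ Vᵃ
              W⊆ = take-⊆ e Vᵃ
              W⊆M : W ⊆ middle
              W⊆M = W-sub W⊆
              uW : List.Unique W
              uW = Unique.take⁺ e Vᵃ-unique
              lenW : length W ≡ e
              lenW = length-take-≤ e Vᵃ (ℕ.≤-pred (ℕ.≤-trans e<m Vᵃ-long))
              c∈M : c ∈ middle
              c∈M = let c∉ , ne = All.lookup Uᵇ✓ c∈ in absent-u∈middle c∉ ne
              ex = extract {xs = c ∷ W} (unique-∷ (λ c∈W → absent-app (proj₁ (All.lookup Vᵃ✓ (W⊆ c∈W))) i eq) uW)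
                λ { (here refl) → c∈M ; (there x∈) → W⊆M x∈ }
              rest = proj₁ ex
              rest↭ : middle ↭ c ∷ W ++ rest
              rest↭ = proj₂ ex
              uA : List.Unique (c ∷ W ++ rest)
              uA = Unique-resp-↭ rest↭ (AllPairs.tail middle-unique)
              B = W ++ take r rest
              uB : List.Unique B
              uB = Unique.++⁺ uW (Unique.take⁺ r (unique-++⁻ʳ W (AllPairs.tail uA)))
                λ (x∈ , y∈) → unique-++⁻-disjoint W (AllPairs.tail uA) (x∈ , take-⊆ r rest y∈)
              r≤rest : r ≤ length rest
              r≤rest = ℕ.+-cancelˡ-≤ e _ _ (ℕ.≤-trans (ℕ.≤-reflexive r≡) (ℕ.≤-pred (ℕ.≤-pred (ℕ.≤-trans (ℕ.+-monoˡ-≤ m 2≤κ)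
                (ℕ.≤-reflexive (≡-trans (sym middle-length) (cong suc (≡-trans (↭-length rest↭) (cong suc (≡-trans (length-++ W) (cong (_+ length rest) lenW))))))))))) 
          -- If `v` has the symbol `c`, keeping it out of `B` takes `m + 1` middle copies, hence two
          -- positions in `P′`. With a single position, `m ≥ 3` allows `c` to be chosen missing from
          -- `v`.
          go : ∀ Q → Q ≡ P′ → Result e
          go [] eq = contradiction (subst (λ Q → 1 ≤ length Q) (sym eq) nonempty) λ ()
          go (q ∷ q′ ∷ Q) eq with Uᵇ | Uᵇ-long | use′
            where
            use′ : ∀ {c} → c ∈ Uᵇ → Result e
            use′ {c} c∈ with present? c v
            ... | inj₁ (i , eq′) = apart-from-v c∈ (subst (λ Q → 2 ≤ length Q) eq (s≤s (s≤s z≤n))) i eq′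
            ... | inj₂ c∉ = both c∈ c∉
          ... | [] | long | _ = contradiction (ℕ.≤-trans 2≤m long) λ { (s≤s ()) }
          ... | c ∷ _ | _ | use′ = use′ (here refl)
          go (q ∷ []) eq = byRich rich
            where
            only : ∀ {i} → i ∈ P′ → i ≡ q
            only i∈ with subst (_ ∈_) (sym eq) i∈
            ... | here refl = refl
            byRich : Rich → Result e
            byRich (inj₂ (i , i′ , i∈ , i′∈ , i≢)) = contradiction (≡-trans (only i∈) (sym (only i′∈))) i≢
            byRich (inj₁ (3≤m , _)) with c , c∈ , c∉ ← pickFresh _≟_ Uᵇ-unique [ v ! q ] (ℕ.≤-pred (ℕ.≤-trans 3≤m Uᵇ-long)) =
              both c∈ (absent λ i → help i)
              where
              help : ∀ i → v ! i ≢ c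
              help i eq′ with c∉u , ne ← All.lookup Uᵇ✓ c∈ with free φ ← free-face f (free-absent c∉u)
                with only (≢p⇒∈P′ (φ eq′) λ { refl → ne (sym eq′) })
              ... | refl = c∉ (here (sym eq′))

        -- When u and v share no symbol, v* = v [ p ≔ a ] is a neighbour of v in the copy of u.
        -- The path through v* ends there, and its remainder is entered anew.
        module Unshared (unshared : ∀ {j} → j ∈ P → Absent (u ! j) v) where

          new∉ : ∀ {j} → j ∈ P → Absent (v ! j) u
          new∉ {j} j∈ = absent help
            where
            help : ∀ i → u ! i ≢ v ! j
            help i eq with free φ ← free-at f j∈ = absent-app (unshared (φ eq)) j (sym eq)

          a∉v : Absent a v
          a∉v = unshared (here refl)

          b∉u : Absent b u
          b∉u = new∉ (here refl)

          lenVᵃ : suc (length Vᵃ) ≡ m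
          lenVᵃ = ℕ.≤-antisym
            (ℕ.≤-trans (⊆-length {xs = a ∷ Vᵃ}
                (unique-∷ (λ a∈ → proj₂ (All.lookup Vᵃ✓ a∈) refl) Vᵃ-unique)
                λ { (here refl) → ∈-missing⁺ a∉v ; (there c∈) → ∈-missing⁺ (proj₁ (All.lookup Vᵃ✓ c∈)) })
              (ℕ.≤-reflexive (missing-length (faceInj f))))
            Vᵃ-long

          Js↭ : P′ ↭ Js
          Js↭ = ⊆-⊇⇒↭ uniqueP′ Js-unique (λ {j} j∈ → Js-all j∈ (absent-app b∉u j)) (λ j∈ → proj₁ (All.lookup Js✓ j∈))

          lenUᵇ : suc (length Uᵇ) ≡ m
          lenUᵇ = ℕ.+-cancelˡ-≡ (length P′) _ _ (≡-trans (ℕ.+-suc (length P′) (length Uᵇ))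
            (≡-trans (cong (λ l → suc (l + length Uᵇ)) (↭-length Js↭)) count))

          v* : V
          v* = v [ p ≔ a ]

          ιv* : Inj v*
          ιv* = ≔-inj p (faceInj f) a∉v

          face-v* : Face s P v*
          face-v* = ≔p-face face-sv a∉v

          v*-p : v* ! p ≡ a
          v*-p = ≔-same v p a

          home-v* : Face s P′ v*
          home-v* = face⇒copy (face-refl ιs) face-v* (≡-trans v*-p (sym s-p))

          v*~v : Adj v* v
          v*~v = Adj-sym (≔-adj p (absent-app a∉v p))

          restore : v* [ p ≔ b ] ≡ v
          restore = ext (≔-elim v* p b (λ i x → x ≡ v ! i) refl λ i≢p → ≔-other v a i≢p)

          home₀ = home Js-unique (home✓ Js✓) (some-home Js-all)
          X₀ = proj₁ home₀
          A₀ = proj₁ (proj₂ home₀)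
          L₀ = proj₁ (proj₂ (proj₂ home₀))
          X₀~ = proj₁ (proj₂ (proj₂ (proj₂ home₀)))
          C₀ = proj₂ (proj₂ (proj₂ (proj₂ home₀)))

          v*∈A₀ : v* ∈ A₀
          v*∈A₀ = ∷⁻-∈ (∷⁻-∈ (Cover.complete C₀ home-v*)
              (λ eq → symbol≢ (≡-trans (sym s-j) (≡-trans (cong (_! jᵤ) (sym eq)) (≔-other v a jᵤ≢p)))))
            λ eq → let j , j≢p , ne = apart in ne (≡-trans (cong (_! j) (sym eq)) (≔-other v a j≢p))

          asResult : ∀ {X : List V} {W} → length X ≡ length Z + suc (length (shifts v W)) → suc (length W) ≡ m → length X ≡ length P′ * m + m
          asResult {W = W} e e′ = ≡-trans e (cong₂ _+_ lenZ (≡-trans (cong suc (length-map _ W)) e′))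

          U-absent : ∀ {U} → U ⊆ Uᵇ → All (λ c → Absent c u) U
          U-absent U⊆ = All.tabulate λ c∈ → proj₁ (All.lookup Uᵇ✓ (U⊆ c∈))

          V-absent : All (λ c → Absent c v) Vᵃ
          V-absent = All.map proj₁ Vᵃ✓

          V⊆middle : Vᵃ ⊆ middle
          V⊆middle c∈ = let c∉ , ne = All.lookup Vᵃ✓ c∈ in absent-v∈middle c∉ ne

          -- A home path already ends at `v*`, so `v*` faces `v` itself: `v` is a start of the
          -- container, and `s*` is a neighbour of `v`. Both `v*` and `s*` finish at `v`; since `s*`
          -- then enters no other start, no exchange is spared and `assign` is used with 0.
          v*-end : ∀ {Y} → map direct D ++ map swapOut Js ↭ v* ∷ Y → Result m
          v*-end q with ∈-++⁻ (map direct D) (∈-resp-↭ (↭-sym q) (here refl))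
          -- `swapOut j` carries `b` away from `p`, whereas `v*` agrees there with `v`, whose only
          -- `b` is at `p`.
          ... | inj₂ v*∈ with j , j∈ , eq ← ∈-map⁻ swapOut v*∈ =
            contradiction (subst (Carries b) (sym eq) (source-b a (proj₁ (All.lookup Js✓ j∈)))) v-¬b
          ... | inj₁ v*∈ with (j , t) , jt∈ , eq ← ∈-map⁻ direct v*∈ with j∈ , t∉ , _ ← All.lookup D✓ jt∈
            with assign 0 Vᵃ-unique V⊆middle (ℕ.suc-injective (≡-trans lenVᵃ (sym R-length)))
          ...   | [] , As , _ , P′↭ , middle↭ , As✓ = 
            let X , len , X~ , T = finish (Exchanges.starts~ Ξ X₀~) Zᵤ~ (s*~v ∷ All.map Adj-sym (shifts-adj V-absent)) v∉Zᵤ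
                  (sinks-pointwise As (All.tabulate λ jc∈ → middle≢b (As⊆ (∈-map⁺ proj₂ jc∈)))) (split-full {[]} {As} P′↭) theta*
                  (relink ↭-refl (↭-sym (shift s* (map direct D ++ map sinkAt As) (shifts v Vᵃ))) ↭-refl
                    (Exchanges.assemble Ξ {D = D} {F = []} (relink ↭-refl (↭-reflexive (sym (++-identityʳ _))) ↭-refl L₀)))
                  C₀ (proj₂ (proj₂ (Exchanges.exchanged Ξ)))
            in X , asResult {X} {Vᵃ} len lenVᵃ , X~ , T
            where
            s*~v : Adj s* v
            s*~v = subst (Adj s*) (≡-trans (S-b t (∈P′⇒≢p j∈)) (≡-trans (sym (S-≔ j t a b)) (≡-trans (cong (_[ p ≔ b ]) (sym eq)) restore)))
              (≔-adj j λ e → absent-app t∉ j (≡-trans (sym (≔-other s b (∈P′⇒≢p j∈))) e))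
            As⊆ : map proj₂ As ⊆ middle
            As⊆ c∈ = ∈-resp-↭ (↭-sym middle↭) (∈-++⁺ʳ Vᵃ c∈)
            uM : List.Unique (Vᵃ ++ map proj₂ As)
            uM = Unique-resp-↭ middle↭ (AllPairs.tail middle-unique)
            As-placed : All (λ (j , c) → j ∈ P′ × (c ≡ s ! j ⊎ c ∈ R)) As
            As-placed = All.tabulate λ {(j , c)} jc∈ → ∈-resp-↭ (↭-sym P′↭) (∈-map⁺ proj₁ jc∈) , All.lookup As✓ jc∈
            Ξ : Exchange
            Ξ = exchange middle Js Uᵇ As Vᵃ (AllPairs.tail middle-unique) id Js-unique Js✓ Uᵇ-unique (U-absent id)
              As-placed
              V-absent
              (Unique.++⁺ (unique-++⁻ʳ Vᵃ uM) Vᵃ-unique λ (c∈ , c∈V) → unique-++⁻-disjoint Vᵃ uM (c∈V , c∈))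
              (sources⊆middle id) (λ c∈ → [ As⊆ , V⊆middle ]′ (∈-++⁻ (map proj₂ As) c∈))
              (cong₂ _+_ (≡-trans (sym (↭-length Js↭)) (≡-trans (↭-length P′↭) (length-map proj₁ As))) (ℕ.suc-injective (≡-trans lenUᵇ (sym lenVᵃ))))
              (inj₂ middle⊆sources)

          -- The path stops at `v*`, and its remainder from `h` is entered from the copy `e`, the
          -- symbol of `v*` that `h` lacks. As `u` lacks it too, `u [ p ≔ e ]` is a neighbour of
          -- `u`, and a Hamiltonian path of that copy leads to `h [ p ≔ e ]`. The copy `e` then
          -- leaves the middle.
          v*-inside : ∀ {h} → h ∈ A₀ → Adj v* h → Linkage (h ∷ X₀) (v* ∷ map direct D ++ map swapOut Js) A₀ → Result m
          v*-inside {h} h∈ v*~h L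
            with assign 1 uB B⊆ (≡-trans lenVᵃ (sym R-length))
            where
            home-h : Face s P′ h
            home-h = Cover.sound C₀ (there (there h∈))
            i∈ : at v*~h ∈ P′
            i∈ = face-adj-∈ (face⇒copy face-v* (copy⇒face (face-refl ιs) home-h) (≡-trans (copy-at home-h) (≡-trans s-p (sym v*-p)))) v*~h
            e∈M : v ! at v*~h ∈ middle
            e∈M = absent-u∈middle (new∉ (there i∈)) λ eq → ∈P′⇒≢p i∈ (inj-app (faceInj f) eq)
            uB : List.Unique (v ! at v*~h ∷ Vᵃ)
            uB = unique-∷ (λ e∈ → absent-app (proj₁ (All.lookup Vᵃ✓ e∈)) (at v*~h) refl) Vᵃ-unique
            B⊆ : v ! at v*~h ∷ Vᵃ ⊆ middle
            B⊆ (here refl) = e∈M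
            B⊆ (there c∈) = V⊆middle c∈
          ... | j₁ ∷ [] , As , _ , P′↭ , middle↭ , As✓ =
            let X , len , X~ , T = finish (Exchanges.starts~ Ξ (≔-adj p (absent-app e∉u p) ∷ X₀~)) Zᵤ~ (v*~v ∷ All.map Adj-sym (shifts-adj V-absent)) v∉Zᵤ
                  (≔-to ∷ sinks-pointwise As (All.tabulate λ jc∈ → middle≢b (As⊆ (∈-map⁺ proj₂ jc∈)))) (split-full {j₁ ∷ []} {As} P′↭) theta*
                  (relink ↭-refl ↭-refl (++⁺ʳ (s ∷ s* ∷ []) (solve 3 (λ z x y → (z ⊕ x) ⊕ y ⊜ x ⊕ (z ⊕ y)) refl zs A₀ (proj₁ (Exchanges.exchanged Ξ))))
                    (Exchanges.assemble Ξ {D = D} {F = [ v* ]} (relink ↭-refl (++-comm [ v* ] (map direct D ++ map swapOut Js)) ↭-refl L₂)))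
                  C₀ (cover-same (λ { (here refl) → e∈M ; (there c∈) → Ms⊆ c∈ }) (∈-resp-↭ Ms↭)
                       (cover-join {M = [ e ]} {M′ = Ms} (λ { (here refl , c∈) → unique-∉ uMs c∈ }) cover-e (proj₂ (proj₂ (Exchanges.exchanged Ξ)))))
            in X , asResult {X} {Vᵃ} len lenVᵃ , X~ , T
            where
            open ↭-Solver {V} using (solve; _⊕_; _⊜_)
            i = at v*~h
            e = v ! i
            home-h : Face s P′ h
            home-h = Cover.sound C₀ (there (there h∈))
            face-h : Face s P h
            face-h = copy⇒face (face-refl ιs) home-h
            h-p : h ! p ≡ a
            h-p = ≡-trans (copy-at home-h) s-p
            i∈ : i ∈ P′
            i∈ = face-adj-∈ (face⇒copy face-v* face-h (≡-trans h-p (sym v*-p))) v*~h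
            e∉h : Absent e h
            e∉h = subst (λ e → Absent e h) (≔-other v a (∈P′⇒≢p i∈)) (adj-absent ιv* (Adj-sym v*~h))
            e∉u : Absent e u
            e∉u = new∉ (there i∈)
            e≢b : e ≢ b
            e≢b eq = ∈P′⇒≢p i∈ (inj-app (faceInj f) eq)
            e∈M : e ∈ middle
            e∈M = absent-u∈middle e∉u e≢b
            e∈Uᵇ : e ∈ Uᵇ
            e∈Uᵇ = Uᵇ-all e∉u e≢b
            u≢h : u ≢ h
            u≢h refl = unique-∉ (AllPairs.tail (Cover.unique C₀)) h∈
            x y : V
            x = u [ p ≔ e ]
            y = h [ p ≔ e ]
            x≢y : x ≢ y
            x≢y eq = u≢h (ext λ i → same i)
              where
              same : ∀ i → u ! i ≡ h ! i
              same i with i ≟ p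
              ... | yes refl = sym h-p
              ... | no i≢p = ≡-trans (sym (≔-other u e i≢p)) (≡-trans (cong (_! i) eq) (≔-other h e i≢p))
            face-x : Face s P x
            face-x = ≔p-face face-su e∉u
            Hm = ham (faceInj face-x)
              (face⇒copy face-x (≔p-face face-h e∉h) (≡-trans (≔-same h p e) (sym (≔-same u p e)))) x≢y
            zs = proj₁ Hm
            cover-e : Cover (InCopies s [ e ]) zs
            cover-e = subst (λ c → Cover (InCopies s [ c ]) zs) (≔-same u p e) (cover-copy face-x (proj₂ (proj₂ Hm)))
            L₂ : Linkage (x ∷ X₀) (v* ∷ map direct D ++ map swapOut Js) (zs ++ A₀)
            L₂ = glue {P = [ y ]} {R = []} (Adj-sym (≔-adj p (absent-app e∉h p)) ∷ []) (single (proj₁ (proj₂ Hm))) L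
            Ms = proj₁ (∈-↭ e∈M)
            Ms↭ : middle ↭ e ∷ Ms
            Ms↭ = proj₂ (∈-↭ e∈M)
            uMs : List.Unique (e ∷ Ms)
            uMs = Unique-resp-↭ Ms↭ (AllPairs.tail middle-unique)
            Ms⊆ : Ms ⊆ middle
            Ms⊆ c∈ = ∈-resp-↭ (↭-sym Ms↭) (there c∈)
            U = proj₁ (∈-↭ e∈Uᵇ)
            U↭ : Uᵇ ↭ e ∷ U
            U↭ = proj₂ (∈-↭ e∈Uᵇ)
            uU : List.Unique (e ∷ U)
            uU = Unique-resp-↭ U↭ Uᵇ-unique
            U⊆ : U ⊆ Uᵇ
            U⊆ c∈ = ∈-resp-↭ (↭-sym U↭) (there c∈)
            uM : List.Unique ((e ∷ Vᵃ) ++ map proj₂ As)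
            uM = Unique-resp-↭ middle↭ (AllPairs.tail middle-unique)
            As⊆ : map proj₂ As ⊆ middle
            As⊆ c∈ = ∈-resp-↭ (↭-sym middle↭) (∈-++⁺ʳ (e ∷ Vᵃ) c∈)
            ≔-to : Adj s* (swapIn j₁)
            ≔-to = subst (Adj s*) (S-b a (∈P′⇒≢p (∈-resp-↭ (↭-sym P′↭) (here refl)))) (≔-adj j₁ (absent-app missing-a j₁))
            toMs : ∀ {c} → c ∈ middle → c ≢ e → c ∈ Ms
            toMs c∈ ne = ∷⁻-∈ (∈-resp-↭ Ms↭ c∈) ne
            e∉old : e ∉ map (u !_) Js
            e∉old e∈ = let j , _ , eq = ∈-map⁻ (u !_) e∈ in absent-app e∉u j (sym eq)
            S⊆ : map (u !_) Js ++ U ⊆ Ms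
            S⊆ c∈ = toMs (sources⊆middle U⊆ c∈) λ { refl → [ e∉old , unique-∉ uU ]′ (∈-++⁻ (map (u !_) Js) c∈) }
            T⊆ : map proj₂ As ++ Vᵃ ⊆ Ms
            T⊆ {c} = [ (λ c∈A → toMs (As⊆ c∈A) λ c≡e → unique-++⁻-disjoint (e ∷ Vᵃ) uM (here c≡e , c∈A))
                     , (λ c∈V → toMs (V⊆middle c∈V) λ c≡e → absent-app (proj₁ (All.lookup Vᵃ✓ c∈V)) i (sym c≡e)) ]′
              ∘ ∈-++⁻ (map proj₂ As)
            allS : Ms ⊆ map (u !_) Js ++ U
            allS {c} c∈ = [ ∈-++⁺ˡ , (λ c∈U → ∈-++⁺ʳ (map (u !_) Js) (∷⁻-∈ (∈-resp-↭ U↭ c∈U) λ c≡e → unique-∉ uMs (subst (_∈ Ms) c≡e c∈))) ]′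
              (∈-++⁻ (map (u !_) Js) (middle⊆sources (Ms⊆ c∈)))
            lens : length Js + length U ≡ length As + length Vᵃ
            lens = ℕ.suc-injective (≡-trans (sym (ℕ.+-suc (length Js) (length U)))
              (≡-trans (cong₂ _+_ (≡-trans (sym (↭-length Js↭)) (≡-trans (↭-length P′↭) (cong suc (length-map proj₁ As))))
                  (≡-trans (sym (↭-length U↭)) (ℕ.suc-injective (≡-trans lenUᵇ (sym lenVᵃ)))))
                refl))
            As-placed : All (λ (j , c) → j ∈ P′ × (c ≡ s ! j ⊎ c ∈ R)) As
            As-placed = All.tabulate λ {(j , c)} jc∈ → ∈-resp-↭ (↭-sym P′↭) (there (∈-map⁺ proj₁ jc∈)) , All.lookup As✓ jc∈
            Ξ : Exchange
            Ξ = exchange Ms Js U As Vᵃ (AllPairs.tail uMs) Ms⊆ Js-unique Js✓ (AllPairs.tail uU) (U-absent U⊆)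
              As-placed
              V-absent
              (Unique.++⁺ (unique-++⁻ʳ (e ∷ Vᵃ) uM) Vᵃ-unique λ (c∈ , c∈V) → unique-++⁻-disjoint (e ∷ Vᵃ) uM (there c∈V , c∈))
              S⊆ T⊆ lens (inj₂ allS)

          manyUnshared : Result m
          manyUnshared with split L₀ v*∈A₀
          ... | inj₁ (_ , q) = v*-end q
          ... | inj₂ (h , h∈ , v*~h , L) = v*-inside h∈ v*~h L

      -- One path and two paths

      hamiltonPath : ∀ {u v} → Inj u → Face u P v → u ! p ≢ v ! p → ∃ λ zs → Walk u v zs × Cover (Face u P) zs
      hamiltonPath {u} {v} ι f ne with es , q ← ∈-↭ (face-symbols f (ne ∘ sym)) =
        let zs , π , C = chain es ι f ne (AllPairs.tail uE) (λ u∈ → proj₂ (∈-symbols⁻ ι (∈-resp-↭ (↭-sym q) (there u∈))) refl)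
              (unique-∉ uE) (All.tabulate λ e∈ → All.lookup (symbols-free ι) (∈-resp-↭ (↭-sym q) (there e∈)))
        in zs , π , cover-⇔ proj₁ (λ {w} g → g , inside g) C
        where
        uE : List.Unique (v ! p ∷ es)
        uE = Unique-resp-↭ q (symbols-unique ι)
        inside : ∀ {w} → Face u P w → w ! p ∈ u ! p ∷ v ! p ∷ es
        inside {w} g with w ! p ≟ u ! p
        ... | yes eq = here eq
        ... | no ne′ = there (∈-resp-↭ q (face-symbols g ne′))

      onePath : ∀ {u v} → Inj u → Face u P v → u ! p ≢ v ! p → ¬ Adj u v →
        ∃ λ X → length X ≡ 1 × All (Adj u) X × Theta P u v X
      onePath ι f ne ¬a with zs , π , C ← hamiltonPath ι f ne
        with x , y , B , u~x , y~v , q , L ← interior π (λ { refl → ne refl }) ¬a =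
        [ x ] , refl , u~x ∷ [] , theta L (y~v ∷ []) (cover-↭ q C)

      -- A Hamiltonian cycle through u passes through v, which cuts it into two paths.
      twoPaths : ∀ {u v} → Inj u → Face u P v → u ≢ v → ¬ Adj u v →
        ∃ λ X → length X ≡ 2 × All (Adj u) X × Theta P u v X
      twoPaths {u} {v} ι f u≢v ¬a = go P′ refl
        where
        t∃ = fresh ι [] (ℕ.≤-trans (s≤s z≤n) 2≤m)
        t = proj₁ t∃
        t∉ : Absent t u
        t∉ = proj₁ (proj₂ t∃)
        go : ∀ Q → Q ≡ P′ → ∃ λ X → length X ≡ 2 × All (Adj u) X × Theta P u v X
        go [] eq = contradiction (subst (λ Q → 1 ≤ length Q) (sym eq) nonempty) λ ()
        go (q ∷ _) eq = cut (theta-path T refl (≔-adj p (absent-app t∉ p) ∷ []))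
          where
          q∈ : q ∈ P′
          q∈ = subst (q ∈_) eq (here refl)
          q≢p : q ≢ p
          q≢p = ∈P′⇒≢p q∈
          w : V
          w = u [ q ≔ t ]
          u~w : Adj u w
          u~w = ≔-adj q (absent-app t∉ q)
          -- A single path from `u` to its neighbour `w` covering the face; the edge from `w` back
          -- to `u` closes the cycle, so `w` can be the first vertex of the second path.
          T : Theta P u w [ u [ p ≔ t ] ]
          T = adjacentStep ι (face-≔ q (there q∈) (face-refl ι) t∉) u~w (sym (≔-other u t (q≢p ∘ sym)))
            ((≔-adj p (absent-app t∉ p) , ≔p-face (face-refl ι) t∉) ∷ []) ([] ∷ [])
            (λ { (here e) → q≢p (proj₁ (≔-injective t∉ t∉ e)) }) λ ()
          cut : (∃ λ zs → Walk u w zs × Cover (Face u P) zs) → ∃ λ X → length X ≡ 2 × All (Adj u) X × Theta P u v X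
          cut (zs , π , C) with splitWalk π (Cover.complete C f)
          ... | inj₁ refl = contradiction u~w ¬a
          ... | inj₂ (h , as , bs , v~h , refl , π₁ , π₂)
            with x , y , B , u~x , y~v , r , L ← interior π₁ u≢v ¬a =
            x ∷ w ∷ [] , refl , u~x ∷ u~w ∷ [] ,
            theta (beside L (reverse (single π₂))) (y~v ∷ Adj-sym v~h ∷ []) (cover-↭ (++⁺ʳ bs r) C)

  -- The induction step and the choice of p

  record At (P : List (Fin k)) (p : Fin k) : Set where
    constructor at-front
    field
      P′ : List (Fin k)
      moved : P ↭ p ∷ P′
      unique′ : List.Unique (p ∷ P′)

  front : ∀ {P p} → List.Unique P → p ∈ P → At P p
  front u p∈ with P′ , q ← ∈-↭ p∈ = at-front P′ q (Unique-resp-↭ q u)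

  module Step (κ : ℕ) (1≤κ : 1 ≤ κ) (large : 3 ≤ m ⊎ 2 ≤ κ)
              (smaller : ∀ P → List.Unique P → length P ≡ κ → AdjacentThetas P × DistantThetas P)
              (P : List (Fin k)) (uniqueP : List.Unique P) (lenP : length P ≡ suc κ) where

    module Front {p : Fin k} (F : At P p) where
      open At F public

      len′ : length P′ ≡ κ
      len′ = ℕ.suc-injective (≡-trans (sym (↭-length moved)) lenP)

      nonempty : 1 ≤ length P′
      nonempty = subst (1 ≤_) (sym len′) 1≤κ

      Σ : Split
      Σ = splitting p P′ unique′

      rich : Copies.Rich Σ
      rich = go P′ (λ q∈ → q∈) (AllPairs.tail unique′) len′ large
        where
        go : ∀ Q → Q ⊆ P′ → List.Unique Q → length Q ≡ κ → 3 ≤ m ⊎ 2 ≤ κ → Copies.Rich Σ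
        go [] _ _ refl _ = contradiction 1≤κ λ ()
        go (q ∷ Q) Q⊆ _ _ (inj₁ 3≤m) = inj₁ (3≤m , q , Q⊆ (here refl))
        go (q ∷ []) Q⊆ _ refl (inj₂ (s≤s ()))
        go (q ∷ q′ ∷ Q) Q⊆ ((q≢ ∷ _) ∷ _) _ (inj₂ _) = inj₂ (q , q′ , Q⊆ (here refl) , Q⊆ (there (here refl)) , q≢)

      adjacent : AdjacentThetas P′
      adjacent = proj₁ (smaller P′ (AllPairs.tail unique′) len′)

      distant : DistantThetas P′
      distant = proj₂ (smaller P′ (AllPairs.tail unique′) len′)

      Γ : Copies.Setting Σ
      Γ = Copies.setting nonempty rich adjacent distant

      back : ∀ {u v X} → Theta (p ∷ P′) u v X → Theta P u v X
      back = theta-↭ (↭-sym moved) ↭-refl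

      toFront : ∀ {u v} → Face u P v → Face u (p ∷ P′) v
      toFront = face-↭ moved

    adjacentThetas : AdjacentThetas P
    adjacentThetas {u} {v} ι f u~v X✓ uX v∉ X≢
      -- Any position other than the one where `u` and `v` differ puts both into one copy.
      with p , p∈ , p∉ ← pickFresh _≟_ uniqueP [ at u~v ] (subst (2 ≤_) (sym lenP) (s≤s 1≤κ)) =
      back (Copies.Inductive.adjacentStep Σ Γ ι (toFront f) u~v (agree u~v λ { refl → p∉ (here refl) })
        (All.map (λ (a , g) → a , toFront g) X✓) uX v∉ X≢)
      where open Front (front uniqueP p∈)

    module _ {u v : V} (ι : Inj u) (f : Face u P v) (u≢v : u ≢ v) (¬a : ¬ Adj u v) where

      Thetas : ℕ → Set
      Thetas l = ∃ λ X → length X ≡ l × All (Adj u) X × Theta P u v X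

      module Differing {p : Fin k} (p∈ : p ∈ P) (ne : u ! p ≢ v ! p) where
        open Front (front uniqueP p∈) public

        backThetas : ∀ {l} → (∃ λ X → length X ≡ l × All (Adj u) X × Theta (p ∷ P′) u v X) → Thetas l
        backThetas (X , len , X~ , T) = X , len , X~ , back T

        apart : Copies.Inductive.Apart Σ Γ u v
        apart with Fin.any? (λ j → ¬? (j ≟ p) ×-dec ¬? (u ! j ≟ v ! j))
        ... | yes (j , j≢ , d) = j , j≢ , d
        ... | no none = contradiction (adj p ne λ {i} i≢ → same i i≢) ¬a
          where
          same : ∀ i → i ≢ p → u ! i ≡ v ! i
          same i i≢ with u ! i ≟ v ! i
          ... | yes eq = eq
          ... | no d = contradiction (i , i≢ , d) none

        Π : Copies.Inductive.Separated Σ Γ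
        Π = Copies.Inductive.separated ι (toFront f) ne apart (Copies.Inductive.findPivot Σ Γ ι (toFront f) ne)

        atMost : ∀ l → 1 ≤ l → l ≤ κ * m → Thetas l
        -- `few` relies on a third start to keep a path in the home copy, so one and two paths come
        -- from Hamiltonian paths and cycles.
        atMost 1 _ _ = backThetas (Copies.Inductive.onePath Σ Γ ι (toFront f) ne ¬a)
        atMost 2 _ _ = backThetas (Copies.Inductive.twoPaths Σ Γ ι (toFront f) u≢v ¬a)
        atMost (suc (suc (suc l))) _ l≤ = backThetas (Copies.Inductive.Pivoted.few Σ Γ Π (3 + l) (s≤s (s≤s (s≤s z≤n))) (subst (λ κ → 3 + l ≤ κ * m) (sym len′) l≤))

        fewer : ∀ e → 1 ≤ e → suc e ≤ m → Thetas (κ * m + e)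
        fewer e 1≤e e<m = backThetas (subst (λ κ → ∃ λ X → length X ≡ κ * m + e × All (Adj u) X × Theta (p ∷ P′) u v X) len′ (Copies.Inductive.Pivoted.manyFewer Σ Γ Π e 1≤e e<m))

      maximal-linked : ∀ {p} → p ∈ P → u ! p ≢ v ! p → ¬ Absent (u ! p) v → Thetas (κ * m + m)
      maximal-linked {p} p∈ ne link = backThetas (subst (λ κ → ∃ λ X → length X ≡ κ * m + m × All (Adj u) X × Theta (p ∷ P′) u v X) len′ (Copies.Inductive.Pivoted.manyLinked Σ Γ Π link))
        where open Differing p∈ ne

      maximal-unshared : ∀ {p} → p ∈ P → u ! p ≢ v ! p → (∀ {j} → j ∈ P → Absent (u ! j) v) → Thetas (κ * m + m)
      maximal-unshared {p} p∈ ne none = backThetas (subst (λ κ → ∃ λ X → length X ≡ κ * m + m × All (Adj u) X × Theta (p ∷ P′) u v X) len′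
          (Copies.Inductive.Pivoted.Unshared.manyUnshared Σ Γ Π λ j∈ → none (∈-resp-↭ (↭-sym moved) j∈)))
        where open Differing p∈ ne

      -- Here `u` and `v` share a copy. The degree within it and the `m` shifts of `u` make up the
      -- whole degree; `u ! q`, missing from `v`, is the end symbol without a start.
      maximal-agreeing : ∀ {p q} → p ∈ P → u ! p ≡ v ! p → q ∈ P → u ! q ≢ v ! q → Absent (u ! q) v → Thetas (κ * m + m)
      maximal-agreeing {p} {q} p∈ eq q∈ ne q∉ =
        let X , len , X~ , T = distant (length P′ * m) ι f′ u≢v ¬a
              (ℕ.≤-trans (s≤s z≤n) (ℕ.≤-trans 2≤m (ℕ.≤-trans (ℕ.≤-reflexive (sym (ℕ.*-identityˡ m))) (ℕ.*-monoˡ-≤ m nonempty)))) ℕ.≤-refl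
        in X ++ map (λ c → u [ p ≔ c ]) (missing u) ,
           ≡-trans (length-++ X) (cong₂ _+_ (≡-trans len (cong (_* m) len′)) (≡-trans (length-map _ (missing u)) (missing-length ι))) ,
           All.++⁺ X~ (All.tabulate λ x∈ → let c , c∈ , e = ∈-map⁻ (λ c → u [ p ≔ c ]) x∈ in
             subst (Adj u) (sym e) (≔-adj p (absent-app (∈-missing⁻ c∈) p))) ,
           back (Copies.Inductive.outward Σ Γ ι (toFront f) eq (q , (λ { refl → ne eq }) , ne) (All.tabulate ∈-missing⁻) (All.tabulate ∈-missing⁻)
             (missing-unique u) (missing-unique v) (≡-trans (missing-length ι) (sym (missing-length (faceInj f))))
             (u ! q , ∈-missing⁺ q∉ , λ c∈ → absent-app (∈-missing⁻ c∈) q refl) T)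
        where
        open Front (front uniqueP p∈)
        f′ : Face u P′ v
        f′ = Copies.face⇒copy Σ (face-refl ι) (toFront f) (sym eq)

      differing : ∃ λ p → p ∈ P × u ! p ≢ v ! p
      differing with Fin.any? (λ j → ¬? (u ! j ≟ v ! j))
      ... | no none = contradiction (ext same) u≢v
        where
        same : ∀ i → u ! i ≡ v ! i
        same i with u ! i ≟ v ! i
        ... | yes eq = eq
        ... | no d = contradiction (i , d) none
      ... | yes (p , ne) with p ∈ᵖ? P
      ...   | yes p∈ = p , p∈ , ne
      ...   | no p∉ = contradiction (sym (faceFixed f p∉)) ne

      absent? : ∀ t w → Dec (Absent t w)
      absent? t w with present? t w
      ... | inj₁ (i , eq) = no λ t∉ → absent-app t∉ i eq
      ... | inj₂ t∉ = yes t∉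

      unlinked? : ∀ j → Dec (u ! j ≡ v ! j ⊎ Absent (u ! j) v)
      unlinked? j = u ! j ≟ v ! j ⊎-dec absent? (u ! j) v

      differs? : ∀ j → Dec (u ! j ≢ v ! j)
      differs? j = ¬? (u ! j ≟ v ! j)

      -- At the full degree `p` must be chosen with care. A position where the vertices differ and
      -- whose symbol in `u` recurs in `v` is best. If there is none, every symbol of `u` at a
      -- differing position is missing from `v`, and either some position agrees or nothing is
      -- shared.
      maximal : Thetas (κ * m + m)
      maximal with All.all? unlinked? P
      ... | no ¬all with p , p∈ , bad ← find (All.¬All⇒Any¬ unlinked? P ¬all) =
        maximal-linked p∈ (bad ∘ inj₁) (bad ∘ inj₂)
      ... | yes all with All.all? differs? P
      ...   | yes none = let p , p∈ , ne = differing in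
        maximal-unshared p∈ ne λ {j} j∈ → [ (λ eq → contradiction eq (All.lookup none j∈)) , id ]′ (All.lookup all j∈)
      ...   | no ¬none with p , p∈ , ¬ne ← find (All.¬All⇒Any¬ differs? P ¬none) | q , q∈ , ne ← differing | u ! p ≟ v ! p
      ...     | no ne′ = contradiction ne′ ¬ne
      ...     | yes eq = maximal-agreeing p∈ eq q∈ ne ([ (λ eq′ → contradiction eq′ ne) , id ]′ (All.lookup all q∈))

      distantAt : ∀ l → 1 ≤ l → l ≤ suc κ * m → Thetas l
      distantAt l 1≤l l≤ with p , p∈ , ne ← differing with l ℕ.≤? κ * m
      ... | yes l≤κm = atMost l 1≤l l≤κm
        where open Differing p∈ ne
      ... | no l≰κm = subst Thetas (ℕ.m+[n∸m]≡n (ℕ.<⇒≤ κm<l)) (surplus (l ∸ κ * m ℕ.≟ m))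
        where
        open Differing p∈ ne
        κm<l : κ * m < l
        κm<l = ℕ.≰⇒> l≰κm
        e≤m : l ∸ κ * m ≤ m
        e≤m = ℕ.≤-trans (ℕ.∸-monoˡ-≤ (κ * m) l≤) (ℕ.≤-reflexive (ℕ.m+n∸n≡m m (κ * m)))
        surplus : Dec (l ∸ κ * m ≡ m) → Thetas (κ * m + (l ∸ κ * m))
        surplus (yes eq) = subst (λ e → Thetas (κ * m + e)) (sym eq) maximal
        surplus (no ne′) = fewer _ (ℕ.m<n⇒0<n∸m κm<l) (ℕ.≤∧≢⇒< e≤m ne′)

    distantThetas : DistantThetas P
    distantThetas {u} {v} l ι f u≢v ¬a 1≤l l≤ = distantAt ι f u≢v ¬a l 1≤l (subst (λ κ → l ≤ κ * m) lenP l≤)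
 

  -- Base cases: lines and squares

  open Certificates

  adj-irrefl : ∀ {w} → ¬ Adj w w
  adj-irrefl (adj _ d _) = d refl

  line-adj : ∀ {p u x y} → Face u [ p ] x → Face u [ p ] y → x ≢ y → Adj x y
  line-adj {p} {u} {x} {y} (face _ s) (face _ s′) x≢y = adj p (λ eq → x≢y (ext (same eq))) λ i≢ → off i≢
    where
    off : ∀ {i} → i ≢ p → x ! i ≡ y ! i
    off i≢ = ≡-trans (s λ { (here e) → i≢ e }) (sym (s′ λ { (here e) → i≢ e }))
    same : x ! p ≡ y ! p → ∀ i → x ! i ≡ y ! i
    same eq i with i ≟ p
    ... | yes refl = eq
    ... | no i≢ = off i≢

  trivialLinks : ∀ X → Links X X X
  trivialLinks [] = []
  trivialLinks (x ∷ X) = stop ∷ trivialLinks X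

  linePath : ∀ {p u} x xs → List.Unique (x ∷ xs) → All (Face u [ p ]) (x ∷ xs) → ∃ λ y → y ∈ x ∷ xs × Walk x y (x ∷ xs)
  linePath x [] _ _ = x , here refl , stop
  linePath x (x′ ∷ xs) ((ne ∷ _) ∷ u) (f ∷ f′ ∷ fs) with y , y∈ , π ← linePath x′ xs u (f′ ∷ fs) =
    y , there y∈ , step (line-adj f f′ ne) π

  lineCover : ∀ {p u} → Inj u → Cover (Face u [ p ]) (u ∷ nbrs [ p ] u)
  lineCover {p} {u} ι = record
    { unique = unique-∷ (adj-irrefl ∘ nbr-adj) (nbrs-unique ([] ∷ []))
    ; sound = λ { (here refl) → face-refl ι ; (there w∈) → nbr-face ι w∈ }
    ; complete = inside }
    where
    inside : ∀ {w} → Face u [ p ] w → w ∈ u ∷ nbrs [ p ] u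
    inside {w} f with w ≟ᵛ u
    ... | yes refl = here refl
    ... | no w≢u = there (face-adj⇒nbr f (line-adj (face-refl ι) f (w≢u ∘ sym)))

  -- A face with one free position is a complete graph: the first path runs through all vertices
  -- that are not prescribed, and every other path has one interior vertex.
  lineAdjacent : ∀ p → AdjacentThetas [ p ]
  lineAdjacent p {X = []} _ _ _ _ _ _ X≢ = contradiction refl X≢
  lineAdjacent p {u} {v} {x ∷ X} ι f u~v X✓ uX v∉ _
    with N , q ← ∈-↭ (face-adj⇒nbr f u~v)
    with rest , r ← extract {xs = v ∷ x ∷ X} (unique-∷ v∉ uX)
           (λ { (here refl) → face-adj⇒nbr f u~v ; (there x∈) → let a , g = All.lookup X✓ x∈ in face-adj⇒nbr g a }) =
    theta (beside (single π) (toLinkage (trivialLinks X)))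
      (All.tabulate λ {w} w∈ → line-adj (inFace (sub w∈)) f λ { refl → unique-∉ u₁ (sub w∈) })
      C
    where
    C : Cover (Face u [ p ]) (u ∷ v ∷ (x ∷ rest) ++ X)
    C = cover-↭ (prep u (↭-trans r (prep v (prep x (++-comm X rest))))) (lineCover ι)
    u₁ : List.Unique (v ∷ (x ∷ rest) ++ X)
    u₁ = AllPairs.tail (Cover.unique C)
    inFace : ∀ {w} → w ∈ (x ∷ rest) ++ X → Face u [ p ] w
    inFace = Cover.sound C ∘ there ∘ there
    lp = linePath x rest (unique-++⁻ˡ (x ∷ rest) (AllPairs.tail u₁)) (All.tabulate (inFace ∘ ∈-++⁺ˡ))
    y = proj₁ lp
    π = proj₂ (proj₂ lp)
    sub : ∀ {w} → w ∈ y ∷ X → w ∈ (x ∷ rest) ++ X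
    sub (here refl) = ∈-++⁺ˡ (proj₁ (proj₂ lp))
    sub (there w∈) = ∈-++⁺ʳ (x ∷ rest) w∈

  lineDistant : ∀ p → DistantThetas [ p ]
  lineDistant p l ι f u≢v ¬a _ _ = contradiction (line-adj (face-refl ι) f u≢v) ¬a

  module Square (m≡2 : m ≡ 2) where

    module Labelled (p q : Fin k) (p≢q : p ≢ q) (u : V) (ι : Inj u) (x y : Fin n) (xy : missing u ↭ x ∷ y ∷ []) where

      uniqueP : List.Unique (p ∷ q ∷ [])
      uniqueP = (p≢q ∷ []) ∷ [] ∷ []

      open Copies (splitting p [ q ] uniqueP)

      x∉ : Absent x u
      x∉ = ∈-missing⁻ (∈-resp-↭ (↭-sym xy) (here refl))

      y∉ : Absent y u
      y∉ = ∈-missing⁻ (∈-resp-↭ (↭-sym xy) (there (here refl)))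

      x≢y : x ≢ y
      x≢y with (ne ∷ _) ∷ _ ← Unique-resp-↭ xy (missing-unique u) = ne

      -- Numbers the four symbols of the face so that `u` becomes the `u₀` of the certificates.
      σ : Fin 4 → Fin n
      σ zero = u ! p
      σ (suc zero) = u ! q
      σ (suc (suc zero)) = x
      σ (suc (suc (suc zero))) = y

      σ-injective : ∀ i j → σ i ≡ σ j → i ≡ j
      σ-injective zero zero _ = refl
      σ-injective zero (suc zero) e = contradiction (inj-app ι e) p≢q
      σ-injective zero (suc (suc zero)) e = contradiction e (absent-app x∉ p)
      σ-injective zero (suc (suc (suc zero))) e = contradiction e (absent-app y∉ p)
      σ-injective (suc zero) zero e = contradiction (sym (inj-app ι e)) p≢q
      σ-injective (suc zero) (suc zero) _ = refl
      σ-injective (suc zero) (suc (suc zero)) e = contradiction e (absent-app x∉ q)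
      σ-injective (suc zero) (suc (suc (suc zero))) e = contradiction e (absent-app y∉ q)
      σ-injective (suc (suc zero)) zero e = contradiction (sym e) (absent-app x∉ p)
      σ-injective (suc (suc zero)) (suc zero) e = contradiction (sym e) (absent-app x∉ q)
      σ-injective (suc (suc zero)) (suc (suc zero)) _ = refl
      σ-injective (suc (suc zero)) (suc (suc (suc zero))) e = contradiction e x≢y
      σ-injective (suc (suc (suc zero))) zero e = contradiction (sym e) (absent-app y∉ p)
      σ-injective (suc (suc (suc zero))) (suc zero) e = contradiction (sym e) (absent-app y∉ q)
      σ-injective (suc (suc (suc zero))) (suc (suc zero)) e = contradiction (sym e) x≢y
      σ-injective (suc (suc (suc zero))) (suc (suc (suc zero))) _ = refl

      σ-fresh : ∀ i {c} → c ≢ p → c ≢ q → u ! c ≢ σ i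
      σ-fresh zero c≢p _ e = c≢p (inj-app ι e)
      σ-fresh (suc zero) _ c≢q e = c≢q (inj-app ι e)
      σ-fresh (suc (suc zero)) {c} _ _ = absent-app x∉ c
      σ-fresh (suc (suc (suc zero))) {c} _ _ = absent-app y∉ c

      σ-onto : ∀ {t} → Free u t → ∃ λ i → σ i ≡ t
      σ-onto {t} (free φ) with present? t u
      ... | inj₁ (c , e) with φ e
      ...   | here refl = zero , e
      ...   | there (here refl) = suc zero , e
      σ-onto {t} (free φ) | inj₂ t∉ with ∈-resp-↭ xy (∈-missing⁺ t∉)
      ... | here refl = suc (suc zero) , refl
      ... | there (here refl) = suc (suc (suc zero)) , refl

      W : Pair → V
      W (i , j) = u [ p ≔ σ i ] [ q ≔ σ j ]

      W-elim : ∀ i j (Q : Fin k → Fin n → Set) → Q p (σ i) → Q q (σ j) → (∀ {c} → c ≢ p → c ≢ q → Q c (u ! c)) →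
        ∀ c → Q c (W (i , j) ! c)
      W-elim i j Q Qp Qq Qr = ≔-elim (u [ p ≔ σ i ]) q (σ j) Q Qq λ {c} c≢q →
        ≔-elim u p (σ i) (λ c t → c ≢ q → Q c t) (λ _ → Qp) (λ c≢p → Qr c≢p) c c≢q

      W-p : ∀ i j → W (i , j) ! p ≡ σ i
      W-p i j = ≡-trans (≔-other (u [ p ≔ σ i ]) (σ j) p≢q) (≔-same u p (σ i))

      W-q : ∀ i j → W (i , j) ! q ≡ σ j
      W-q i j = ≔-same (u [ p ≔ σ i ]) q (σ j)

      W-≡ : ∀ {w} i j → Face u (p ∷ q ∷ []) w → w ! p ≡ σ i → w ! q ≡ σ j → W (i , j) ≡ w
      W-≡ {w} i j (face _ s) e e′ = ext (W-elim i j (λ c t → t ≡ w ! c) (sym e) (sym e′)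
        λ c≢p c≢q → sym (s λ { (here r) → c≢p r ; (there (here r)) → c≢q r }))

      W-inj : ∀ {i j} → i ≢ j → Inj (W (i , j))
      W-inj {i} {j} i≢j = inj λ {c} {c′} → W-elim i j (λ c t → t ≡ W (i , j) ! c′ → c ≡ c′)
        (W-elim i j (λ c′ t → σ i ≡ t → p ≡ c′) (λ _ → refl) (λ e → contradiction (σ-injective i j e) i≢j)
          (λ c≢p c≢q e → contradiction (sym e) (σ-fresh i c≢p c≢q)) c′)
        (W-elim i j (λ c′ t → σ j ≡ t → q ≡ c′) (λ e → contradiction (sym (σ-injective j i e)) i≢j) (λ _ → refl)
          (λ c≢p c≢q e → contradiction (sym e) (σ-fresh j c≢p c≢q)) c′)
        (λ {c} c≢p c≢q → W-elim i j (λ c′ t → u ! c ≡ t → c ≡ c′) (λ e → contradiction e (σ-fresh i c≢p c≢q))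
          (λ e → contradiction e (σ-fresh j c≢p c≢q)) (λ _ _ e → inj-app ι e) c′) c

      W-face : ∀ {i j} → i ≢ j → Face u (p ∷ q ∷ []) (W (i , j))
      W-face {i} {j} i≢j = face (W-inj i≢j) λ {c} → W-elim i j (λ c t → c ∉ p ∷ q ∷ [] → t ≡ u ! c)
        (λ p∉ → contradiction (here refl) p∉) (λ q∉ → contradiction (there (here refl)) q∉) (λ _ _ _ → refl) c

      W-injective : ∀ {c c′} → W c ≡ W c′ → c ≡ c′
      W-injective {i , j} {i′ , j′} e = cong₂ _,_
        (σ-injective i i′ (≡-trans (sym (W-p i j)) (≡-trans (cong (_! p) e) (W-p i′ j′))))
        (σ-injective j j′ (≡-trans (sym (W-q i j)) (≡-trans (cong (_! q) e) (W-q i′ j′))))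

      W-adj : ∀ {c c′} → c ~₄ c′ → Adj (W c) (W c′)
      W-adj {i , j} {i′ , .j} (inj₁ (ne , refl)) =
        adj p (λ e → ne (σ-injective i i′ (≡-trans (sym (W-p i j)) (≡-trans e (W-p i′ j)))))
          λ {c} c≢p → W-elim i j (λ c t → c ≢ p → t ≡ W (i′ , j) ! c) (λ ne → contradiction refl ne) (λ _ → sym (W-q i′ j))
            (λ {c} c≢p c≢q _ → W-elim i′ j (λ c t → c ≢ p → c ≢ q → u ! c ≡ t) (λ ne _ → contradiction refl ne)
              (λ _ ne → contradiction refl ne) (λ _ _ _ _ → refl) c c≢p c≢q) c c≢p
      W-adj {i , j} {.i , j′} (inj₂ (refl , ne)) =
        adj q (λ e → ne (σ-injective j j′ (≡-trans (sym (W-q i j)) (≡-trans e (W-q i j′)))))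
          λ c≢q → ≡-trans (≔-other (u [ p ≔ σ i ]) (σ j) c≢q) (sym (≔-other (u [ p ≔ σ i ]) (σ j′) c≢q))

      W-u₀ : W u₀ ≡ u
      W-u₀ = W-≡ zero (suc zero) (face-refl ι) refl refl

      toPath : ∀ c cs → Linked _~₄_ (c ∷ cs) → Walk (W c) (W (final c cs)) (map W (c ∷ cs))
      toPath c [] _ = stop
      toPath c (c′ ∷ cs) (a ∷ as) = step (W-adj a) (toPath c′ cs as)

      toLinks : ∀ {v} L → All (λ (x , xs) → Linked _~₄_ (u₀ ∷ x ∷ xs) × final x xs ~₄ v) L →
        ∃ λ Y → Links (map (W ∘ proj₁) L) Y (map W (flat L)) × All (λ y → Adj y (W v)) Y
      toLinks [] [] = [] , [] , []
      toLinks ((c , cs) ∷ L) ((_ ∷ l , e) ∷ oks) with Y , Ls , Y~ ← toLinks L oks =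
        W (final c cs) ∷ Y , subst (Links _ _) (sym (map-++ W (c ∷ cs) (flat L))) (toPath c cs l ∷ Ls) , W-adj e ∷ Y~

      certified-starts : ∀ {v L} → Valid v L → All (Adj u) (map (W ∘ proj₁) L)
      certified-starts (valid ok _ _ _) = go ok
        where
        go : ∀ {v L} → All (λ (x , xs) → Linked _~₄_ (u₀ ∷ x ∷ xs) × final x xs ~₄ v) L → All (Adj u) (map (W ∘ proj₁) L)
        go [] = []
        go {L = (c , _) ∷ _} ((a ∷ _ , _) ∷ oks) = subst (λ z → Adj z (W c)) W-u₀ (W-adj a) ∷ go oks

      certified : ∀ {v L} → Valid v L → Theta (p ∷ q ∷ []) u (W v) (map (W ∘ proj₁) L)
      certified {v} {L} (valid ok dis prop span) with Y , Ls , Y~ ← toLinks L ok =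
        theta (toLinkage Ls) Y~ (subst (λ z → Cover (Face u (p ∷ q ∷ [])) (z ∷ W v ∷ map W (flat L))) W-u₀ (record
          { unique = Unique.map⁺ W-injective dis
          ; sound = λ w∈ → let c , c∈ , e = ∈-map⁻ W w∈ in subst (Face u _) (sym e) (W-face (All.lookup prop c∈))
          ; complete = λ {w} f →
              let i , e = σ-onto (free-at f (here refl)) ; j , e′ = σ-onto (free-at f (there (here refl)))
              in subst (_∈ map W (u₀ ∷ v ∷ flat L)) (W-≡ i j f (sym e) (sym e′))
                   (∈-map⁺ W (span i j λ i≡j → p≢q (inj-app (faceInj f) (≡-trans (sym e) (≡-trans (cong σ i≡j) e′))))) }))

      pattern #0 = zero
      pattern #1 = suc zero
      pattern #2 = suc (suc zero)
      pattern #3 = suc (suc (suc zero))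

      -- The numbering brings the adjacent vertex `v` to the pair (2 , 1). The seven certificates
      -- belong to the nonempty subsets of the other three neighbours of `u`.
      adjacentTheta : ∀ {X} → All (λ z → Adj u z × Face u (p ∷ q ∷ []) z) X → List.Unique X → W (#2 , #1) ∉ X → X ≢ [] →
        Theta (p ∷ q ∷ []) u (W (#2 , #1)) X
      adjacentTheta {X} X✓ uX v∉ X≢ = choose (W (#3 , #1) ∈ᵛ? X) (W (#0 , #2) ∈ᵛ? X) (W (#0 , #3) ∈ᵛ? X)
        (↭-trans perm (↭-reflexive (≡-trans (filter-keep _ _) (cong (keep (W (#3 , #1) ∈ᵛ? X))
          (≡-trans (filter-keep _ _) (cong (keep (W (#0 , #2) ∈ᵛ? X)) (filter-keep _ _)))))))
        where
        cs = W (#3 , #1) ∷ W (#0 , #2) ∷ W (#0 , #3) ∷ []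
        known : ∀ {z} → Adj u z × Face u (p ∷ q ∷ []) z → z ∈ W (#2 , #1) ∷ cs
        known {z} (a , f) with ∈-nbrs⁻ (face-adj⇒nbr f a)
        ... | _ , t , here refl , t∉ , refl with ∈-resp-↭ xy (∈-missing⁺ t∉)
        ...   | here refl = here (sym (W-≡ #2 #1 f (≔-same u p t) (≔-other u t (p≢q ∘ sym))))
        ...   | there (here refl) = there (here (sym (W-≡ #3 #1 f (≔-same u p t) (≔-other u t (p≢q ∘ sym)))))
        known {z} (a , f) | _ , t , there (here refl) , t∉ , refl with ∈-resp-↭ xy (∈-missing⁺ t∉)
        ...   | here refl = there (there (here (sym (W-≡ #0 #2 f (≔-other u t p≢q) (≔-same u q t)))))
        ...   | there (here refl) = there (there (there (here (sym (W-≡ #0 #3 f (≔-other u t p≢q) (≔-same u q t))))))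
        cs-unique : List.Unique cs
        cs-unique = Unique.map⁺ {f = W} W-injective unique-pairs
          where
          unique-pairs : List.Unique ((#3 , #1) ∷ (#0 , #2) ∷ (#0 , #3) ∷ [])
          unique-pairs = ((λ ()) ∷ (λ ()) ∷ []) ∷ ((λ ()) ∷ []) ∷ [] ∷ []
        perm : X ↭ filter (_∈ᵛ? X) cs
        perm = ⊆-⊇⇒↭ uX (Unique.filter⁺ (_∈ᵛ? X) cs-unique)
          (λ z∈ → ∈-filter⁺ (_∈ᵛ? X) (∷⁻-∈ (known (All.lookup X✓ z∈)) λ { refl → v∉ z∈ }) z∈)
          (λ z∈ → proj₂ (∈-filter⁻ (_∈ᵛ? X) {xs = cs} z∈))
        use : ∀ L {t : True (valid? (#2 , #1) L)} → X ↭ map (W ∘ proj₁) L → Theta (p ∷ q ∷ []) u (W (#2 , #1)) X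
        use L {t} r = theta-↭ ↭-refl (↭-sym r) (certified (certify (#2 , #1) L {t}))
        nil : X ↭ [] → X ≡ []
        nil r = go X (↭-length r)
          where
          go : ∀ (X : List V) → length X ≡ 0 → X ≡ []
          go [] _ = refl
        keep : ∀ {z} → Dec (z ∈ X) → List V → List V
        keep {z} (yes _) zs = z ∷ zs
        keep (no _) zs = zs
        filter-keep : ∀ z zs → filter (_∈ᵛ? X) (z ∷ zs) ≡ keep (z ∈ᵛ? X) (filter (_∈ᵛ? X) zs)
        filter-keep z zs with z ∈ᵛ? X
        ... | yes _ = refl
        ... | no _ = refl
        choose : (d₁ : Dec (W (#3 , #1) ∈ X)) (d₂ : Dec (W (#0 , #2) ∈ X)) (d₃ : Dec (W (#0 , #3) ∈ X)) →
          X ↭ keep d₁ (keep d₂ (keep d₃ [])) → Theta (p ∷ q ∷ []) u (W (#2 , #1)) X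
        choose (yes _) (yes _) (yes _) r = use (((#3 , #1) , []) ∷ ((#0 , #2) , (#1 , #2) ∷ (#3 , #2) ∷ (#3 , #0) ∷ (#1 , #0) ∷ (#2 , #0) ∷ []) ∷ ((#0 , #3) , (#1 , #3) ∷ (#2 , #3) ∷ []) ∷ []) r
        choose (yes _) (yes _) (no _) r = use (((#3 , #1) , []) ∷ ((#0 , #2) , (#0 , #3) ∷ (#1 , #3) ∷ (#1 , #0) ∷ (#1 , #2) ∷ (#3 , #2) ∷ (#3 , #0) ∷ (#2 , #0) ∷ (#2 , #3) ∷ []) ∷ []) r
        choose (yes _) (no _) (yes _) r = use (((#3 , #1) , []) ∷ ((#0 , #3) , (#0 , #2) ∷ (#1 , #2) ∷ (#3 , #2) ∷ (#3 , #0) ∷ (#1 , #0) ∷ (#1 , #3) ∷ (#2 , #3) ∷ (#2 , #0) ∷ []) ∷ []) r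
        choose (yes _) (no _) (no _) r = use (((#3 , #1) , (#3 , #0) ∷ (#1 , #0) ∷ (#1 , #2) ∷ (#3 , #2) ∷ (#0 , #2) ∷ (#0 , #3) ∷ (#1 , #3) ∷ (#2 , #3) ∷ (#2 , #0) ∷ []) ∷ []) r
        choose (no _) (yes _) (yes _) r = use (((#0 , #2) , (#1 , #2) ∷ (#1 , #0) ∷ (#2 , #0) ∷ (#3 , #0) ∷ (#3 , #2) ∷ (#3 , #1) ∷ []) ∷ ((#0 , #3) , (#1 , #3) ∷ (#2 , #3) ∷ []) ∷ []) r
        choose (no _) (yes _) (no _) r = use (((#0 , #2) , (#0 , #3) ∷ (#1 , #3) ∷ (#1 , #0) ∷ (#1 , #2) ∷ (#3 , #2) ∷ (#3 , #1) ∷ (#3 , #0) ∷ (#2 , #0) ∷ (#2 , #3) ∷ []) ∷ []) r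
        choose (no _) (no _) (yes _) r = use (((#0 , #3) , (#0 , #2) ∷ (#1 , #2) ∷ (#1 , #0) ∷ (#1 , #3) ∷ (#2 , #3) ∷ (#2 , #0) ∷ (#3 , #0) ∷ (#3 , #2) ∷ (#3 , #1) ∷ []) ∷ []) r
        choose (no _) (no _) (no _) r = contradiction (nil r) X≢

      -- Freedom in calling one of the missing symbols `x` reduces the vertices `v` to be listed;
      -- each has one certificate for every `l` up to the degree 4.
      distantTheta : ∀ {v} l → Face u (p ∷ q ∷ []) v → u ≢ v → ¬ Adj u v →
        (v ! p ≡ u ! q ⊎ v ! p ≡ x) → (v ! q ≡ u ! p ⊎ (v ! q ≡ x × v ! p ≢ x) ⊎ (v ! q ≡ y)) →
        1 ≤ l → l ≤ 4 → ∃ λ X → length X ≡ l × All (Adj u) X × Theta (p ∷ q ∷ []) u v X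
      distantTheta {v} l f u≢v ¬a = cases
        where
        use : ∀ i j L {t : True (valid? (i , j) L)} → v ! p ≡ σ i → v ! q ≡ σ j →
          ∃ λ X → length X ≡ length L × All (Adj u) X × Theta (p ∷ q ∷ []) u v X
        use i j L {t} e e′ = map (W ∘ proj₁) L , length-map _ L , certified-starts (certify (i , j) L {t}) ,
          subst (λ v → Theta (p ∷ q ∷ []) u v (map (W ∘ proj₁) L)) (W-≡ i j f e e′) (certified (certify (i , j) L {t}))
        cases : (v ! p ≡ u ! q ⊎ v ! p ≡ x) → (v ! q ≡ u ! p ⊎ (v ! q ≡ x × v ! p ≢ x) ⊎ (v ! q ≡ y)) →
          1 ≤ l → l ≤ 4 → ∃ λ X → length X ≡ l × All (Adj u) X × Theta (p ∷ q ∷ []) u v X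
        cases e e′ 1≤l l≤4 = table l e e′ 1≤l l≤4
          where
          table : ∀ l → (v ! p ≡ u ! q ⊎ v ! p ≡ x) → (v ! q ≡ u ! p ⊎ (v ! q ≡ x × v ! p ≢ x) ⊎ (v ! q ≡ y)) →
            1 ≤ l → l ≤ 4 → ∃ λ X → length X ≡ l × All (Adj u) X × Theta (p ∷ q ∷ []) u v X
          table 1 (inj₁ e) (inj₁ e′) _ _ = use #1 #0 (((#0 , #2) , (#0 , #3) ∷ (#1 , #3) ∷ (#1 , #2) ∷ (#3 , #2) ∷ (#3 , #0) ∷ (#3 , #1) ∷ (#2 , #1) ∷ (#2 , #3) ∷ (#2 , #0) ∷ []) ∷ []) e e′
          table 2 (inj₁ e) (inj₁ e′) _ _ = use #1 #0 (((#0 , #2) , (#1 , #2) ∷ []) ∷ ((#0 , #3) , (#1 , #3) ∷ (#2 , #3) ∷ (#2 , #0) ∷ (#2 , #1) ∷ (#3 , #1) ∷ (#3 , #2) ∷ (#3 , #0) ∷ []) ∷ []) e e′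
          table 3 (inj₁ e) (inj₁ e′) _ _ = use #1 #0 (((#0 , #2) , (#1 , #2) ∷ []) ∷ ((#0 , #3) , (#1 , #3) ∷ (#2 , #3) ∷ (#2 , #0) ∷ []) ∷ ((#2 , #1) , (#3 , #1) ∷ (#3 , #2) ∷ (#3 , #0) ∷ []) ∷ []) e e′
          table 4 (inj₁ e) (inj₁ e′) _ _ = use #1 #0 (((#0 , #2) , (#1 , #2) ∷ []) ∷ ((#0 , #3) , (#1 , #3) ∷ []) ∷ ((#2 , #1) , (#2 , #3) ∷ (#2 , #0) ∷ []) ∷ ((#3 , #1) , (#3 , #2) ∷ (#3 , #0) ∷ []) ∷ []) e e′
          table 1 (inj₁ e) (inj₂ (inj₁ (e′ , _))) _ _ = use #1 #2 (((#0 , #2) , (#0 , #3) ∷ (#1 , #3) ∷ (#1 , #0) ∷ (#2 , #0) ∷ (#2 , #3) ∷ (#2 , #1) ∷ (#3 , #1) ∷ (#3 , #0) ∷ (#3 , #2) ∷ []) ∷ []) e e′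
          table 2 (inj₁ e) (inj₂ (inj₁ (e′ , _))) _ _ = use #1 #2 (((#0 , #2) , []) ∷ ((#0 , #3) , (#1 , #3) ∷ (#1 , #0) ∷ (#2 , #0) ∷ (#2 , #3) ∷ (#2 , #1) ∷ (#3 , #1) ∷ (#3 , #0) ∷ (#3 , #2) ∷ []) ∷ []) e e′
          table 3 (inj₁ e) (inj₂ (inj₁ (e′ , _))) _ _ = use #1 #2 (((#0 , #2) , []) ∷ ((#0 , #3) , (#1 , #3) ∷ []) ∷ ((#2 , #1) , (#2 , #3) ∷ (#2 , #0) ∷ (#1 , #0) ∷ (#3 , #0) ∷ (#3 , #1) ∷ (#3 , #2) ∷ []) ∷ []) e e′
          table 4 (inj₁ e) (inj₂ (inj₁ (e′ , _))) _ _ = use #1 #2 (((#0 , #2) , []) ∷ ((#0 , #3) , (#1 , #3) ∷ []) ∷ ((#2 , #1) , (#2 , #3) ∷ (#2 , #0) ∷ (#1 , #0) ∷ []) ∷ ((#3 , #1) , (#3 , #0) ∷ (#3 , #2) ∷ []) ∷ []) e e′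
          table 1 (inj₁ e) (inj₂ (inj₂ e′)) _ _ = use #1 #3 (((#0 , #2) , (#0 , #3) ∷ (#2 , #3) ∷ (#2 , #0) ∷ (#2 , #1) ∷ (#3 , #1) ∷ (#3 , #0) ∷ (#3 , #2) ∷ (#1 , #2) ∷ (#1 , #0) ∷ []) ∷ []) e e′
          table 2 (inj₁ e) (inj₂ (inj₂ e′)) _ _ = use #1 #3 (((#0 , #2) , (#1 , #2) ∷ []) ∷ ((#0 , #3) , (#2 , #3) ∷ (#2 , #0) ∷ (#2 , #1) ∷ (#3 , #1) ∷ (#3 , #2) ∷ (#3 , #0) ∷ (#1 , #0) ∷ []) ∷ []) e e′
          table 3 (inj₁ e) (inj₂ (inj₂ e′)) _ _ = use #1 #3 (((#0 , #2) , (#1 , #2) ∷ []) ∷ ((#0 , #3) , []) ∷ ((#2 , #1) , (#3 , #1) ∷ (#3 , #2) ∷ (#3 , #0) ∷ (#1 , #0) ∷ (#2 , #0) ∷ (#2 , #3) ∷ []) ∷ []) e e′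
          table 4 (inj₁ e) (inj₂ (inj₂ e′)) _ _ = use #1 #3 (((#0 , #2) , (#1 , #2) ∷ []) ∷ ((#0 , #3) , []) ∷ ((#2 , #1) , (#2 , #0) ∷ (#2 , #3) ∷ []) ∷ ((#3 , #1) , (#3 , #2) ∷ (#3 , #0) ∷ (#1 , #0) ∷ []) ∷ []) e e′
          table 1 (inj₂ e) (inj₁ e′) _ _ = use #2 #0 (((#0 , #2) , (#0 , #3) ∷ (#1 , #3) ∷ (#1 , #0) ∷ (#1 , #2) ∷ (#3 , #2) ∷ (#3 , #0) ∷ (#3 , #1) ∷ (#2 , #1) ∷ (#2 , #3) ∷ []) ∷ []) e e′
          table 2 (inj₂ e) (inj₁ e′) _ _ = use #2 #0 (((#0 , #2) , (#1 , #2) ∷ (#1 , #0) ∷ []) ∷ ((#0 , #3) , (#1 , #3) ∷ (#2 , #3) ∷ (#2 , #1) ∷ (#3 , #1) ∷ (#3 , #2) ∷ (#3 , #0) ∷ []) ∷ []) e e′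
          table 3 (inj₂ e) (inj₁ e′) _ _ = use #2 #0 (((#0 , #2) , (#1 , #2) ∷ (#1 , #0) ∷ []) ∷ ((#0 , #3) , (#1 , #3) ∷ (#2 , #3) ∷ []) ∷ ((#2 , #1) , (#3 , #1) ∷ (#3 , #2) ∷ (#3 , #0) ∷ []) ∷ []) e e′
          table 4 (inj₂ e) (inj₁ e′) _ _ = use #2 #0 (((#0 , #2) , (#1 , #2) ∷ (#1 , #0) ∷ []) ∷ ((#0 , #3) , (#1 , #3) ∷ (#2 , #3) ∷ []) ∷ ((#2 , #1) , []) ∷ ((#3 , #1) , (#3 , #2) ∷ (#3 , #0) ∷ []) ∷ []) e e′
          table 1 (inj₂ e) (inj₂ (inj₂ e′)) _ _ = use #2 #3 (((#0 , #2) , (#0 , #3) ∷ (#1 , #3) ∷ (#1 , #0) ∷ (#1 , #2) ∷ (#3 , #2) ∷ (#3 , #0) ∷ (#3 , #1) ∷ (#2 , #1) ∷ (#2 , #0) ∷ []) ∷ []) e e′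
          table 2 (inj₂ e) (inj₂ (inj₂ e′)) _ _ = use #2 #3 (((#0 , #2) , (#1 , #2) ∷ (#1 , #0) ∷ (#2 , #0) ∷ (#3 , #0) ∷ (#3 , #2) ∷ (#3 , #1) ∷ (#2 , #1) ∷ []) ∷ ((#0 , #3) , (#1 , #3) ∷ []) ∷ []) e e′
          table 3 (inj₂ e) (inj₂ (inj₂ e′)) _ _ = use #2 #3 (((#0 , #2) , (#1 , #2) ∷ (#1 , #0) ∷ (#1 , #3) ∷ []) ∷ ((#0 , #3) , []) ∷ ((#2 , #1) , (#3 , #1) ∷ (#3 , #2) ∷ (#3 , #0) ∷ (#2 , #0) ∷ []) ∷ []) e e′
          table 4 (inj₂ e) (inj₂ (inj₂ e′)) _ _ = use #2 #3 (((#0 , #2) , (#1 , #2) ∷ (#1 , #0) ∷ (#1 , #3) ∷ []) ∷ ((#0 , #3) , []) ∷ ((#2 , #1) , []) ∷ ((#3 , #1) , (#3 , #2) ∷ (#3 , #0) ∷ (#2 , #0) ∷ []) ∷ []) e e′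
          table _ (inj₂ e) (inj₂ (inj₁ (_ , ne))) _ _ = contradiction e ne
          table (suc (suc (suc (suc (suc _))))) _ _ _ (s≤s (s≤s (s≤s (s≤s ()))))

    missing-pair : ∀ {u} → Inj u → ∃ λ x → ∃ λ y → missing u ≡ x ∷ y ∷ []
    missing-pair {u} ι with missing u | missing-length ι
    ... | x ∷ y ∷ [] | _ = x , y , refl
    ... | [] | e = contradiction (≡-trans e m≡2) λ ()
    ... | _ ∷ [] | e = contradiction (≡-trans e m≡2) λ ()
    ... | _ ∷ _ ∷ _ ∷ _ | e = contradiction (≡-trans e m≡2) λ ()

    missing-first : ∀ {u t} → Inj u → Absent t u → ∃ λ y → missing u ↭ t ∷ y ∷ []
    missing-first {u} {t} ι t∉ with missing-pair ι
    ... | x , y , e with subst (t ∈_) e (∈-missing⁺ t∉)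
    ...   | here refl = y , ↭-reflexive e
    ...   | there (here refl) = x , ↭-trans (↭-reflexive e) (swap x y ↭-refl)

    adjacentAt : ∀ {p q} → p ≢ q → ∀ {u v X} → Inj u → Face u (p ∷ q ∷ []) v → (a : Adj u v) → at a ≡ p →
      All (λ x → Adj u x × Face u (p ∷ q ∷ []) x) X → List.Unique X → v ∉ X → X ≢ [] → Theta (p ∷ q ∷ []) u v X
    adjacentAt {p} {q} p≢q {u} {v} {X} ι f a refl X✓ uX v∉ X≢ with y , xy ← missing-first ι (adj-absent (faceInj f) a) =
      subst (λ v → Theta (p ∷ q ∷ []) u v X) eq (adjacentTheta X✓ uX (v∉ ∘ subst (_∈ X) eq) X≢)
      where
      open Labelled p q p≢q u ι (v ! p) y xy
      eq : W (#2 , #1) ≡ v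
      eq = W-≡ #2 #1 f refl (sym (agree a (p≢q ∘ sym)))

    squareAdjacent : ∀ {p q} → p ≢ q → AdjacentThetas (p ∷ q ∷ [])
    squareAdjacent {p} {q} p≢q ι f a X✓ uX v∉ X≢ with face-adj-∈ f a
    ... | here e = adjacentAt p≢q ι f a e X✓ uX v∉ X≢
    ... | there (here e) = theta-↭ (swap q p ↭-refl) ↭-refl
      (adjacentAt (p≢q ∘ sym) ι (face-↭ (swap p q ↭-refl) f) a e (All.map (λ (b , g) → b , face-↭ (swap p q ↭-refl) g) X✓) uX v∉ X≢)

    squareDistant : ∀ {p q} → p ≢ q → DistantThetas (p ∷ q ∷ [])
    squareDistant {p} {q} p≢q {u} {v} l ι f u≢v ¬a 1≤l l≤ = go (present? (v ! p) u) (present? (v ! q) u)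
      where
      uP : List.Unique (p ∷ q ∷ [])
      uP = (p≢q ∷ []) ∷ [] ∷ []
      open Copies (splitting p [ q ] uP) using (free; free-at)
      l≤4 : l ≤ 4
      l≤4 = ℕ.≤-trans l≤ (ℕ.≤-reflexive (cong (2 *_) m≡2))
      Result = ∃ λ X → length X ≡ l × All (Adj u) X × Theta (p ∷ q ∷ []) u v X
      agree-off : ∀ {c} → c ≢ p → c ≢ q → u ! c ≡ v ! c
      agree-off c≢p c≢q = sym (faceFixed f λ { (here e) → c≢p e ; (there (here e)) → c≢q e })
      p-differs : u ! p ≢ v ! p
      p-differs e = ¬a (adj q (λ e′ → u≢v (ext (same e′))) λ {c} c≢q → off c c≢q)
        where
        off : ∀ c → c ≢ q → u ! c ≡ v ! c
        off c c≢q with c ≟ p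
        ... | yes refl = e
        ... | no c≢p = agree-off c≢p c≢q
        same : u ! q ≡ v ! q → ∀ c → u ! c ≡ v ! c
        same e′ c with c ≟ q
        ... | yes refl = e′
        ... | no c≢q = off c c≢q
      q-differs : u ! q ≢ v ! q
      q-differs e = ¬a (adj p p-differs λ {c} c≢p → off c c≢p)
        where
        off : ∀ c → c ≢ p → u ! c ≡ v ! c
        off c c≢p with c ≟ q
        ... | yes refl = e
        ... | no c≢q = agree-off c≢p c≢q
      go : (∃ λ i → u ! i ≡ v ! p) ⊎ Absent (v ! p) u → (∃ λ i → u ! i ≡ v ! q) ⊎ Absent (v ! q) u → Result
      go (inj₁ (i , e)) r with free φ ← free-at f (here refl) with φ e
      ... | here refl = contradiction e p-differs
      ... | there (here refl) = go-q r
        where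
        go-q : (∃ λ i → u ! i ≡ v ! q) ⊎ Absent (v ! q) u → Result
        go-q (inj₁ (j , e′)) with free φ′ ← free-at f (there (here refl)) with φ′ e′
        ... | there (here refl) = contradiction e′ q-differs
        ... | here refl = let x , y , eq = missing-pair ι in
          Labelled.distantTheta p q p≢q u ι x y (↭-reflexive eq) l f u≢v ¬a (inj₁ (sym e)) (inj₁ (sym e′)) 1≤l l≤4
        go-q (inj₂ v∉) = let y , xy = missing-first ι v∉ in
          Labelled.distantTheta p q p≢q u ι (v ! q) y xy l f u≢v ¬a (inj₁ (sym e))
            (inj₂ (inj₁ (refl , λ e″ → p≢q (inj-app (faceInj f) e″)))) 1≤l l≤4
      go (inj₂ v∉) r = let y , xy = missing-first ι v∉ in
        Labelled.distantTheta p q p≢q u ι (v ! p) y xy l f u≢v ¬a (inj₂ refl) (second y xy r) 1≤l l≤4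
        where
        second : ∀ y → missing u ↭ v ! p ∷ y ∷ [] → (∃ λ i → u ! i ≡ v ! q) ⊎ Absent (v ! q) u →
          v ! q ≡ u ! p ⊎ (v ! q ≡ v ! p × v ! p ≢ v ! p) ⊎ (v ! q ≡ y)
        second y xy (inj₁ (j , e′)) with free φ′ ← free-at f (there (here refl)) with φ′ e′
        ... | there (here refl) = contradiction e′ q-differs
        ... | here refl = inj₁ (sym e′)
        second y xy (inj₂ v∉q) with ∈-resp-↭ xy (∈-missing⁺ v∉q)
        ... | here e″ = contradiction (sym (inj-app (faceInj f) e″)) p≢q
        ... | there (here e″) = inj₂ (inj₂ e″)
 

  -- From thetas to containers of the graph

  module Conversion (1≤k : 1 ≤ k) where

    Thetas : List (Fin k) → Set
    Thetas P = AdjacentThetas P × DistantThetas P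

    -- The induction step asks for `m ≥ 3` or two positions besides `p`; two positions in all with
    -- `m = 2` is what `Square` settles.
    enlarge : ∀ κ → (∀ P → List.Unique P → length P ≡ suc κ → Thetas P) → Dec (3 ≤ m) →
      ∀ P → List.Unique P → length P ≡ 2 + κ → Thetas P
    enlarge κ smaller (yes 3≤m) P u len = Step.adjacentThetas (suc κ) (s≤s z≤n) (inj₁ 3≤m) smaller P u len ,
      Step.distantThetas (suc κ) (s≤s z≤n) (inj₁ 3≤m) smaller P u len
    enlarge (suc κ) smaller (no _) P u len = Step.adjacentThetas (2 + κ) (s≤s z≤n) (inj₂ (s≤s (s≤s z≤n))) smaller P u len ,
      Step.distantThetas (2 + κ) (s≤s z≤n) (inj₂ (s≤s (s≤s z≤n))) smaller P u len
    enlarge zero _ (no m≱3) (p ∷ q ∷ []) ((p≢q ∷ _) ∷ _) _ = Square.squareAdjacent m≡2 p≢q , Square.squareDistant m≡2 p≢q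
      where
      m≡2 : m ≡ 2
      m≡2 = ℕ.≤-antisym (ℕ.≤-pred (ℕ.≰⇒> m≱3)) 2≤m

    thetas : ∀ κ P → List.Unique P → length P ≡ suc κ → Thetas P
    thetas zero (p ∷ []) _ _ = lineAdjacent p , lineDistant p
    thetas (suc κ) = enlarge κ (thetas κ) (3 ℕ.≤? m)

    everywhere : List (Fin k)
    everywhere = allFin k

    everywhere-length : length everywhere ≡ k
    everywhere-length = length-tabulate id

    inj⇒face : ∀ {u w} → Inj w → Face u everywhere w
    inj⇒face ι = face ι λ i∉ → contradiction (∈-allFin _) i∉

    internals : ∀ {u v X Y B} → Links X Y B → All (Adj u) X → All (λ y → Adj y v) Y →
      ∃ λ Is → length Is ≡ length X × All (_≢ []) Is × All (λ I → Linked Adj (u ∷ I ∷ʳ v)) Is × concat Is ≡ B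
    internals [] [] [] = [] , refl , [] , [] , refl
    internals {u} {v} (_∷_ {zs = zs} π Ls) (u~x ∷ X~) (y~v ∷ Y~)
      with Is , len , ne , ok , refl ← internals Ls X~ Y~ =
      zs ∷ Is , cong suc len , nonempty π ∷ ne , link u~x π y~v ∷ ok , refl
      where
      nonempty : ∀ {x y zs} → Walk x y zs → zs ≢ []
      nonempty stop ()
      nonempty (step _ _) ()
      link : ∀ {w x y zs} → Adj w x → Walk x y zs → Adj y v → Linked Adj (w ∷ zs ∷ʳ v)
      link a stop b = a ∷ b ∷ [-]
      link a (step c π) b = a ∷ link c π b

    record Internals (u v : V) (l : ℕ) : Set where
      field
        paths : List (List V)
        count : length paths ≡ l
        distinct : List.Unique paths
        linked : All (λ I → Linked Adj (u ∷ I ∷ʳ v)) paths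
        covers : Cover Inj (u ∷ v ∷ concat paths)

    fromTheta : ∀ {u v X} → Inj u → All (Adj u) X → Theta everywhere u v X →
      ∃ λ (I : Internals u v (length X)) → All (_≢ []) (Internals.paths I)
    fromTheta ι X~ (theta L ends~ C)
      with _ , _ , q , r , Ls ← fromStarts L
      with Is , len , ne , ok , refl ← internals Ls X~ (All-resp-↭ q ends~) =
      record { paths = Is ; count = len
             ; distinct = unique-concat⁻ ne (AllPairs.tail (AllPairs.tail (Cover.unique D)))
             ; linked = ok ; covers = D } , ne
      where
      D = cover-⇔ faceInj inj⇒face (cover-↭ (prep _ (prep _ r)) C)

    container : ∀ {u v} l → Inj u → Inj v → u ≢ v → 1 ≤ l → l ≤ k * m → Internals u v l
    container {u} {v} l ι ι′ u≢v 1≤l l≤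
      with adjacent , distant ← thetas (k ∸ 1) everywhere (Unique.allFin⁺ k) (≡-trans everywhere-length (sym (ℕ.m+[n∸m]≡n 1≤k)))
      with edgeThetas (Unique.allFin⁺ k) (subst (1 ≤_) (sym everywhere-length) 1≤k) adjacent distant l ι (inj⇒face ι′) u≢v 1≤l
             (subst (λ κ → l ≤ κ * m) (sym everywhere-length) l≤)
    ... | X , refl , _ , X✓ , inj₁ T = proj₁ (fromTheta ι (All.map proj₁ X✓) T)
    ... | X , refl , _ , X✓ , inj₂ (X′ , q , u~v , T)
      with I , ne ← fromTheta ι (All.map proj₁ (All.tail (All-resp-↭ q X✓))) T =
      -- The edge is the path with empty interior. All other interiors are nonempty, so it is
      -- distinct from them.
      record { paths = [] ∷ paths ; count = ≡-trans (cong suc count) (sym (↭-length q))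
             ; distinct = All.map (λ ne e → ne (sym e)) ne ∷ distinct
             ; linked = (u~v ∷ [-]) ∷ linked ; covers = covers }
      where open Internals I

    unique? : (w : V) → Dec (Vec.Unique w)
    unique? = VecPairs.allPairs? (λ x y → ¬? (x ≟ y))

    unique⇒inj : ∀ {w} → Vec.Unique w → Inj w
    unique⇒inj u = inj λ {i} {j} → VecUnique.lookup-injective u i j

    inj⇒unique : ∀ {w} → Inj w → Vec.Unique w
    inj⇒unique {w} (inj ι) = subst Vec.Unique (tabulate∘lookup w) (VecUnique.tabulate⁺ ι)

    -- The uniqueness proof inside a vertex is irrelevant; it is recovered by deciding uniqueness
    -- anew.
    vertex-inj : (x : ArrangementVertex n k) → Inj (value x)
    vertex-inj (w , irrelevant u) = unique⇒inj (recompute (unique? w) u)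

    open Graph (A n k) using (_~_)

    adj⇒~ : ∀ {x y : ArrangementVertex n k} → Adj (value x) (value y) → x ~ y
    adj⇒~ {x} {y} (adj j d s) = j , d , λ {i} d′ → only i d′
      where
      only : ∀ i → value x ! i ≢ value y ! i → j ≡ i
      only i d′ with i ≟ j
      ... | yes e = sym e
      ... | no i≢j = contradiction (s i≢j) d′

    ~⇒adj : ∀ {x y : ArrangementVertex n k} → x ~ y → Adj (value x) (value y)
    ~⇒adj {x} {y} (j , d , only) = adj j d λ {i} i≢j → same i i≢j
      where
      same : ∀ i → i ≢ j → value x ! i ≡ value y ! i
      same i i≢j with value x ! i ≟ value y ! i
      ... | yes e = e
      ... | no d′ = contradiction (sym (only d′)) i≢j

    module Lifting (x₀ : ArrangementVertex n k) where

      -- x₀ is a default value for vectors with repetitions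
      lift : V → ArrangementVertex n k
      lift w with unique? w
      ... | yes u = w , irrelevant u
      ... | no _ = x₀

      value-lift : ∀ {w} → Inj w → value (lift w) ≡ w
      value-lift {w} ι with unique? w
      ... | yes _ = refl
      ... | no ¬u = contradiction (inj⇒unique ι) ¬u

      lift-value : ∀ x → lift (value x) ≡ x
      lift-value x = value-injective (value-lift (vertex-inj x))

      lift-injective : ∀ {w w′} → Inj w → Inj w′ → lift w ≡ lift w′ → w ≡ w′
      lift-injective ι ι′ e = ≡-trans (sym (value-lift ι)) (≡-trans (cong value e) (value-lift ι′))

      lift-linked : ∀ {ws} → All Inj ws → Linked Adj ws → Linked _~_ (map lift ws)
      lift-linked _ [] = []
      lift-linked _ [-] = [-]
      lift-linked {w ∷ w′ ∷ _} (ι ∷ ι′ ∷ ιs) (a ∷ l) =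
        adj⇒~ {lift w} {lift w′} (subst (λ z → Adj z (value (lift w′))) (sym (value-lift ι)) (subst (Adj w) (sym (value-lift ι′)) a)) ∷ lift-linked (ι′ ∷ ιs) l

    module _ (x y : ArrangementVertex n k) where
      open Lifting x

      private
        u = value x
        v = value y

      toContainer : ∀ {l} → 1 ≤ l → Internals u v l → (l *-Container) (A n k) x y
      toContainer {l} 1≤l I = subst (λ l → (l *-Container) (A n k) x y) count (C , spanning)
        where
        open Internals I
        module K = Cover covers
        inside : ∀ i {w} → w ∈ L.lookup paths i → w ∈ concat paths
        inside i = lookup⊆concat paths i
        concat-unique : List.Unique (concat paths)
        concat-unique = AllPairs.tail (AllPairs.tail K.unique)
        I-inj : ∀ i {w} → w ∈ L.lookup paths i → Inj w
        I-inj i w∈ = K.sound (there (there (inside i w∈)))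
        full : Fin (length paths) → List V
        full i = u ∷ L.lookup paths i ∷ʳ v
        sub : ∀ i {w} → w ∈ full i → w ∈ u ∷ v ∷ L.lookup paths i
        sub i (here e) = here e
        sub i (there w∈) = there (∈-resp-↭ (++-comm (L.lookup paths i) (v ∷ [])) w∈)
        full-inj : ∀ i → All Inj (full i)
        full-inj i = All.tabulate λ w∈ → case i (sub i w∈)
          where
          case : ∀ i {w} → w ∈ u ∷ v ∷ L.lookup paths i → Inj w
          case i (here refl) = vertex-inj x
          case i (there (here refl)) = vertex-inj y
          case i (there (there w∈)) = I-inj i w∈
        full-unique : ∀ i → List.Unique (full i)
        full-unique i = Unique-resp-↭ (prep u (++-comm (v ∷ []) (L.lookup paths i)))
          (unique-∷ (λ { (here e) → unique-∉ K.unique (here e) ; (there w∈) → unique-∉ K.unique (there (inside i w∈)) })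
            (unique-∷ (λ w∈ → unique-∉ (AllPairs.tail K.unique) (inside i w∈)) (lookup-unique paths i concat-unique)))
        full≡ : ∀ i → map lift (full i) ≡ x ∷ map lift (L.lookup paths i) ∷ʳ y
        full≡ i = cong₂ _∷_ (lift-value x) (≡-trans (map-++ lift (L.lookup paths i) (v ∷ [])) (cong (λ z → map lift (L.lookup paths i) ∷ʳ z) (lift-value y)))
        path : Fin (length paths) → Path (A n k) x y
        path i = record
          { internal = map lift (L.lookup paths i)
          ; linked = subst (Linked _~_) (full≡ i) (lift-linked (full-inj i) (All.lookup linked (∈-lookup i)))
          ; unique = subst List.Unique (full≡ i)
              (unique-map (λ a b → lift-injective (All.lookup (full-inj i) a) (All.lookup (full-inj i) b)) (full-unique i))
          }
        unlift : ∀ {Z} → All Inj Z → map value (map lift Z) ≡ Z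
        unlift [] = refl
        unlift (ι ∷ ιs) = cong₂ _∷_ (value-lift ι) (unlift ιs)
        unlift-path : ∀ i → map value (map lift (L.lookup paths i)) ≡ L.lookup paths i
        unlift-path i = unlift (All.tabulate (I-inj i))
        C : Container (A n k) (length paths) x y
        C = record
          { path = path
          ; distinct = λ {i} {j} i≢j e → i≢j (lookup-injective distinct
              (≡-trans (sym (unlift-path i)) (≡-trans (cong (map value) (proj₁ (∷ʳ-injective _ _ (proj₂ (∷-injective e))))) (unlift-path j))))
          ; disjoint = λ {i} {j} i≢j (z∈ , z∈′) → lookup-disjoint paths concat-unique i≢j
              (subst (_ ∈_) (unlift-path i) (∈-map⁺ value z∈) , subst (_ ∈_) (unlift-path j) (∈-map⁺ value z∈′))
          }
        -- Any path contains both end vertices, and `1 ≤ l` guarantees that there is one.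
        some : ∃ λ (i : Fin (length paths)) → i ≡ i
        some with paths | count
        ... | [] | refl = contradiction 1≤l λ ()
        ... | _ ∷ _ | _ = zero , refl
        spanning : Spanning C
        spanning z with K.complete (vertex-inj z)
        ... | here e = proj₁ some , here (value-injective e)
        ... | there (here e) = proj₁ some , there (∈-++⁺ʳ (map lift (L.lookup paths (proj₁ some))) (here (value-injective e)))
        ... | there (there z∈) with i , z∈i ← concat-index paths z∈ =
          i , there (∈-++⁺ˡ (subst (_∈ map lift (L.lookup paths i)) (lift-value z) (∈-map⁺ lift z∈i)))

      spanningContainer : ∀ l → 1 ≤ l → l ≤ k * m → x ≢ y → (l *-Container) (A n k) x y
      spanningContainer l 1≤l l≤ x≢y =
        toContainer 1≤l (container l (vertex-inj x) (vertex-inj y) (x≢y ∘ value-injective) 1≤l l≤)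

    -- An upper bound for the connectivity

    module Neighbourhood (u₀ : V) (ι₀ : Inj u₀) where

      x₀ : ArrangementVertex n k
      x₀ = u₀ , irrelevant (inj⇒unique ι₀)

      open Lifting x₀

      N : List (ArrangementVertex n k)
      N = map lift (nbrs everywhere u₀)

      N-inj : ∀ {w} → w ∈ nbrs everywhere u₀ → Inj w
      N-inj w∈ = faceInj (nbr-face ι₀ w∈)

      N-length : length N ≡ k * m
      N-length = ≡-trans (length-map lift (nbrs everywhere u₀)) (≡-trans (nbrs-length ι₀) (cong (_* m) everywhere-length))

      N-unique : List.Unique N
      N-unique = unique-map (λ a b → lift-injective (N-inj a) (N-inj b)) (nbrs-unique (Unique.allFin⁺ k))

      adj⇒∈N : ∀ {x} → Adj u₀ (value x) → x ∈ N
      adj⇒∈N {x} a = subst (_∈ N) (lift-value x) (∈-map⁺ lift (face-adj⇒nbr (inj⇒face (vertex-inj x)) a))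

      ∈N⇒adj : ∀ {x} → x ∈ N → Adj u₀ (value x)
      ∈N⇒adj x∈ with w , w∈ , refl ← ∈-map⁻ lift x∈ = subst (Adj u₀) (sym (value-lift (N-inj w∈))) (nbr-adj w∈)

      -- Deleting its neighbours isolates `u₀`. For `k = 1` no other vertex remains; for larger `k`
      -- a vertex that differs from `u₀` at two positions survives and cannot be reached.
      separates : Separates (A n k) N
      separates = N-unique , far (k ℕ.≟ 1)
        where
        disconnects : ∀ {v} → Inj v → v ≢ u₀ → ¬ Adj u₀ v → ¬ Connected (A n k ─ N)
        disconnects {v} ι v≢u ¬a conn = go (conn s t λ e → v≢u (sym (cong (value ∘ value) e)))
          where
          y : ArrangementVertex n k
          y = v , irrelevant (inj⇒unique ι)
          s t : Graph.Vertex (A n k ─ N)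
          s = x₀ , irrelevant (adj-irrefl ∘ ∈N⇒adj)
          t = y , irrelevant (¬a ∘ ∈N⇒adj)
          -- The first edge out of `u₀` leads to a neighbour, which is neither the target nor still
          -- present.
          go : ¬ Path (A n k ─ N) s t
          go record { internal = [] ; linked = x₀~y ∷ _ } = ¬a (~⇒adj {x₀} {y} x₀~y)
          go record { internal = (z , irrelevant z∉) ∷ _ ; linked = x₀~z ∷ _ } = ⊥-elim-irr (z∉ (adj⇒∈N (~⇒adj {x₀} {z} x₀~z)))
        far : Dec (k ≡ 1) → ¬ Connected (A n k ─ N) ⊎ Trivial (A n k ─ N)
        far (yes k≡1) = inj₂ λ a b → value-injective (≡-trans (only a) (sym (only b)))
          where
          collapse : ∀ {k} → k ≡ 1 → (i j : Fin k) → i ≡ j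
          collapse refl zero zero = refl
          only : (a : Graph.Vertex (A n k ─ N)) → value a ≡ x₀
          only (z , irrelevant z∉) with value z ≟ᵛ u₀
          ... | yes e = value-injective e
          ... | no ne = ⊥-elim-irr (z∉ (adj⇒∈N (near ne)))
            where
            near : ∀ {w} → w ≢ u₀ → Adj u₀ w
            near {w} ne = adj i₀ (λ e → ne (ext λ i → subst (λ i → w ! i ≡ u₀ ! i) (collapse k≡1 i₀ i) (sym e)))
              λ {i} i≢ → contradiction (collapse k≡1 i i₀) i≢
              where
              i₀ : Fin k
              i₀ = subst Fin (sym k≡1) zero
        far (no k≢1) with i , j , i≢j ← twoPositions 1≤k k≢1
          with t , t∉ , _ ← fresh ι₀ [] (ℕ.≤-trans (s≤s z≤n) 2≤m)
          with t′ , t′∉ , t′≢ ← fresh ι₀ (t ∷ []) 2≤m =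
          inj₁ (disconnects (≔-inj j (≔-inj i ι₀ t∉) (≔-absent i t′∉ λ e → t′≢ (here (sym e)))) (λ e → i-differs (sym (cong (_! i) e))) nonadjacent)
          where
          w = u₀ [ i ≔ t ] [ j ≔ t′ ]
          i-differs : u₀ ! i ≢ w ! i
          i-differs e = absent-app t∉ i (≡-trans e (≡-trans (≔-other _ t′ i≢j) (≔-same u₀ i t)))
          j-differs : u₀ ! j ≢ w ! j
          j-differs e = absent-app t′∉ j (≡-trans e (≔-same _ j t′))
          nonadjacent : ¬ Adj u₀ w
          nonadjacent (adj c _ s) with i ≟ c
          ... | no i≢c = i-differs (s i≢c)
          ... | yes refl = j-differs (s (i≢j ∘ sym))

    connectivity-bound : ∀ κ → IsConnectivity (A n k) κ → κ ≤ k * m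
    connectivity-bound κ (_ , least) = ℕ.≤-trans (least N separates) (ℕ.≤-reflexive N-length)
      where
      k≤n : k ≤ n
      k≤n = ℕ.≤-trans (ℕ.m≤m+n k m) (ℕ.≤-reflexive (sym n≡k+m))
      first : V
      first = tabulate λ i → inject≤ i k≤n
      first-inj : Inj first
      first-inj = inj λ {i} {j} e → Fin.inject≤-injective k≤n k≤n i j
        (≡-trans (sym (lookup∘tabulate _ i)) (≡-trans e (lookup∘tabulate _ j)))
      open Neighbourhood first first-inj

theorem1 : (n k : ℕ) → 4 ≤ n → 1 ≤ k → 2 ≤ n ∸ k →
    SuperSpanningConnected (A n k)
    × (∀ (l : ℕ) → 1 ≤ l → l ≤ k * (n ∸ k) →
    ∀ (u v : ArrangementVertex n k) → u ≢ v → (l *-Container) (A n k) u v)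
theorem1 n k _ 1≤k 2≤m =
  (λ κ isκ l 1≤l l≤κ u v → containers l 1≤l (ℕ.≤-trans l≤κ (Arrangement.Conversion.connectivity-bound Ω 1≤k κ isκ)) u v) ,
  containers
  where
  Ω : Parameters
  Ω = parameters n k (n ∸ k)
    -- The truncated difference is at least 2, hence nonzero, which forces `k < n`.
    (sym (ℕ.m+[n∸m]≡n (ℕ.<⇒≤ (ℕ.m∸n≢0⇒n<m {n} {k} λ e → contradiction (subst (2 ≤_) e 2≤m) λ ())))) 2≤m
  containers : ∀ l → 1 ≤ l → l ≤ k * (n ∸ k) → ∀ (u v : ArrangementVertex n k) → u ≢ v → (l *-Container) (A n k) u v
  containers l 1≤l l≤ u v = Arrangement.Conversion.spanningContainer Ω 1≤k u v l 1≤l l≤
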